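{- Let $K$ be a commutative $\mathbb Q$-algebra, $n\ge 1$, and let $P\in K[[X_1,\ldots,X_n]]$ be such that every component of $\nabla P=(D_1P,\ldots,D_nP)$ has only terms of degree $\ge 2$. Let $F=X-\nabla P$ and let $G=(G_1,\ldots,G_n)$ be the formal inverse of $F$. Then $G=X+\nabla Q$, where $$Q=\sum_{T\in\mathbb T}\frac{1}{|\mathrm{Aut}\,T|}\,\mathcal Q_{T,P},\qquad \mathcal Q_{T,P}=\sum_{\ell:E(T)\to\{1,\ldots,n\}}\ \prod_{v\in V(T)}D_{\mathrm{adj}(v)}P .$$
   Context: $X=(X_1,\ldots,X_n)$ and $D_i=\partial/\partial X_i$. A formal map of special type is a system $F=(F_1,\ldots,F_n)$ of power series over $K$ with each $F_i$ of the form $X_i+(\text{terms of degree}\ge 2)$; it has a unique formal inverse, i.e. a formal map $G$ of special type with $F\circ G=G\circ F=X$. $\mathbb T$ denotes the set of isomorphism classes of finite free (unrooted) trees; for a tree $T$, $V(T)$ and $E(T)$ are its sets of vertices and edges and $\mathrm{Aut}\,T$ is its automorphism group. Given a labeling $\ell:E(T)\to\{1,\ldots,n\}$ and $v\in V(T)$, $\mathrm{adj}(v)=\{e_1,\ldots,e_s\}$ is the set of edges adjacent to $v$, and $D_{\mathrm{adj}(v)}=D_{\ell(e_1)}\cdots D_{\ell(e_s)}$ (the identity operator if $s=0$). The infinite sum is understood in the formal (adic) sense. -}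

module Defs where

open import Algebra.Bundles using (CommutativeRing; RawRing)
open import Algebra.Morphism.Structures using (IsRingHomomorphism)
import Algebra.Definitions.RawSemiring as RawSemiringOps
open import Data.Bool.Base using (Bool; T)
open import Data.Bool.Properties using (T?) renaming (_≟_ to _≟ᵇ_)
open import Data.Fin.Base using (Fin; toℕ; finToFun; funToFin)
open import Data.Fin.Properties using (_≟_; _<?_; all?; any?; finToFun-funToFin)
open import Data.Integer.Base using (+_)
open import Data.List.Base as List using (List; []; _∷_; _∷ʳ_; allFin; cartesianProduct; filter; foldr; length)
open import Data.List.Membership.Propositional.Properties using (∈-allFin; ∈-filter⁺; ∈-length)
import Data.List.Membership.Setoid as SetoidMembership
open import Data.List.Relation.Unary.Linked using (Linked)
open import Data.List.Relation.Unary.Unique.Propositional using (Unique)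
import Data.List.Relation.Unary.Unique.Setoid as SetoidUnique
open import Data.Nat.Base as ℕ using (ℕ; zero; suc; _∸_; NonZero; >-nonZero)
open import Data.Nat.Properties using () renaming (_≟_ to _≟ⁿ_)
open import Data.Product.Base using (_×_; _,_; proj₁; proj₂; ∃-syntax)
open import Data.Rational.Base as ℚ using (ℚ)
open import Data.Vec.Base as Vec using (Vec; []; _∷_; lookup; _[_]%=_; _[_]≔_)
import Data.Vec.Properties as Vec
open import Function.Base using (id; _∘_)
open import Function.Consequences.Propositional using (strictlySurjective⇒surjective)
import Function.Construct.Composition as Composition
import Function.Construct.Identity as Identity
import Function.Construct.Symmetry as Symmetry
open import Function.Definitions using (Injective; Surjective; Bijective)
open import Level using (Level; 0ℓ; _⊔_) renaming (suc to lsuc)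
open import Relation.Binary.Bundles using (Setoid)
open import Relation.Binary.Construct.Closure.ReflexiveTransitive using (Star)
open import Relation.Binary.Core using (Rel)
open import Relation.Binary.Definitions using (Symmetric; Irreflexive)
open import Relation.Binary.PropositionalEquality using (_≡_; _≗_; refl; sym; trans; cong; cong₂)
open import Relation.Nullary.Decidable using (Dec; yes; no; map′; _×-dec_; _⊎-dec_; _→-dec_)
open import Relation.Nullary.Negation.Core using (¬_)

private
  variable
    c ℓ : Level
    m n : ℕ

-- Every finite vertex set is in bijection with some Fin order, so this covers
-- all finite simple graphs up to isomorphism.
record Graph : Set where
  field
    order : ℕ
    adj   : Fin order → Fin order → Bool

  Vertex : Set
  Vertex = Fin order

  _~_ : Rel Vertex 0ℓ
  u ~ v = T (adj u v)

  field
    symmetric   : Symmetric _~_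
    irreflexive : Irreflexive _≡_ _~_

  -- An edge {u , v} is listed once, as the ordered pair with u < v.
  edges : List (Vertex × Vertex)
  edges = filter (λ (u , v) → (u <? v) ×-dec T? (adj u v))
                 (cartesianProduct (allFin order) (allFin order))

  size : ℕ
  size = length edges

  Edge : Set
  Edge = Fin size

  incident : Vertex → List Edge
  incident v = filter (λ e → (v ≟ proj₁ (List.lookup edges e)) ⊎-dec
                             (v ≟ proj₂ (List.lookup edges e)))
                      (allFin size)

  Connected : Set
  Connected = ∀ u v → Star _~_ u v

  -- The closed walk v, w₁, …, wₖ, v with v, w₁, …, wₖ distinct and k ≥ 2.
  record IsCycle (v : Vertex) (ws : List Vertex) : Set where
    field
      distinct : Unique (v ∷ ws)
      closed   : Linked _~_ (v ∷ (ws ∷ʳ v))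
      long     : 2 ℕ.≤ length ws

  Acyclic : Set
  Acyclic = ∀ v ws → ¬ IsCycle v ws

record Tree : Set where
  field
    graph     : Graph
  open Graph graph public
  field
    nonEmpty  : NonZero order
    connected : Connected
    acyclic   : Acyclic

record IsIsomorphism (S T : Tree) (f : Tree.Vertex S → Tree.Vertex T) : Set where
  field
    bijective : Bijective _≡_ _≡_ f
    adj-resp  : ∀ u v → Tree.adj S u v ≡ Tree.adj T (f u) (f v)

_≅_ : Rel Tree 0ℓ
S ≅ T = ∃[ f ] IsIsomorphism S T f

-- Working with this setoid amounts to working with isomorphism classes.
𝕋 : Setoid 0ℓ 0ℓ
𝕋 = record
  { Carrier       = Tree
  ; _≈_           = _≅_
  ; isEquivalence = record
    { refl  = id , record { bijective = Identity.bijective _≡_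
                          ; adj-resp  = λ _ _ → refl }
    ; sym   = ≅-sym
    ; trans = λ (f , p) (g , q) → g ∘ f , record
      { bijective = Composition.bijective _≡_ _≡_ _≡_ (bijective p) (bijective q)
      ; adj-resp  = λ u v → trans (adj-resp p u v) (adj-resp q (f u) (f v))
      }
    }
  }
  where
  open IsIsomorphism
  ≅-sym : Symmetric _≅_
  ≅-sym {S} {T} (f , p) = f⁻¹ , record
    { bijective = Symmetry.bijective (bijective p) refl sym trans (cong f)
    ; adj-resp  = λ u v → sym (trans (adj-resp p (f⁻¹ u) (f⁻¹ v))
                                     (cong₂ (Tree.adj T) (f∘f⁻¹ u) (f∘f⁻¹ v)))
    }
    where
    f⁻¹ : Tree.Vertex T → Tree.Vertex S
    f⁻¹ = proj₁ ∘ proj₂ (bijective p)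
    f∘f⁻¹ : ∀ v → f (f⁻¹ v) ≡ v
    f∘f⁻¹ v = proj₂ (proj₂ (bijective p) v) refl

bijective? : (f : Fin m → Fin n) → Dec (Bijective _≡_ _≡_ f)
bijective? f = injective? ×-dec surjective?
  where
  injective? : Dec (Injective _≡_ _≡_ f)
  injective? = map′ (λ inj {x} {y} → inj x y) (λ inj x y → inj {x} {y})
                    (all? λ x → all? λ y → (f x ≟ f y) →-dec (x ≟ y))
  surjective? : Dec (Surjective _≡_ _≡_ f)
  surjective? = map′ strictlySurjective⇒surjective (λ surj y → proj₁ (surj y) , proj₂ (surj y) refl)
                     (all? λ y → any? λ x → f x ≟ y)

isIsomorphism? : ∀ S T f → Dec (IsIsomorphism S T f)
isIsomorphism? S T f =
  map′ (λ (b , r) → record { bijective = b ; adj-resp = r })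
       (λ p → IsIsomorphism.bijective p , IsIsomorphism.adj-resp p)
       (bijective? f ×-dec
        (all? λ u → all? λ v → Tree.adj S u v ≟ᵇ Tree.adj T (f u) (f v)))

-- finToFun enumerates the maps Vertex → Vertex, each exactly once up to _≗_.
automorphisms : (T : Tree) → List (Fin (Tree.order T ℕ.^ Tree.order T))
automorphisms T = filter (λ k → isIsomorphism? T T (finToFun k)) (allFin _)

∣Aut_∣ : Tree → ℕ
∣Aut T ∣ = length (automorphisms T)

∣Aut∣-nonZero : ∀ T → NonZero ∣Aut T ∣
∣Aut∣-nonZero T = >-nonZero (∈-length
  (∈-filter⁺ (λ k → isIsomorphism? T T (finToFun k)) (∈-allFin code) id-iso))
  where
  open Tree T using (order; Vertex; adj)

  code : Fin (order ℕ.^ order)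
  code = funToFin {order} id

  f : Vertex → Vertex
  f = finToFun code

  f≗id : f ≗ id
  f≗id = finToFun-funToFin {order} id

  id-iso : IsIsomorphism T T f
  id-iso = record
    { bijective = (λ {x} {y} eq → trans (sym (f≗id x)) (trans eq (f≗id y)))
                , (λ y → y , λ { refl → f≗id y })
    ; adj-resp  = λ u v → sym (cong₂ adj (f≗id u) (f≗id v))
    }

1/∣Aut_∣ : Tree → ℚ
1/∣Aut T ∣ = (+ 1 ℚ./ ∣Aut T ∣) {{∣Aut∣-nonZero T}}

record Commutativeℚ-Algebra (c ℓ : Level) : Set (lsuc (c ⊔ ℓ)) where
  field
    commutativeRing : CommutativeRing c ℓ
  open CommutativeRing commutativeRing public
  field
    fromℚ              : ℚ → Carrier
    isRingHomomorphism : IsRingHomomorphism ℚ.+-*-rawRing rawRing fromℚ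

MultiIndex : ℕ → Set
MultiIndex n = Vec ℕ n

∣_∣ : MultiIndex n → ℕ
∣ α ∣ = Vec.sum α

module PowerSeries (K : Commutativeℚ-Algebra c ℓ) (n : ℕ) where

  private
    module K = Commutativeℚ-Algebra K
    module Kᵒ = RawSemiringOps (RawRing.rawSemiring K.rawRing)

  K[[X]] : Set c
  K[[X]] = MultiIndex n → K.Carrier

  -- Σ over all pairs (β , γ) with β + γ ≡ α.
  ∑-splits : (α : MultiIndex m) → (MultiIndex m → MultiIndex m → K.Carrier) → K.Carrier
  ∑-splits []      h = h [] []
  ∑-splits (a ∷ α) h =
    Kᵒ.sum {suc a} λ k → ∑-splits α λ β γ → h (toℕ k ∷ β) (a ∸ toℕ k ∷ γ)

  -- Σ over all β with every component at most d.
  ∑-box : ∀ m (d : ℕ) → (MultiIndex m → K.Carrier) → K.Carrier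
  ∑-box zero    d h = h []
  ∑-box (suc m) d h = Kᵒ.sum {suc d} λ k → ∑-box m d λ β → h (toℕ k ∷ β)

  0ᵐ : MultiIndex n
  0ᵐ = Vec.replicate n 0

  monomial : MultiIndex n → K[[X]]
  monomial α β with Vec.≡-dec _≟ⁿ_ α β
  ... | yes _ = K.1#
  ... | no  _ = K.0#

  rawRing : RawRing c ℓ
  rawRing = record
    { Carrier = K[[X]]
    ; _≈_     = λ f g → ∀ α → f α K.≈ g α
    ; _+_     = λ f g α → f α K.+ g α
    ; _*_     = λ f g α → ∑-splits α λ β γ → f β K.* g γ
    ; -_      = λ f α → K.- f α
    ; 0#      = λ _ → K.0#
    ; 1#      = monomial 0ᵐ
    }

  open RawRing rawRing public using (_≈_; _+_; _*_; -_; 0#; 1#)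
  open RawSemiringOps (RawRing.rawSemiring rawRing) public using (_^_; sum; product)

  infixr 7 _•_
  _•_ : ℚ → K[[X]] → K[[X]]
  (q • f) α = K.fromℚ q K.* f α

  OnlyDegrees≥ : ℕ → K[[X]] → Set ℓ
  OnlyDegrees≥ d f = ∀ α → ∣ α ∣ ℕ.< d → f α K.≈ K.0#

  D : Fin n → K[[X]] → K[[X]]
  D i f α = suc (lookup α i) Kᵒ.× f (α [ i ]%= suc)

  -- The formal (adic) sum of a family indexed by the classes of a setoid: each
  -- coefficient is a finite sum over pairwise inequivalent indices, outside whose
  -- classes that coefficient vanishes. Meaningful for families compatible with
  -- the equivalence of I.
  HasSum : ∀ {i e} (I : Setoid i e) → (Setoid.Carrier I → K[[X]]) → K[[X]] → Set (i ⊔ e ⊔ ℓ)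
  HasSum I f s = ∀ α → ∃[ xs ] Unique′ xs
                             × (∀ x → x ∉ xs → f x α K.≈ K.0#)
                             × foldr (λ x r → f x α K.+ r) K.0# xs K.≈ s α
    where
    open SetoidMembership I using (_∉_)
    open SetoidUnique I using () renaming (Unique to Unique′)

  FormalMap : Set c
  FormalMap = Fin n → K[[X]]

  infix 4 _≋_
  _≋_ : Rel FormalMap ℓ
  F ≋ G = ∀ i → F i ≈ G i

  infixl 6 _⊕_ _⊖_
  _⊕_ _⊖_ : FormalMap → FormalMap → FormalMap
  (F ⊕ G) i = F i + G i
  (F ⊖ G) i = F i + (- G i)

  X : FormalMap
  X i = monomial (0ᵐ [ i ]≔ 1)

  ∇ : K[[X]] → FormalMap
  ∇ f i = D i f

  SpecialType : FormalMap → Set ℓ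
  SpecialType F = ∀ i → OnlyDegrees≥ 2 (F i + (- X i))

  -- f(G₁, …, Gₙ) for G without constant terms: G^β then has only terms of
  -- degree ≥ |β|, so the coefficient at α involves no β with a component
  -- exceeding |α|. For other G this is not a meaningful substitution.
  substitute : K[[X]] → FormalMap → K[[X]]
  substitute f G α =
    ∑-box n ∣ α ∣ λ β → f β K.* product (λ j → G j ^ lookup β j) α

  infixr 9 _⊚_
  _⊚_ : FormalMap → FormalMap → FormalMap
  (F ⊚ G) i = substitute (F i) G

  record IsFormalInverse (F G : FormalMap) : Set ℓ where
    field
      specialType : SpecialType G
      inverseʳ    : F ⊚ G ≋ X
      inverseˡ    : G ⊚ F ≋ X

  D-adj : (T : Tree) → (Tree.Edge T → Fin n) → Tree.Vertex T → K[[X]] → K[[X]]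
  D-adj T label v f = foldr (λ e → D (label e)) f (Tree.incident T v)

  -- finToFun enumerates the labelings Edge → Fin n.
  𝒬 : Tree → K[[X]] → K[[X]]
  𝒬 T P = sum {n ℕ.^ Tree.size T} λ k →
          product λ v → D-adj T (finToFun k) v P

{-# OPTIONS --safe #-}

-- Let S(A) be the sum of 𝒬_{T,P} over all trees T with vertex set A. Deleting an
-- oriented edge splits a tree on A into trees on B and A ∖ B, whence
-- 2 (|A| − 1) S(A) = Σ_{B ⊆ A} ⟨∇S(B) , ∇S(A ∖ B)⟩; in particular S(A) depends on |A|
-- only. By orbit–stabilizer q_N = S({1,…,N}) / N! is the sum of 𝒬_{T,P} / |Aut T| over
-- the isomorphism classes of order N, and the recursion says that the gradients
-- V = Σ_N t^{N−1} ∇q_N solve the Burgers equation ∂V/∂t = (V · ∇) V with V = ∇P at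
-- t = 0. Hence V is constant along the characteristics X − t ∇P, that is
-- V(t)(X − t ∇P) = ∇P; at t = 1 this says (X + ∇Q) ∘ F = X. Finally, A ∘ F = 0 forces
-- A = 0 because F = X + (terms of degree ≥ 2), so G ∘ F = X gives G = X + ∇Q.
-- A tree of order N ≥ 2 contributes only in degrees ≥ N, so all sums are adically
-- locally finite.
module Submission where

open import Defs
open import Defs using () renaming (∣_∣ to deg)
open import Algebra.Bundles using (CommutativeMonoid; CommutativeRing)
import Algebra.Definitions.RawMonoid as RawMonoidOps
open import Algebra.Morphism.Structures using (IsRingHomomorphism)
open import Data.Bool.Base using (Bool; true; false; if_then_else_; T)
open import Data.Bool.Properties using (T?) renaming (_≟_ to _≟ᵇ_)
open import Data.Empty using (⊥)
open import Data.Fin.Base using (Fin; zero; suc; toℕ; fromℕ<; finToFun; combine; remQuot; funToFin)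
  renaming (_<_ to _<ᶠ_)
open import Data.Fin.Properties as Fin using (all?; any?; _≟_; _<?_)
open import Data.Fin.Subset using (Subset; inside; outside; ⊤; ⁅_⁆; _∪_; _─_; _⊆_; Nonempty)
  renaming (_∈_ to _∈ˢ_; _∉_ to _∉ˢ_; ∣_∣ to card)
open import Data.Fin.Subset.Properties as Subset using (_∈?_; _⊆?_)
open import Data.Integer.Base as ℤ using (+_)
open import Data.Integer.Properties as ℤ using ()
open import Data.List.Base as List using (List; []; _∷_; _++_; map; foldr; filter; cartesianProduct; allFin; length; cartesianProductWith; _∷ʳ_; deduplicate)
open import Data.List.Membership.DecPropositional as DecMembership using ()
open import Data.List.Membership.Propositional using (_∈_; find)
open import Data.List.Membership.Propositional.Properties as List∈ using (∈-map⁺; ∈-map⁻)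
open import Data.List.Membership.Propositional.Properties.WithK using (unique∧set⇒bag)
import Data.List.Membership.Setoid as SetoidMembership
import Data.List.Membership.Setoid.Properties as SetoidMembershipProperties
open import Data.List.Properties as List using ()
open import Data.List.Relation.Binary.BagAndSetEquality using (∼bag⇒↭)
open import Data.List.Relation.Binary.Permutation.Propositional as Perm using (_↭_)
open import Data.List.Relation.Binary.Permutation.Propositional.Properties as Perm using ()
open import Data.List.Relation.Unary.All as All using (All; []; _∷_)
open import Data.List.Relation.Unary.All.Properties as All using ()
open import Data.List.Relation.Unary.AllPairs as AllPairs using ([]; _∷_)
open import Data.List.Relation.Unary.AllPairs.Properties as AllPairs using ()
open import Data.List.Relation.Unary.Any as Any using (here; there; Any)
open import Data.List.Relation.Unary.Linked using (Linked; []; [-]; _∷_)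
import Data.List.Relation.Unary.Unique.DecSetoid.Properties as DecSetoidUnique
open import Data.List.Relation.Unary.Unique.Propositional using (Unique)
open import Data.List.Relation.Unary.Unique.Propositional.Properties as Unique using ()
import Data.List.Relation.Unary.Unique.Setoid as SetoidUnique
import Data.List.Relation.Unary.Unique.Setoid.Properties as SetoidUniqueProperties
open import Data.Nat.Base as ℕ using (ℕ; zero; suc; _∸_; z≤n; s≤s; NonZero; _!)
open import Data.Nat.Induction using (<-rec)
open import Data.Nat.Properties as ℕ using ()
open import Data.Product.Base using (_×_; _,_; proj₁; proj₂; ∃-syntax; ∃₂; swap; uncurry)
open import Data.Rational.Base as ℚ using (ℚ)
open import Data.Rational.Properties as ℚ using ()
open import Data.Rational.Unnormalised.Base as ℚᵘ using (*≡*)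
open import Data.Rational.Unnormalised.Properties as ℚᵘ using ()
open import Data.Sum.Base using (_⊎_; inj₁; inj₂; [_,_]′)
open import Data.Unit.Base using (tt)
open import Data.Vec.Base as Vec using (Vec; []; _∷_; lookup; _[_]%=_; zipWith; _[_]≔_; here; there)
open import Data.Vec.Properties as Vec using ()
open import Function.Base using (_∘_; id; flip)
open import Function.Bundles using (mk⇔)
open import Function.Definitions using (Injective; Bijective)
open import Level using (Level; _⊔_; 0ℓ) renaming (suc to lsuc)
open import Relation.Binary.Bundles using (Setoid; DecSetoid)
open import Relation.Binary.Construct.Closure.ReflexiveTransitive as Star using (Star; _◅_; _◅◅_)
  renaming (ε to ε⋆)
open import Relation.Binary.Core using (Rel)
open import Relation.Binary.Definitions using (Symmetric; Decidable; tri<; tri≈; tri>)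
open import Relation.Binary.PropositionalEquality as ≡ using (_≡_; _≢_; cong; subst; cong₂; _≗_)
open import Relation.Nullary.Decidable using (Dec; yes; no; does; _×-dec_; ⌊_⌋; _⊎-dec_; _→-dec_; ¬?; map′; toWitness; fromWitness)
open import Relation.Nullary.Negation.Core using (¬_; contradiction)

-- Finite sums indexed by lists

-- Neither the variable t nor a limit occurs literally. A power series in t is a sequence of
-- coefficients, `conv` is its Cauchy product, and f (X + t N) is the sequence `Λ k f`. Putting t =
-- 1 becomes the finite sum `Λ≤ B`: an `N` of order at least 2 makes `Λ k` raise orders by k, so
-- coefficients of degree at most B do not feel the cut, and identities at t = 1 are proved modulo
-- degree B + 1. Labeled trees live on arbitrary subsets of `Fin N`, since cutting an edge produces
-- vertex sets that are no initial segments. For this surgery acyclicity is restated as: every edge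
-- is a bridge. The label of a cut edge becomes one derivative on each side, a half-edge; by the
-- product rule, summing over its position differentiates the whole tree sum, and this is where the
-- gradients of the recursion come from. Differentiating the recursion once more gives two equal
-- halves, which cancel the 2 in front. Only the gradient of `P` is constrained, so `P` may have a
-- constant term. It enters the one-vertex tree alone: with two or more vertices, every vertex is
-- differentiated.

unique∧set⇒↭ : ∀ {a} {A : Set a} {xs ys : List A} → Unique xs → Unique ys →
               (∀ {x} → x ∈ xs → x ∈ ys) → (∀ {x} → x ∈ ys → x ∈ xs) → xs ↭ ys
unique∧set⇒↭ xs! ys! f g = ∼bag⇒↭ (unique∧set⇒bag xs! ys! (mk⇔ f g))

map-∘-id : ∀ {a b} {A : Set a} {B : Set b} {f : A → B} {g : B → A} (xs : List A) → (∀ {x} → x ∈ xs → g (f x) ≡ x) → map g (map f xs) ≡ xs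
map-∘-id []       _  = ≡.refl
map-∘-id (x ∷ xs) gf = ≡.cong₂ _∷_ (gf (here ≡.refl)) (map-∘-id xs (gf ∘ there))

-- `f` and `g` are inverse to each other only on the two lists, so that constructions such as
-- cutting a tree at an edge, meaningful only on part of their domain, can serve as bijections.
bijection⇒↭ : ∀ {a b} {A : Set a} {B : Set b} {xs : List A} {ys : List B} (f : A → B) (g : B → A) → Unique xs → Unique ys →
              (∀ {x} → x ∈ xs → f x ∈ ys × g (f x) ≡ x) →
              (∀ {y} → y ∈ ys → g y ∈ xs × f (g y) ≡ y) →
              map f xs ↭ ys
bijection⇒↭ {xs = xs} {ys} f g xs! ys! fwd bwd = unique∧set⇒↭ fxs! ys! to from
  where
  fxs! : Unique (map f xs)
  -- Uniqueness is pulled back along `g`: `map g (map f xs)` is `xs`, and entries with distinct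
  -- values under `g` are distinct.
  fxs! = AllPairs.map (λ neq eq → neq (cong g eq))
           (AllPairs.map⁻ (subst Unique (≡.sym (map-∘-id xs (proj₂ ∘ fwd))) xs!))
  to : ∀ {y} → y ∈ map f xs → y ∈ ys
  to y∈ with ∈-map⁻ f y∈
  ... | x , x∈ , ≡.refl = proj₁ (fwd x∈)
  from : ∀ {y} → y ∈ ys → y ∈ map f xs
  from y∈ = subst (_∈ map f xs) (proj₂ (bwd y∈)) (∈-map⁺ f (proj₁ (bwd y∈)))

module ListSum {c ℓ} (M : CommutativeMonoid c ℓ) where
  open CommutativeMonoid M
  open import Algebra.Properties.CommutativeMonoid.Sum M using (sum; sum-cong-≋; sum-replicate-zero)
  open import Algebra.Properties.CommutativeSemigroup commutativeSemigroup using (interchange; x∙yz≈y∙xz)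
  open import Relation.Binary.Reasoning.Setoid setoid

  private
    variable
      a b p q : Level
      A B : Set a

  -- The same `foldr` as in `HasSum`, so the final sums fit without conversion.
  ∑ : List A → (A → Carrier) → Carrier
  ∑ xs f = foldr (λ x r → f x ∙ r) ε xs

  infix 8 [_]_
  -- The Iverson bracket. It inspects only `does`, hence the bracket of a `map′` reduces to the
  -- bracket of the underlying decision.
  [_]_ : {P : Set p} → Dec P → Carrier → Carrier
  [ d ] y = if does d then y else ε

  ∑-cong∈ : {f g : A → Carrier} (xs : List A) → (∀ {x} → x ∈ xs → f x ≈ g x) → ∑ xs f ≈ ∑ xs g
  ∑-cong∈ []       f≈g = refl
  ∑-cong∈ (x ∷ xs) f≈g = ∙-cong (f≈g (here ≡.refl)) (∑-cong∈ xs (f≈g ∘ there))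

  ∑-cong : {f g : A → Carrier} (xs : List A) → (∀ x → f x ≈ g x) → ∑ xs f ≈ ∑ xs g
  ∑-cong xs f≈g = ∑-cong∈ xs (λ {x} _ → f≈g x)

  ∑-ε : (xs : List A) → ∑ xs (λ _ → ε) ≈ ε
  ∑-ε []       = refl
  ∑-ε (x ∷ xs) = trans (identityˡ _) (∑-ε xs)

  ∑-ε∈ : {f : A → Carrier} (xs : List A) → (∀ {x} → x ∈ xs → f x ≈ ε) → ∑ xs f ≈ ε
  ∑-ε∈ xs f≈ε = trans (∑-cong∈ xs f≈ε) (∑-ε xs)

  ∑-∙ : (xs : List A) (f g : A → Carrier) → ∑ xs (λ x → f x ∙ g x) ≈ ∑ xs f ∙ ∑ xs g
  ∑-∙ []       f g = sym (identityˡ _)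
  ∑-∙ (x ∷ xs) f g = trans (∙-congˡ (∑-∙ xs f g)) (interchange _ _ _ _)

  ∑-++ : (xs ys : List A) (f : A → Carrier) → ∑ (xs ++ ys) f ≈ ∑ xs f ∙ ∑ ys f
  ∑-++ []       ys f = sym (identityˡ _)
  ∑-++ (x ∷ xs) ys f = trans (∙-congˡ (∑-++ xs ys f)) (sym (assoc _ _ _))

  ∑-map : (g : A → B) (xs : List A) (f : B → Carrier) → ∑ (map g xs) f ≡ ∑ xs (f ∘ g)
  ∑-map g []       f = ≡.refl
  ∑-map g (x ∷ xs) f = cong (f (g x) ∙_) (∑-map g xs f)

  ∑-swap : (xs : List A) (ys : List B) (f : A → B → Carrier) →
           ∑ xs (λ x → ∑ ys (f x)) ≈ ∑ ys (λ y → ∑ xs (λ x → f x y))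
  ∑-swap []       ys f = sym (∑-ε ys)
  ∑-swap (x ∷ xs) ys f = trans (∙-congˡ (∑-swap xs ys f)) (sym (∑-∙ ys (f x) _))

  ∑-cartesianProduct : (xs : List A) (ys : List B) (f : A × B → Carrier) →
                       ∑ (cartesianProduct xs ys) f ≈ ∑ xs (λ x → ∑ ys (λ y → f (x , y)))
  ∑-cartesianProduct []       ys f = refl
  ∑-cartesianProduct (x ∷ xs) ys f = begin
    ∑ (map (x ,_) ys ++ cartesianProduct xs ys) f                ≈⟨ ∑-++ (map (x ,_) ys) _ f ⟩
    ∑ (map (x ,_) ys) f ∙ ∑ (cartesianProduct xs ys) f           ≈⟨ ∙-cong (reflexive (∑-map (x ,_) ys f)) (∑-cartesianProduct xs ys f) ⟩
    ∑ ys (λ y → f (x , y)) ∙ ∑ xs (λ x → ∑ ys (λ y → f (x , y))) ∎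

  ∑-filter : {P : A → Set p} (P? : ∀ x → Dec (P x)) (xs : List A) (f : A → Carrier) →
             ∑ (filter P? xs) f ≈ ∑ xs (λ x → [ P? x ] f x)
  ∑-filter P? []       f = refl
  ∑-filter P? (x ∷ xs) f with does (P? x)
  ... | true  = ∙-congˡ (∑-filter P? xs f)
  ... | false = trans (∑-filter P? xs f) (sym (identityˡ _))

  ∑-↭ : {xs ys : List A} (f : A → Carrier) → xs ↭ ys → ∑ xs f ≈ ∑ ys f
  ∑-↭ f Perm.refl         = refl
  ∑-↭ f (Perm.prep x s)   = ∙-congˡ (∑-↭ f s)
  ∑-↭ f (Perm.swap x y s) = trans (∙-congˡ (∙-congˡ (∑-↭ f s))) (x∙yz≈y∙xz _ _ _)
  ∑-↭ f (Perm.trans s t)  = trans (∑-↭ f s) (∑-↭ f t)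

  ∑-bijection : {xs : List A} {ys : List B} (f : A → B) (g : B → A) → Unique xs → Unique ys →
                (∀ {x} → x ∈ xs → f x ∈ ys × g (f x) ≡ x) →
                (∀ {y} → y ∈ ys → g y ∈ xs × f (g y) ≡ y) →
                (w : B → Carrier) → ∑ xs (w ∘ f) ≈ ∑ ys w
  ∑-bijection {xs = xs} f g xs! ys! fwd bwd w =
    trans (reflexive (≡.sym (∑-map f xs w))) (∑-↭ w (bijection⇒↭ f g xs! ys! fwd bwd))

  ∑-tabulate : ∀ {n} (g : Fin n → A) (f : A → Carrier) → ∑ (List.tabulate g) f ≡ sum (f ∘ g)
  ∑-tabulate {n = zero}  g f = ≡.refl
  ∑-tabulate {n = suc n} g f = cong (f (g zero) ∙_) (∑-tabulate (g ∘ suc) f)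

  ∑-allFin : ∀ {n} (f : Fin n → Carrier) → ∑ (allFin n) f ≡ sum f
  ∑-allFin = ∑-tabulate id

  []-cong : {P : Set p} (d : Dec P) {x y : Carrier} → (P → x ≈ y) → [ d ] x ≈ [ d ] y
  []-cong (yes p) x≈y = x≈y p
  []-cong (no _)  x≈y = refl

  []-yes : {P : Set p} (d : Dec P) {x : Carrier} → P → [ d ] x ≈ x
  []-yes (yes _) _ = refl
  []-yes (no ¬p) p = contradiction p ¬p

  []-no : {P : Set p} (d : Dec P) {x : Carrier} → ¬ P → [ d ] x ≈ ε
  []-no (yes p) ¬p = contradiction p ¬p
  []-no (no _)  _  = refl

  []-⇔ : {P : Set p} {Q : Set q} (d : Dec P) (e : Dec Q) {x : Carrier} → (P → Q) → (Q → P) → [ d ] x ≈ [ e ] x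
  []-⇔ (yes p) e f g = sym ([]-yes e (f p))
  []-⇔ (no ¬p) e f g = sym ([]-no e (¬p ∘ g))

  []-× : {P : Set p} {Q : Set q} (d : Dec P) (e : Dec Q) {x : Carrier} → [ d ×-dec e ] x ≡ [ d ] [ e ] x
  []-× (yes _) e = ≡.refl
  []-× (no _)  e = ≡.refl

  []-ε : {P : Set p} (d : Dec P) → [ d ] ε ≈ ε
  []-ε (yes _) = refl
  []-ε (no _)  = refl

  []-∑ : {P : Set p} (d : Dec P) (xs : List A) (f : A → Carrier) → [ d ] ∑ xs f ≈ ∑ xs (λ x → [ d ] f x)
  []-∑ (yes _) xs f = refl
  []-∑ (no _)  xs f = sym (∑-ε xs)

  ∑-single : {xs : List A} {P : A → Set p} (P? : ∀ x → Dec (P x)) (f : A → Carrier) {x : A} →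
             Unique xs → x ∈ xs → P x → (∀ {y} → P y → y ≡ x) → ∑ xs (λ y → [ P? y ] f y) ≈ f x
  ∑-single {xs = _ ∷ xs} P? f {x} (x∉xs ∷ xs!) (here ≡.refl) Px only = begin
    [ P? x ] f x ∙ ∑ xs (λ y → [ P? y ] f y) ≈⟨ ∙-cong ([]-yes (P? x) Px) (∑-ε∈ xs λ y∈ → []-no (P? _) λ Py → All.lookup x∉xs y∈ (≡.sym (only Py))) ⟩
    f x ∙ ε                                  ≈⟨ identityʳ _ ⟩
    f x                                      ∎
  ∑-single {xs = z ∷ xs} P? f {x} (z∉xs ∷ xs!) (there x∈) Px only = begin
    [ P? z ] f z ∙ ∑ xs (λ y → [ P? y ] f y) ≈⟨ ∙-cong ([]-no (P? z) λ Pz → All.lookup z∉xs x∈ (only Pz)) (∑-single P? f xs! x∈ Px only) ⟩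
    ε ∙ f x                                  ≈⟨ identityˡ _ ⟩
    f x                                      ∎

  sum-single : ∀ {m} (j : Fin m) (f : Fin m → Carrier) → (∀ i → i ≢ j → f i ≈ ε) → sum f ≈ f j
  sum-single {suc m} zero    f off = trans (∙-congˡ (trans (sum-cong-≋ (λ i → off (suc i) (λ ()))) (sum-replicate-zero m))) (identityʳ _)
  sum-single {suc m} (suc j) f off = trans (∙-cong (off zero (λ ()))
      (sum-single j (f ∘ suc) (λ i i≢j → off (suc i) (i≢j ∘ Fin.suc-injective)))) (identityˡ _)

-- Convolutions over natural numbers and multi-indices

infixl 6 _+ᵐ_
_+ᵐ_ : ∀ {m} → MultiIndex m → MultiIndex m → MultiIndex m
_+ᵐ_ = zipWith ℕ._+_

module Convolution {c ℓ} (M : CommutativeMonoid c ℓ) where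
  open CommutativeMonoid M
  open import Algebra.Properties.CommutativeMonoid.Sum M using (sum)
  open import Algebra.Properties.CommutativeMonoid.Mult M using (×-homo-+) renaming (_×_ to _·_)
  open import Algebra.Properties.CommutativeSemigroup commutativeSemigroup using (interchange)
  open import Relation.Binary.Reasoning.Setoid setoid

  -- The sum over k + l = a, by recursion so that no truncated subtraction occurs. It serves both as
  -- the product of power series in one of the `X i` and as the product of series in the auxiliary
  -- variable t.
  conv : ℕ → (ℕ → ℕ → Carrier) → Carrier
  conv zero    h = h 0 0
  conv (suc a) h = h 0 (suc a) ∙ conv a (λ k l → h (suc k) l)

  conv-sum : ∀ a h → sum {suc a} (λ k → h (toℕ k) (a ∸ toℕ k)) ≈ conv a h
  conv-sum zero    h = identityʳ _
  conv-sum (suc a) h = ∙-congˡ (conv-sum a (λ k l → h (suc k) l))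

  conv-cong+ : ∀ a {h h′} → (∀ k l → k ℕ.+ l ≡ a → h k l ≈ h′ k l) → conv a h ≈ conv a h′
  conv-cong+ zero    eq = eq 0 0 ≡.refl
  conv-cong+ (suc a) eq = ∙-cong (eq 0 (suc a) ≡.refl) (conv-cong+ a (λ k l p → eq (suc k) l (cong suc p)))

  conv-cong : ∀ a {h h′} → (∀ k l → h k l ≈ h′ k l) → conv a h ≈ conv a h′
  conv-cong a eq = conv-cong+ a (λ k l _ → eq k l)

  conv-∙ : ∀ a (h h′ : ℕ → ℕ → Carrier) → conv a (λ k l → h k l ∙ h′ k l) ≈ conv a h ∙ conv a h′
  conv-∙ zero    h h′ = refl
  conv-∙ (suc a) h h′ = trans (∙-congˡ (conv-∙ a _ _)) (interchange _ _ _ _)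

  conv-ε : ∀ a → conv a (λ _ _ → ε) ≈ ε
  conv-ε zero    = refl
  conv-ε (suc a) = trans (identityˡ _) (conv-ε a)

  conv-last : ∀ a (h : ℕ → ℕ → Carrier) → conv (suc a) h ≈ conv a (λ k l → h k (suc l)) ∙ h (suc a) 0
  conv-last zero    h = refl
  conv-last (suc a) h = trans (∙-congˡ (conv-last a (λ k l → h (suc k) l))) (sym (assoc _ _ _))

  conv-comm : ∀ a h → conv a h ≈ conv a (flip h)
  conv-comm zero    h = refl
  conv-comm (suc a) h = begin
    h 0 (suc a) ∙ conv a (λ k l → h (suc k) l)   ≈⟨ comm _ _ ⟩
    conv a (λ k l → h (suc k) l) ∙ h 0 (suc a)   ≈⟨ ∙-congʳ (conv-comm a (λ k l → h (suc k) l)) ⟩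
    conv a (λ k l → h (suc l) k) ∙ h 0 (suc a)   ≈⟨ conv-last a (flip h) ⟨
    conv (suc a) (flip h)                        ∎

  conv-assoc : ∀ N (h : ℕ → ℕ → ℕ → Carrier) →
               conv N (λ x y → conv x (λ a b → h a b y)) ≈ conv N (λ a z → conv z (λ b y → h a b y))
  conv-assoc zero    h = refl
  conv-assoc (suc N) h = begin
    h 0 0 (suc N) ∙ conv N (λ x y → h 0 (suc x) y ∙ conv x (λ a b → h (suc a) b y))
      ≈⟨ ∙-congˡ (conv-∙ N _ _) ⟩
    h 0 0 (suc N) ∙ (conv N (λ x y → h 0 (suc x) y) ∙ conv N (λ x y → conv x (λ a b → h (suc a) b y)))
      ≈⟨ assoc _ _ _ ⟨
    conv (suc N) (λ b y → h 0 b y) ∙ conv N (λ x y → conv x (λ a b → h (suc a) b y))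
      ≈⟨ ∙-congˡ (conv-assoc N (λ a → h (suc a))) ⟩
    conv (suc N) (λ b y → h 0 b y) ∙ conv N (λ a z → conv z (λ b y → h (suc a) b y)) ∎

  conv-single : ∀ {a} k l {h} → k ℕ.+ l ≡ a → (∀ k′ l′ → k′ ≢ k → h k′ l′ ≈ ε) → conv a h ≈ h k l
  conv-single zero    zero    ≡.refl off = refl
  conv-single zero    (suc l) ≡.refl off =
    trans (∙-congˡ (trans (conv-cong l (λ k′ l′ → off (suc k′) l′ (λ ()))) (conv-ε l))) (identityʳ _)
  conv-single (suc k) l       ≡.refl off =
    trans (∙-cong (off 0 _ (λ ())) (conv-single k l ≡.refl (λ k′ l′ ≢ → off (suc k′) l′ (≢ ∘ ℕ.suc-injective)))) (identityˡ _)

  -- Both sides run over all quadruples with a + b + c + d = N. Reassociating brings `b` and `c`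
  -- together, where `conv-comm` exchanges them.
  conv-medial : ∀ N (h : ℕ → ℕ → ℕ → ℕ → Carrier) →
    conv N (λ x y → conv x (λ a b → conv y (λ c d → h a b c d))) ≈
    conv N (λ x y → conv x (λ a c → conv y (λ b d → h a b c d)))
  conv-medial N h = begin
    conv N (λ x y → conv x (λ a b → conv y (λ c d → h a b c d)))
      ≈⟨ conv-assoc N (λ a b y → conv y (λ c d → h a b c d)) ⟩
    conv N (λ a z → conv z (λ b y → conv y (λ c d → h a b c d)))
      ≈⟨ conv-cong N (λ a z → inner a z) ⟩
    conv N (λ a z → conv z (λ c y → conv y (λ b d → h a b c d)))
      ≈⟨ conv-assoc N (λ a c y → conv y (λ b d → h a b c d)) ⟨
    conv N (λ x y → conv x (λ a c → conv y (λ b d → h a b c d))) ∎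
    where
    inner : ∀ a z → conv z (λ b y → conv y (λ c d → h a b c d)) ≈ conv z (λ c y → conv y (λ b d → h a b c d))
    inner a z = begin
      conv z (λ b y → conv y (λ c d → h a b c d)) ≈⟨ conv-assoc z (h a) ⟨
      conv z (λ x d → conv x (λ b c → h a b c d)) ≈⟨ conv-cong z (λ x d → conv-comm x _) ⟩
      conv z (λ x d → conv x (λ c b → h a b c d)) ≈⟨ conv-assoc z (λ c b d → h a b c d) ⟩
      conv z (λ c y → conv y (λ b d → h a b c d)) ∎

  splits : ∀ {m} → MultiIndex m → (MultiIndex m → MultiIndex m → Carrier) → Carrier
  splits []      h = h [] []
  splits (a ∷ α) h = conv a λ k l → splits α λ β γ → h (k ∷ β) (l ∷ γ)

  splits-cong+ : ∀ {m} (α : MultiIndex m) {h h′} → (∀ β γ → β +ᵐ γ ≡ α → h β γ ≈ h′ β γ) → splits α h ≈ splits α h′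
  splits-cong+ []      eq = eq [] [] ≡.refl
  splits-cong+ (a ∷ α) eq = conv-cong+ a λ k l p → splits-cong+ α λ β γ q → eq (k ∷ β) (l ∷ γ) (cong₂ _∷_ p q)

  splits-cong : ∀ {m} (α : MultiIndex m) {h h′} → (∀ β γ → h β γ ≈ h′ β γ) → splits α h ≈ splits α h′
  splits-cong α eq = splits-cong+ α (λ β γ _ → eq β γ)

  splits-∙ : ∀ {m} (α : MultiIndex m) (h h′ : MultiIndex m → MultiIndex m → Carrier) → splits α (λ β γ → h β γ ∙ h′ β γ) ≈ splits α h ∙ splits α h′
  splits-∙ []      h h′ = refl
  splits-∙ (a ∷ α) h h′ = trans (conv-cong a (λ k l → splits-∙ α _ _)) (conv-∙ a _ _)

  splits-ε : ∀ {m} (α : MultiIndex m) → splits α (λ _ _ → ε) ≈ ε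
  splits-ε []      = refl
  splits-ε (a ∷ α) = trans (conv-cong a (λ k l → splits-ε α)) (conv-ε a)

  splits-conv : ∀ {m} (α : MultiIndex m) a (h : ℕ → ℕ → MultiIndex m → MultiIndex m → Carrier) →
    splits α (λ β γ → conv a (λ k l → h k l β γ)) ≈ conv a (λ k l → splits α (h k l))
  splits-conv α zero    h = refl
  splits-conv α (suc a) h = trans (splits-∙ α _ _) (∙-congˡ (splits-conv α a _))

  splits-comm : ∀ {m} (α : MultiIndex m) (h : MultiIndex m → MultiIndex m → Carrier) → splits α h ≈ splits α (flip h)
  splits-comm []      h = refl
  splits-comm (a ∷ α) h = trans (conv-comm a _) (conv-cong a (λ k l → splits-comm α _))

  splits-assoc : ∀ {m} (α : MultiIndex m) (h : MultiIndex m → MultiIndex m → MultiIndex m → Carrier) →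
    splits α (λ β γ → splits β (λ δ ε → h δ ε γ)) ≈ splits α (λ δ ζ → splits ζ (λ ε γ → h δ ε γ))
  splits-assoc []      h = refl
  splits-assoc (a ∷ α) h = begin
    conv a (λ x y → splits α λ β γ → conv x λ k l → splits β λ δ ε → h (k ∷ δ) (l ∷ ε) (y ∷ γ))
      ≈⟨ conv-cong a (λ x y → splits-conv α x _) ⟩
    conv a (λ x y → conv x λ k l → splits α λ β γ → splits β λ δ ε → h (k ∷ δ) (l ∷ ε) (y ∷ γ))
      ≈⟨ conv-cong a (λ x y → conv-cong x λ k l → splits-assoc α _) ⟩
    conv a (λ x y → conv x λ k l → splits α λ δ ζ → splits ζ λ ε γ → h (k ∷ δ) (l ∷ ε) (y ∷ γ))
      ≈⟨ conv-assoc a (λ k l y → splits α λ δ ζ → splits ζ λ ε γ → h (k ∷ δ) (l ∷ ε) (y ∷ γ)) ⟩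
    conv a (λ k z → conv z λ l y → splits α λ δ ζ → splits ζ λ ε γ → h (k ∷ δ) (l ∷ ε) (y ∷ γ))
      ≈⟨ conv-cong a (λ k z → splits-conv α z _) ⟨
    conv a (λ k z → splits α λ δ ζ → conv z λ l y → splits ζ λ ε γ → h (k ∷ δ) (l ∷ ε) (y ∷ γ)) ∎

  splits-single : ∀ {m} {α : MultiIndex m} δ ε′ {h} → δ +ᵐ ε′ ≡ α → (∀ β γ → β ≢ δ → h β γ ≈ ε) → splits α h ≈ h δ ε′
  splits-single []      []      ≡.refl off = refl
  splits-single (d ∷ δ) (e ∷ ε′) {h} ≡.refl off = trans
    (conv-single d e ≡.refl λ k l ≢ →
      trans (splits-cong (δ +ᵐ ε′) (λ β γ → off _ _ (≢ ∘ Vec.∷-injectiveˡ))) (splits-ε (δ +ᵐ ε′)))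
    (splits-single δ ε′ {λ β γ → h (d ∷ β) (e ∷ γ)} ≡.refl (λ β γ ≢ → off _ _ (≢ ∘ Vec.∷-injectiveʳ)))

  -- Splits with `lookup β i` equal to 0 carry the factor 0; in all others one unit at `i` is taken
  -- from `β` and from the total. In terms of coefficients, the left factor is being differentiated.
  splits-shiftˡ : ∀ {m} (α : MultiIndex m) i (h : MultiIndex m → MultiIndex m → Carrier) →
    splits (α [ i ]%= suc) (λ β γ → lookup β i · h β γ) ≈
    splits α (λ β γ → suc (lookup β i) · h (β [ i ]%= suc) γ)
  splits-shiftˡ (a ∷ α) zero    h = begin
    conv (suc a) (λ k l → splits α λ β γ → k · h (k ∷ β) (l ∷ γ))
      ≈⟨ ∙-congʳ (splits-ε α) ⟩
    ε ∙ conv a (λ k l → splits α λ β γ → suc k · h (suc k ∷ β) (l ∷ γ))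
      ≈⟨ identityˡ _ ⟩
    conv a (λ k l → splits α λ β γ → suc k · h (suc k ∷ β) (l ∷ γ)) ∎
  splits-shiftˡ (a ∷ α) (suc i) h = conv-cong a λ k l → splits-shiftˡ α i (λ β γ → h (k ∷ β) (l ∷ γ))

  splits-shiftʳ : ∀ {m} (α : MultiIndex m) i (h : MultiIndex m → MultiIndex m → Carrier) →
    splits (α [ i ]%= suc) (λ β γ → lookup γ i · h β γ) ≈
    splits α (λ β γ → suc (lookup γ i) · h β (γ [ i ]%= suc))
  splits-shiftʳ α i h = begin
    splits (α [ i ]%= suc) (λ β γ → lookup γ i · h β γ)       ≈⟨ splits-comm (α [ i ]%= suc) (λ β γ → lookup γ i · h β γ) ⟩
    splits (α [ i ]%= suc) (λ γ β → lookup γ i · h β γ)       ≈⟨ splits-shiftˡ α i (flip h) ⟩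
    splits α (λ γ β → suc (lookup γ i) · h β (γ [ i ]%= suc)) ≈⟨ splits-comm α (λ γ β → suc (lookup γ i) · h β (γ [ i ]%= suc)) ⟩
    splits α (λ β γ → suc (lookup γ i) · h β (γ [ i ]%= suc)) ∎

  -- The Leibniz rule: at a split of `α [ i ]%= suc` the number `suc (lookup α i)` is
  -- `lookup β i ℕ.+ lookup γ i`, and each summand differentiates its own factor.
  splits-shift : ∀ {m} (α : MultiIndex m) i (h : MultiIndex m → MultiIndex m → Carrier) →
    suc (lookup α i) · splits (α [ i ]%= suc) h ≈
    splits α (λ β γ → suc (lookup β i) · h (β [ i ]%= suc) γ) ∙ splits α (λ β γ → suc (lookup γ i) · h β (γ [ i ]%= suc))
  splits-shift α i h = begin
    suc (lookup α i) · splits (α [ i ]%= suc) h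
      ≈⟨ times (suc (lookup α i)) (α [ i ]%= suc) h ⟩
    splits (α [ i ]%= suc) (λ β γ → suc (lookup α i) · h β γ)
      ≈⟨ splits-cong+ (α [ i ]%= suc) (λ β γ eq → trans (reflexive (cong (_· h β γ) (degree β γ eq))) (×-homo-+ (h β γ) (lookup β i) (lookup γ i))) ⟩
    splits (α [ i ]%= suc) (λ β γ → lookup β i · h β γ ∙ lookup γ i · h β γ)
      ≈⟨ splits-∙ (α [ i ]%= suc) (λ β γ → lookup β i · h β γ) (λ β γ → lookup γ i · h β γ) ⟩
    splits (α [ i ]%= suc) (λ β γ → lookup β i · h β γ) ∙ splits (α [ i ]%= suc) (λ β γ → lookup γ i · h β γ)
      ≈⟨ ∙-cong (splits-shiftˡ α i h) (splits-shiftʳ α i h) ⟩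
    splits α (λ β γ → suc (lookup β i) · h (β [ i ]%= suc) γ) ∙ splits α (λ β γ → suc (lookup γ i) · h β (γ [ i ]%= suc)) ∎
    where
    times : ∀ {m} k (α : MultiIndex m) (h : MultiIndex m → MultiIndex m → Carrier) → k · splits α h ≈ splits α (λ β γ → k · h β γ)
    times zero    α h = sym (splits-ε α)
    times (suc k) α h = trans (∙-congˡ (times k α h)) (sym (splits-∙ α h (λ β γ → k · h β γ)))
    degree : ∀ β γ → β +ᵐ γ ≡ α [ i ]%= suc → suc (lookup α i) ≡ lookup β i ℕ.+ lookup γ i
    degree β γ eq = ≡.trans (≡.sym (Vec.lookup∘updateAt i α)) (≡.trans (≡.sym (cong (λ v → lookup v i) eq)) (Vec.lookup-zipWith ℕ._+_ i β γ))

  -- The case of a single exponent, that is the product rule for d/dt on power series in t.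
  conv-shift : ∀ N (h : ℕ → ℕ → Carrier) →
    suc N · conv (suc N) h ≈ conv N (λ k l → suc k · h (suc k) l) ∙ conv N (λ k l → suc l · h k (suc l))
  conv-shift N h = splits-shift (N ∷ []) zero (λ β γ → h (lookup β zero) (lookup γ zero))

  conv-Fin : ∀ {n} N (h : Fin n → ℕ → ℕ → Carrier) → conv N (λ k l → sum (λ i → h i k l)) ≈ sum (λ i → conv N (h i))
  conv-Fin {zero}  N h = conv-ε N
  conv-Fin {suc n} N h = trans (conv-∙ N (h zero) (λ k l → sum (λ i → h (suc i) k l))) (∙-congˡ (conv-Fin N (h ∘ suc)))

  conv-swap : ∀ a b (h : ℕ → ℕ → ℕ → ℕ → Carrier) →
    conv a (λ k l → conv b (h k l)) ≈ conv b (λ x y → conv a (λ k l → h k l x y))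
  conv-swap zero    b h = refl
  conv-swap (suc a) b h = trans (∙-congˡ (conv-swap a b (λ k → h (suc k)))) (sym (conv-∙ b (h 0 (suc a)) (λ x y → conv a (λ k l → h (suc k) l x y))))

  conv-extend : ∀ z a (g : ℕ → Carrier) → (∀ b → z ℕ.< b → g b ≈ ε) →
    conv (a ℕ.+ z) (λ b _ → g b) ≈ conv z (λ b _ → g b)
  conv-extend z zero    g off = refl
  conv-extend z (suc a) g off = begin
    conv (suc (a ℕ.+ z)) (λ b _ → g b)               ≈⟨ conv-last (a ℕ.+ z) (λ b _ → g b) ⟩
    conv (a ℕ.+ z) (λ b _ → g b) ∙ g (suc (a ℕ.+ z)) ≈⟨ ∙-cong (conv-extend z a g off) (off _ (ℕ.s≤s (ℕ.m≤n+m z a))) ⟩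
    conv z (λ b _ → g b) ∙ ε                         ≈⟨ identityʳ _ ⟩
    conv z (λ b _ → g b)                             ∎

  -- The triangle a + b ≤ B and the square a, b ≤ B differ only in pairs where `h` vanishes. This
  -- turns truncation by total order into truncation of each index separately.
  triangle≈square : ∀ B (h : ℕ → ℕ → Carrier) → (∀ a b → B ℕ.< a ℕ.+ b → h a b ≈ ε) →
    conv B (λ x _ → conv x h) ≈ conv B (λ a _ → conv B (λ b _ → h a b))
  triangle≈square B h off = begin
    conv B (λ x _ → conv x h)                       ≈⟨ conv-assoc B (λ a b _ → h a b) ⟩
    conv B (λ a z → conv z (λ b _ → h a b))         ≈⟨ conv-cong+ B extend ⟩
    conv B (λ a _ → conv B (λ b _ → h a b))         ∎
    where
    extend : ∀ a z → a ℕ.+ z ≡ B → conv z (λ b _ → h a b) ≈ conv B (λ b _ → h a b)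
    extend a z ≡.refl = sym (conv-extend z a (h a) (λ b z<b → off a b (ℕ.+-monoʳ-< a z<b)))

-- Power series as a differential algebra

-- What the Burgers argument and the tree recursion use of power series. Division by positive
-- integers is multiplication by the elements `1/suc k`.
record DifferentialAlgebra (c ℓ : Level) (n : ℕ) : Set (lsuc (c ⊔ ℓ)) where
  field
    commutativeRing : CommutativeRing c ℓ
  open CommutativeRing commutativeRing public
  field
    D      : Fin n → Carrier → Carrier
    D-cong : ∀ i {f g} → f ≈ g → D i f ≈ D i g
    D-+    : ∀ i f g → D i (f + g) ≈ D i f + D i g
    D-*    : ∀ i f g → D i (f * g) ≈ D i f * g + f * D i g
    D-comm : ∀ i j f → D i (D j f) ≈ D j (D i f)
    1/suc  : ℕ → Carrier
    ·-1/   : ∀ k → RawMonoidOps._×_ +-rawMonoid (suc k) (1/suc k) ≈ 1#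

deg-%= : ∀ {m} (α : MultiIndex m) i → (deg (α [ i ]%= suc)) ≡ suc (deg α)
deg-%= (a ∷ α) zero    = ≡.refl
deg-%= (a ∷ α) (suc i) = ≡.trans (cong (a ℕ.+_) (deg-%= α i)) (ℕ.+-suc a (deg α))

deg-+ᵐ : ∀ {m} (β γ : MultiIndex m) → (deg (β +ᵐ γ)) ≡ (deg β) ℕ.+ (deg γ)
deg-+ᵐ []      []      = ≡.refl
deg-+ᵐ (b ∷ β) (c ∷ γ) = ≡.trans (cong ((b ℕ.+ c) ℕ.+_) (deg-+ᵐ β γ))
    (solve 4 (λ b c x y → (b :+ c) :+ (x :+ y) := (b :+ x) :+ (c :+ y)) ≡.refl b c (deg β) (deg γ))
  where
  open import Data.Nat.Solver
  open +-*-Solver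

+ᵐ-identityˡ : ∀ {m} (α : MultiIndex m) → Vec.replicate m 0 +ᵐ α ≡ α
+ᵐ-identityˡ = Vec.zipWith-identityˡ ℕ.+-identityˡ

unit+ᵐ : ∀ {m} (α : MultiIndex m) i → (Vec.replicate m 0 [ i ]≔ 1) +ᵐ α ≡ α [ i ]%= suc
unit+ᵐ (a ∷ α) zero    = cong (suc a ∷_) (+ᵐ-identityˡ α)
unit+ᵐ (a ∷ α) (suc i) = cong (a ∷_) (unit+ᵐ α i)

-- Passing to unnormalised rationals avoids the gcd hidden in `ℚ./`.
suc·1/suc : ∀ k → (+ suc k ℚ./ 1) ℚ.* (+ 1 ℚ./ suc k) ≡ ℚ.1ℚ
suc·1/suc k = ℚ.toℚᵘ-injective (begin
  ℚ.toℚᵘ ((+ suc k ℚ./ 1) ℚ.* (+ 1 ℚ./ suc k))       ≈⟨ ℚ.toℚᵘ-homo-* (+ suc k ℚ./ 1) (+ 1 ℚ./ suc k) ⟩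
  ℚ.toℚᵘ (+ suc k ℚ./ 1) ℚᵘ.* ℚ.toℚᵘ (+ 1 ℚ./ suc k) ≈⟨ ℚᵘ.*-cong (ℚ.toℚᵘ-fromℚᵘ (ℚᵘ.mkℚᵘ (+ suc k) 0)) (ℚ.toℚᵘ-fromℚᵘ (ℚᵘ.mkℚᵘ (+ 1) k)) ⟩
  ℚᵘ.mkℚᵘ (+ suc k) 0 ℚᵘ.* ℚᵘ.mkℚᵘ (+ 1) k           ≈⟨ *≡*
      (≡.trans (ℤ.*-identityʳ _) (≡.trans (ℤ.*-identityʳ _) (≡.sym (≡.trans (ℤ.*-identityˡ _) (ℤ.*-identityˡ (+ suc k)))))) ⟩
  ℚᵘ.1ℚᵘ                                             ∎)
  where open import Relation.Binary.Reasoning.Setoid ℚᵘ.≃-setoid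

suc/1 : ∀ k → + suc k ℚ./ 1 ≡ ℚ.1ℚ ℚ.+ (+ k ℚ./ 1)
suc/1 k = ℚ.toℚᵘ-injective (begin
  ℚ.toℚᵘ (+ suc k ℚ./ 1)                     ≈⟨ ℚ.toℚᵘ-fromℚᵘ (ℚᵘ.mkℚᵘ (+ suc k) 0) ⟩
  ℚᵘ.mkℚᵘ (+ suc k) 0                        ≈⟨ *≡* (cong (λ x → (+ 1 ℤ.+ x) ℤ.* + 1) (≡.sym (ℤ.*-identityʳ (+ k)))) ⟩
  ℚᵘ.1ℚᵘ ℚᵘ.+ ℚᵘ.mkℚᵘ (+ k) 0                ≈⟨ ℚᵘ.+-congʳ ℚᵘ.1ℚᵘ (ℚ.toℚᵘ-fromℚᵘ (ℚᵘ.mkℚᵘ (+ k) 0)) ⟨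
  ℚ.toℚᵘ ℚ.1ℚ ℚᵘ.+ ℚ.toℚᵘ (+ k ℚ./ 1)        ≈⟨ ℚ.toℚᵘ-homo-+ ℚ.1ℚ (+ k ℚ./ 1) ⟨
  ℚ.toℚᵘ (ℚ.1ℚ ℚ.+ (+ k ℚ./ 1))              ∎)
  where open import Relation.Binary.Reasoning.Setoid ℚᵘ.≃-setoid

module ℚ-Scalars {c ℓ} (K : Commutativeℚ-Algebra c ℓ) where
  private module K = Commutativeℚ-Algebra K
  open K
  open IsRingHomomorphism isRingHomomorphism
  open import Algebra.Properties.Semiring.Mult semiring using (×-assoc-*; ×-congʳ) renaming (_×_ to _·_)
  open import Relation.Binary.Reasoning.Setoid setoid

  fromℚ-ℕ : ∀ k → fromℚ (+ k ℚ./ 1) ≈ k · 1#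
  fromℚ-ℕ zero    = 0#-homo
  fromℚ-ℕ (suc k) = begin
    fromℚ (+ suc k ℚ./ 1)               ≡⟨ cong fromℚ (suc/1 k) ⟩
    fromℚ (ℚ.1ℚ ℚ.+ (+ k ℚ./ 1))        ≈⟨ +-homo ℚ.1ℚ (+ k ℚ./ 1) ⟩
    fromℚ ℚ.1ℚ + fromℚ (+ k ℚ./ 1)      ≈⟨ +-cong 1#-homo (fromℚ-ℕ k) ⟩
    1# + k · 1#                         ∎

  ·-fromℚ-1/ : ∀ k → suc k · fromℚ (+ 1 ℚ./ suc k) ≈ 1#
  ·-fromℚ-1/ k = begin
    suc k · fromℚ (+ 1 ℚ./ suc k)                     ≈⟨ ×-congʳ (suc k) (*-identityˡ _) ⟨
    suc k · (1# * fromℚ (+ 1 ℚ./ suc k))              ≈⟨ ×-assoc-* (suc k) _ _ ⟨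
    (suc k · 1#) * fromℚ (+ 1 ℚ./ suc k)              ≈⟨ *-congʳ (fromℚ-ℕ (suc k)) ⟨
    fromℚ (+ suc k ℚ./ 1) * fromℚ (+ 1 ℚ./ suc k)     ≈⟨ *-homo (+ suc k ℚ./ 1) (+ 1 ℚ./ suc k) ⟨
    fromℚ ((+ suc k ℚ./ 1) ℚ.* (+ 1 ℚ./ suc k))       ≡⟨ cong fromℚ (suc·1/suc k) ⟩
    fromℚ ℚ.1ℚ                                        ≈⟨ 1#-homo ⟩
    1#                                                ∎

module PowerSeriesAlgebra {c ℓ} (K : Commutativeℚ-Algebra c ℓ) (n : ℕ) where
  private module K = Commutativeℚ-Algebra K
  open PowerSeries K n
  open Convolution K.+-commutativeMonoid public
  open ℚ-Scalars K
  open import Algebra.Properties.Semiring.Mult K.semiring using (×-assoc-*; ×-comm-*; ×-congʳ; ×-assocˡ; ×-homo-+) renaming (_×_ to _·_)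
  open import Algebra.Properties.CommutativeMonoid.Mult K.+-commutativeMonoid using (×-distrib-+)
  open import Relation.Binary.Reasoning.Setoid K.setoid

  ∑-splits≈splits : ∀ {m} (α : MultiIndex m) (h : MultiIndex m → MultiIndex m → K.Carrier) → ∑-splits α h K.≈ splits α h
  ∑-splits≈splits []      h = K.refl
  ∑-splits≈splits (a ∷ α) h = K.trans (conv-sum a (λ k l → ∑-splits α (λ β γ → h (k ∷ β) (l ∷ γ))))
    (conv-cong a (λ k l → ∑-splits≈splits α (λ β γ → h (k ∷ β) (l ∷ γ))))

  *-splits : ∀ f g α → (f * g) α K.≈ splits α (λ β γ → f β K.* g γ)
  *-splits f g α = ∑-splits≈splits α _

  splits-*ˡ : ∀ {m} (α : MultiIndex m) x (h : MultiIndex m → MultiIndex m → K.Carrier) → x K.* splits α h K.≈ splits α (λ β γ → x K.* h β γ)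
  splits-*ˡ []      x h = K.refl
  splits-*ˡ (a ∷ α) x h = K.trans (conv-*ˡ a (λ k l → splits α λ β γ → h (k ∷ β) (l ∷ γ)))
      (conv-cong a λ k l → splits-*ˡ α x (λ β γ → h (k ∷ β) (l ∷ γ)))
    where
    conv-*ˡ : ∀ a (h : ℕ → ℕ → K.Carrier) → x K.* conv a h K.≈ conv a (λ k l → x K.* h k l)
    conv-*ˡ zero    h = K.refl
    conv-*ˡ (suc a) h = K.trans (K.distribˡ _ _ _) (K.+-congˡ (conv-*ˡ a (λ k l → h (suc k) l)))

  splits-*ʳ : ∀ {m} (α : MultiIndex m) x (h : MultiIndex m → MultiIndex m → K.Carrier) → splits α h K.* x K.≈ splits α (λ β γ → h β γ K.* x)
  splits-*ʳ α x h = K.trans (K.*-comm _ _) (K.trans (splits-*ˡ α x h) (splits-cong α λ β γ → K.*-comm _ _))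

  *-cong : ∀ {f f′ g g′} → f ≈ f′ → g ≈ g′ → f * g ≈ f′ * g′
  *-cong {f} {f′} {g} {g′} p q α = begin
    (f * g) α                         ≈⟨ *-splits f g α ⟩
    splits α (λ β γ → f β K.* g γ)    ≈⟨ splits-cong α (λ β γ → K.*-cong (p β) (q γ)) ⟩
    splits α (λ β γ → f′ β K.* g′ γ)  ≈⟨ *-splits f′ g′ α ⟨
    (f′ * g′) α                       ∎

  *-comm : ∀ f g → f * g ≈ g * f
  *-comm f g α = begin
    (f * g) α                         ≈⟨ *-splits f g α ⟩
    splits α (λ β γ → f β K.* g γ)    ≈⟨ splits-comm α (λ β γ → f β K.* g γ) ⟩
    splits α (λ β γ → f γ K.* g β)    ≈⟨ splits-cong α (λ β γ → K.*-comm _ _) ⟩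
    splits α (λ β γ → g β K.* f γ)    ≈⟨ *-splits g f α ⟨
    (g * f) α                         ∎

  *-assoc : ∀ f g h → (f * g) * h ≈ f * (g * h)
  *-assoc f g h α = begin
    ((f * g) * h) α
      ≈⟨ *-splits (f * g) h α ⟩
    splits α (λ β γ → (f * g) β K.* h γ)
      ≈⟨ splits-cong α (λ β γ → K.trans (K.*-congʳ (*-splits f g β)) (splits-*ʳ β (h γ) _)) ⟩
    splits α (λ β γ → splits β (λ δ ε → (f δ K.* g ε) K.* h γ))
      ≈⟨ splits-assoc α (λ δ ε γ → (f δ K.* g ε) K.* h γ) ⟩
    splits α (λ δ ζ → splits ζ (λ ε γ → (f δ K.* g ε) K.* h γ))
      ≈⟨ splits-cong α (λ δ ζ → K.trans (splits-cong ζ (λ ε γ → K.*-assoc _ _ _)) (K.sym (splits-*ˡ ζ (f δ) _))) ⟩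
    splits α (λ δ ζ → f δ K.* splits ζ (λ ε γ → g ε K.* h γ))
      ≈⟨ splits-cong α (λ δ ζ → K.*-congˡ (*-splits g h ζ)) ⟨
    splits α (λ δ ζ → f δ K.* (g * h) ζ)
      ≈⟨ *-splits f (g * h) α ⟨
    (f * (g * h)) α ∎

  monomial-yes : ∀ α → monomial α α K.≈ K.1#
  monomial-yes α with Vec.≡-dec ℕ._≟_ α α
  ... | yes _ = K.refl
  ... | no ¬p = contradiction ≡.refl ¬p

  monomial-no : ∀ {α β} → α ≢ β → monomial α β K.≈ K.0#
  monomial-no {α} {β} ≢ with Vec.≡-dec ℕ._≟_ α β
  ... | yes p = contradiction p ≢
  ... | no _  = K.refl

  monomial-*-at : ∀ δ ε {α} f → δ +ᵐ ε ≡ α → (monomial δ * f) α K.≈ f ε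
  monomial-*-at δ ε {α} f eq = begin
    (monomial δ * f) α                          ≈⟨ *-splits (monomial δ) f α ⟩
    splits α (λ β γ → monomial δ β K.* f γ)     ≈⟨ splits-single δ ε eq (λ β γ ≢ → K.trans (K.*-congʳ (monomial-no (≢ ∘ ≡.sym))) (K.zeroˡ _)) ⟩
    monomial δ δ K.* f ε                        ≈⟨ K.*-congʳ (monomial-yes δ) ⟩
    K.1# K.* f ε                                ≈⟨ K.*-identityˡ _ ⟩
    f ε                                         ∎

  monomial-* : ∀ δ ε → monomial δ * monomial ε ≈ monomial (δ +ᵐ ε)
  monomial-* δ ε α with Vec.≡-dec ℕ._≟_ (δ +ᵐ ε) α
  ... | yes eq = K.trans (monomial-*-at δ ε (monomial ε) eq) (monomial-yes ε)
  ... | no ≢α  = begin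
    (monomial δ * monomial ε) α                       ≈⟨ *-splits (monomial δ) (monomial ε) α ⟩
    splits α (λ β γ → monomial δ β K.* monomial ε γ)  ≈⟨ splits-cong+ α off ⟩
    splits α (λ β γ → K.0#)                           ≈⟨ splits-ε α ⟩
    K.0#                                              ∎
    where
    off : ∀ β γ → β +ᵐ γ ≡ α → monomial δ β K.* monomial ε γ K.≈ K.0#
    off β γ eq with Vec.≡-dec ℕ._≟_ δ β | Vec.≡-dec ℕ._≟_ ε γ
    ... | yes ≡.refl | yes ≡.refl = contradiction eq ≢α
    ... | yes _      | no _       = K.zeroʳ _
    ... | no _       | _          = K.zeroˡ _

  *-identityˡ : ∀ f → 1# * f ≈ f
  *-identityˡ f α = monomial-*-at 0ᵐ α f (+ᵐ-identityˡ α)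

  distribˡ : ∀ f g h → f * (g + h) ≈ (f * g) + (f * h)
  distribˡ f g h α = begin
    (f * (g + h)) α                                                         ≈⟨ *-splits f (g + h) α ⟩
    splits α (λ β γ → f β K.* (g γ K.+ h γ))                                ≈⟨ splits-cong α (λ β γ → K.distribˡ _ _ _) ⟩
    splits α (λ β γ → f β K.* g γ K.+ f β K.* h γ)                          ≈⟨ splits-∙ α _ _ ⟩
    splits α (λ β γ → f β K.* g γ) K.+ splits α (λ β γ → f β K.* h γ)       ≈⟨ K.+-cong (*-splits f g α) (*-splits f h α) ⟨
    (f * g) α K.+ (f * h) α                                                 ∎

  commutativeRing : CommutativeRing c ℓ
  commutativeRing = record
    { Carrier = K[[X]] ; _≈_ = _≈_ ; _+_ = _+_ ; _*_ = _*_ ; -_ = -_ ; 0# = 0# ; 1# = 1#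
    ; isCommutativeRing = record
      { isRing = record
        { +-isAbelianGroup = record
          { isGroup = record
            { isMonoid = record
              { isSemigroup = record
                { isMagma = record
                  { isEquivalence = record
                    { refl = λ α → K.refl ; sym = λ p α → K.sym (p α) ; trans = λ p q α → K.trans (p α) (q α) }
                  ; ∙-cong = λ p q α → K.+-cong (p α) (q α) }
                ; assoc = λ f g h α → K.+-assoc _ _ _ }
              ; identity = (λ f α → K.+-identityˡ _) , (λ f α → K.+-identityʳ _) }
            ; inverse = (λ f α → K.-‿inverseˡ _) , (λ f α → K.-‿inverseʳ _)
            ; ⁻¹-cong = λ p α → K.-‿cong (p α) }
          ; comm = λ f g α → K.+-comm _ _ }
        ; *-cong = *-cong
        ; *-assoc = *-assoc
        ; *-identity = *-identityˡ , (λ f α → K.trans (*-comm f 1# α) (*-identityˡ f α))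
        ; distrib = distribˡ , (λ f g h α → K.trans (*-comm (g + h) f α) (K.trans (distribˡ f g h α) (K.+-cong (*-comm f g α) (*-comm f h α)))) }
      ; *-comm = *-comm } }

  D-cong : ∀ i {f g} → f ≈ g → D i f ≈ D i g
  D-cong i p α = ×-congʳ (suc (lookup α i)) (p (α [ i ]%= suc))

  D-+ : ∀ i f g → D i (f + g) ≈ D i f + D i g
  D-+ i f g α = ×-distrib-+ _ _ (suc (lookup α i))

  D-* : ∀ i f g → D i (f * g) ≈ (D i f * g) + (f * D i g)
  D-* i f g α = begin
    suc (lookup α i) · (f * g) (α [ i ]%= suc)
      ≈⟨ ×-congʳ (suc (lookup α i)) (*-splits f g (α [ i ]%= suc)) ⟩
    suc (lookup α i) · splits (α [ i ]%= suc) (λ β γ → f β K.* g γ)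
      ≈⟨ splits-shift α i (λ β γ → f β K.* g γ) ⟩
    splits α (λ β γ → suc (lookup β i) · (f (β [ i ]%= suc) K.* g γ)) K.+ splits α (λ β γ → suc (lookup γ i) · (f β K.* g (γ [ i ]%= suc)))
      ≈⟨ K.+-cong (splits-cong α (λ β γ → ×-assoc-* (suc (lookup β i)) _ _)) (splits-cong α (λ β γ → ×-comm-* (suc (lookup γ i)) _ _)) ⟨
    splits α (λ β γ → D i f β K.* g γ) K.+ splits α (λ β γ → f β K.* D i g γ)
      ≈⟨ K.+-cong (*-splits (D i f) g α) (*-splits f (D i g) α) ⟨
    (D i f * g) α K.+ (f * D i g) α ∎

  D-comm : ∀ i j f → D i (D j f) ≈ D j (D i f)
  D-comm i j f α with i Fin.≟ j
  ... | yes ≡.refl = K.refl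
  ... | no i≢j = begin
    suc (lookup α i) · (suc (lookup (α [ i ]%= suc) j) · f ((α [ i ]%= suc) [ j ]%= suc))
      ≡⟨ cong₂ (λ k β → suc (lookup α i) · (suc k · f β)) (Vec.lookup∘updateAt′ j i (i≢j ∘ ≡.sym) α) (≡.sym (Vec.updateAt-commutes i j i≢j α)) ⟩
    suc (lookup α i) · (suc (lookup α j) · f ((α [ j ]%= suc) [ i ]%= suc))
      ≈⟨ ×-assocˡ _ (suc (lookup α i)) (suc (lookup α j)) ⟩
    (suc (lookup α i) ℕ.* suc (lookup α j)) · f ((α [ j ]%= suc) [ i ]%= suc)
      ≡⟨ cong (_· f ((α [ j ]%= suc) [ i ]%= suc)) (ℕ.*-comm (suc (lookup α i)) (suc (lookup α j))) ⟩
    (suc (lookup α j) ℕ.* suc (lookup α i)) · f ((α [ j ]%= suc) [ i ]%= suc)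
      ≈⟨ ×-assocˡ _ (suc (lookup α j)) (suc (lookup α i)) ⟨
    suc (lookup α j) · (suc (lookup α i) · f ((α [ j ]%= suc) [ i ]%= suc))
      ≡⟨ cong (λ k → suc (lookup α j) · (suc k · f ((α [ j ]%= suc) [ i ]%= suc))) (Vec.lookup∘updateAt′ i j i≢j α) ⟨
    suc (lookup α j) · (suc (lookup (α [ j ]%= suc) i) · f ((α [ j ]%= suc) [ i ]%= suc)) ∎

  open CommutativeRing commutativeRing using (+-rawMonoid)

  ·-coefficient : ∀ k f α → RawMonoidOps._×_ +-rawMonoid k f α ≡ k · f α
  ·-coefficient zero    f α = ≡.refl
  ·-coefficient (suc k) f α = cong (f α K.+_) (·-coefficient k f α)

  differentialAlgebra : DifferentialAlgebra c ℓ n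
  differentialAlgebra = record
    { commutativeRing = commutativeRing
    ; D = D ; D-cong = D-cong ; D-+ = D-+ ; D-* = D-* ; D-comm = D-comm
    ; 1/suc = λ k → (+ 1 ℚ./ suc k) • 1#
    ; ·-1/ = λ k α → begin
        RawMonoidOps._×_ +-rawMonoid (suc k) ((+ 1 ℚ./ suc k) • 1#) α      ≡⟨ ·-coefficient (suc k) ((+ 1 ℚ./ suc k) • 1#) α ⟩
        suc k · (K.fromℚ (+ 1 ℚ./ suc k) K.* 1# α)                         ≈⟨ ×-assoc-* (suc k) _ _ ⟨
        (suc k · K.fromℚ (+ 1 ℚ./ suc k)) K.* 1# α                         ≈⟨ K.*-congʳ (·-fromℚ-1/ k) ⟩
        K.1# K.* 1# α                                                      ≈⟨ K.*-identityˡ _ ⟩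
        1# α                                                               ∎
    }

-- Taylor expansion and the Burgers equation

module DifferentialAlgebraProperties {c ℓ n} (A : DifferentialAlgebra c ℓ n) where
  open DifferentialAlgebra A public hiding (zero)
  open Convolution +-commutativeMonoid public
    using (conv; conv-cong; conv-cong+; conv-last; conv-∙; conv-ε; conv-single; conv-medial; conv-comm; conv-shift; conv-Fin; conv-swap)
  open ListSum +-commutativeMonoid using (sum-single)
  open import Algebra.Properties.Semiring.Sum semiring public
    using (sum; sum-cong-≋; sum-replicate-zero; ∑-distrib-+; ∑-comm; *-distribˡ-sum; *-distribʳ-sum)
  open import Algebra.Properties.Semiring.Mult semiring public
    using (×-assoc-*; ×-comm-*; ×-congʳ; ×-assocˡ; ×-homo-+) renaming (_×_ to _·_)
  open import Algebra.Properties.CommutativeMonoid.Mult +-commutativeMonoid public using (×-distrib-+)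
  open import Algebra.Properties.Ring ring using (+-cancelˡ; +-inverseˡ-unique)
  open import Algebra.Properties.CommutativeSemigroup *-commutativeSemigroup using () renaming (x∙yz≈y∙xz to x*yz≈y*xz)
  open import Relation.Binary.Reasoning.Setoid setoid

  -- Common to `D i`, to multiplication by an element, to `Λ k` and to its truncations: each of them
  -- commutes with every kind of finite sum used below.
  record Additive (Φ : Carrier → Carrier) : Set (c Level.⊔ ℓ) where
    field
      Φ-cong : ∀ {f g} → f ≈ g → Φ f ≈ Φ g
      Φ-+    : ∀ f g → Φ (f + g) ≈ Φ f + Φ g

    Φ-0 : Φ 0# ≈ 0#
    Φ-0 = +-cancelˡ (Φ 0#) (Φ 0#) 0# (begin
      Φ 0# + Φ 0# ≈⟨ Φ-+ 0# 0# ⟨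
      Φ (0# + 0#) ≈⟨ Φ-cong (+-identityˡ 0#) ⟩
      Φ 0#        ≈⟨ +-identityʳ _ ⟨
      Φ 0# + 0#   ∎)

    Φ-neg : ∀ f → Φ (- f) ≈ - Φ f
    Φ-neg f = +-inverseˡ-unique (Φ (- f)) (Φ f) (trans (sym (Φ-+ (- f) f)) (trans (Φ-cong (-‿inverseˡ f)) Φ-0))

    Φ-· : ∀ k f → Φ (k · f) ≈ k · Φ f
    Φ-· zero    f = Φ-0
    Φ-· (suc k) f = trans (Φ-+ f (k · f)) (+-congˡ (Φ-· k f))

    Φ-sum : ∀ {m} (f : Fin m → Carrier) → Φ (sum f) ≈ sum (λ i → Φ (f i))
    Φ-sum {zero}  f = Φ-0
    Φ-sum {suc m} f = trans (Φ-+ (f zero) (sum (f ∘ suc))) (+-congˡ (Φ-sum (f ∘ suc)))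

    Φ-conv : ∀ N (h : ℕ → ℕ → Carrier) → Φ (conv N h) ≈ conv N (λ k l → Φ (h k l))
    Φ-conv zero    h = refl
    Φ-conv (suc N) h = trans (Φ-+ _ _) (+-congˡ (Φ-conv N (λ k l → h (suc k) l)))

  open Additive

  D-additive : ∀ i → Additive (D i)
  D-additive i = record { Φ-cong = D-cong i ; Φ-+ = D-+ i }

  *ˡ-additive : ∀ x → Additive (x *_)
  *ˡ-additive x = record { Φ-cong = *-congˡ ; Φ-+ = distribˡ x }

  *ʳ-additive : ∀ x → Additive (_* x)
  *ʳ-additive x = record { Φ-cong = *-congʳ ; Φ-+ = distribʳ x }

  D-1 : ∀ i → D i 1# ≈ 0#
  D-1 i = +-cancelˡ (D i 1#) (D i 1#) 0# (begin
    D i 1# + D i 1#               ≈⟨ +-cong (*-identityʳ _) (*-identityˡ _) ⟨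
    D i 1# * 1# + 1# * D i 1#     ≈⟨ D-* i 1# 1# ⟨
    D i (1# * 1#)                 ≈⟨ D-cong i (*-identityˡ 1#) ⟩
    D i 1#                        ≈⟨ +-identityʳ _ ⟨
    D i 1# + 0#                   ∎)

  1/suc-· : ∀ k x → 1/suc k * (suc k · x) ≈ x
  1/suc-· k x = begin
    1/suc k * (suc k · x)   ≈⟨ ×-comm-* (suc k) _ _ ⟩
    suc k · (1/suc k * x)   ≈⟨ ×-assoc-* (suc k) _ _ ⟨
    (suc k · 1/suc k) * x   ≈⟨ *-congʳ (·-1/ k) ⟩
    1# * x                  ≈⟨ *-identityˡ x ⟩
    x                       ∎

  ·-1/suc : ∀ k x → suc k · (1/suc k * x) ≈ x
  ·-1/suc k x = trans (sym (×-comm-* (suc k) _ _)) (1/suc-· k x)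

  ·-cancel : ∀ k {x y} → suc k · x ≈ suc k · y → x ≈ y
  ·-cancel k {x} {y} eq = trans (sym (1/suc-· k x)) (trans (*-congˡ eq) (1/suc-· k y))

  ·-zero : ∀ k → k · 0# ≈ 0#
  ·-zero k = sym (Φ-· 0-additive k 0#)
    where
    0-additive : Additive (λ _ → 0#)
    0-additive = record { Φ-cong = λ _ → refl ; Φ-+ = λ _ _ → sym (+-identityˡ 0#) }

  -- The Taylor coefficients of t ↦ f (X + t N).
  module Taylor (N : Fin n → Carrier) where

    -- `Λ k f` is 1/k! times the sum of `N i₁` ⋯ `N iₖ` times the k-th derivative of `f` in the
    -- directions i₁, ..., iₖ. The factors `N i` stay outside all derivatives, so this is not an
    -- iterated vector field; the recursion is d/dt of f (X + t N).
    Λ : ℕ → Carrier → Carrier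
    Λ zero    f = f
    Λ (suc k) f = 1/suc k * sum (λ i → N i * Λ k (D i f))

    suc·Λ : ∀ k f → suc k · Λ (suc k) f ≈ sum (λ i → N i * Λ k (D i f))
    suc·Λ k f = ·-1/suc k _

    Λ-cong : ∀ k {f g} → f ≈ g → Λ k f ≈ Λ k g
    Λ-cong zero    p = p
    Λ-cong (suc k) p = *-congˡ (sum-cong-≋ (λ i → *-congˡ (Λ-cong k (D-cong i p))))

    Λ-+ : ∀ k f g → Λ k (f + g) ≈ Λ k f + Λ k g
    Λ-+ zero    f g = refl
    Λ-+ (suc k) f g = begin
      1/suc k * sum (λ i → N i * Λ k (D i (f + g)))
        ≈⟨ *-congˡ (sum-cong-≋ λ i → trans (*-congˡ (trans (Λ-cong k (D-+ i f g)) (Λ-+ k (D i f) (D i g)))) (distribˡ _ _ _)) ⟩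
      1/suc k * sum (λ i → N i * Λ k (D i f) + N i * Λ k (D i g))
        ≈⟨ trans (*-congˡ (∑-distrib-+ {n} (λ i → N i * Λ k (D i f)) (λ i → N i * Λ k (D i g)))) (distribˡ _ _ _) ⟩
      Λ (suc k) f + Λ (suc k) g ∎

    Λ-additive : ∀ k → Additive (Λ k)
    Λ-additive k = record { Φ-cong = Λ-cong k ; Φ-+ = Λ-+ k }

    -- Evaluation at X + t N is multiplicative. Both sides are compared after multiplication by k +
    -- 1: the left one unfolds by the Leibniz rule for the `D i`, the right one by the product rule
    -- for d/dt.
    Λ-* : ∀ k f g → Λ k (f * g) ≈ conv k (λ a b → Λ a f * Λ b g)
    Λ-* zero    f g = refl
    Λ-* (suc k) f g = ·-cancel k (begin
      suc k · Λ (suc k) (f * g)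
        ≈⟨ suc·Λ k (f * g) ⟩
      sum (λ i → N i * Λ k (D i (f * g)))
        ≈⟨ sum-cong-≋ (λ i → *-congˡ (trans (Λ-cong k (D-* i f g)) (trans (Λ-+ k _ _) (+-cong (Λ-* k (D i f) g) (Λ-* k f (D i g)))))) ⟩
      sum (λ i → N i * (conv k (λ a b → Λ a (D i f) * Λ b g) + conv k (λ a b → Λ a f * Λ b (D i g))))
        ≈⟨ sum-cong-≋ (λ i → trans (distribˡ _ _ _) (+-cong
             (trans (Φ-conv (*ˡ-additive (N i)) k _) (conv-cong k λ a b → sym (*-assoc _ _ _)))
             (trans (Φ-conv (*ˡ-additive (N i)) k _) (conv-cong k λ a b → x*yz≈y*xz _ _ _)))) ⟩
      sum (λ i → conv k (λ a b → (N i * Λ a (D i f)) * Λ b g) + conv k (λ a b → Λ a f * (N i * Λ b (D i g))))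
        ≈⟨ ∑-distrib-+ {n} (λ i → conv k (λ a b → (N i * Λ a (D i f)) * Λ b g)) (λ i → conv k (λ a b → Λ a f * (N i * Λ b (D i g)))) ⟩
      sum (λ i → conv k (λ a b → (N i * Λ a (D i f)) * Λ b g)) + sum (λ i → conv k (λ a b → Λ a f * (N i * Λ b (D i g))))
        ≈⟨ +-cong (conv-Fin k (λ i a b → (N i * Λ a (D i f)) * Λ b g)) (conv-Fin k (λ i a b → Λ a f * (N i * Λ b (D i g)))) ⟨
      conv k (λ a b → sum (λ i → (N i * Λ a (D i f)) * Λ b g)) + conv k (λ a b → sum (λ i → Λ a f * (N i * Λ b (D i g))))
        ≈⟨ +-cong (conv-cong k λ a b → left a b) (conv-cong k λ a b → right a b) ⟨
      conv k (λ a b → suc a · (Λ (suc a) f * Λ b g)) + conv k (λ a b → suc b · (Λ a f * Λ (suc b) g))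
        ≈⟨ conv-shift k (λ a b → Λ a f * Λ b g) ⟨
      suc k · conv (suc k) (λ a b → Λ a f * Λ b g) ∎)
      where
      left : ∀ a b → suc a · (Λ (suc a) f * Λ b g) ≈ sum (λ i → (N i * Λ a (D i f)) * Λ b g)
      left a b = begin
        suc a · (Λ (suc a) f * Λ b g)             ≈⟨ ×-assoc-* (suc a) _ _ ⟨
        (suc a · Λ (suc a) f) * Λ b g             ≈⟨ *-congʳ (suc·Λ a f) ⟩
        sum (λ i → N i * Λ a (D i f)) * Λ b g     ≈⟨ *-distribʳ-sum (Λ b g) (λ i → N i * Λ a (D i f)) ⟩
        sum (λ i → (N i * Λ a (D i f)) * Λ b g)   ∎
      right : ∀ a b → suc b · (Λ a f * Λ (suc b) g) ≈ sum (λ i → Λ a f * (N i * Λ b (D i g)))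
      right a b = begin
        suc b · (Λ a f * Λ (suc b) g)             ≈⟨ ×-comm-* (suc b) _ _ ⟨
        Λ a f * (suc b · Λ (suc b) g)             ≈⟨ *-congˡ (suc·Λ b g) ⟩
        Λ a f * sum (λ i → N i * Λ b (D i g))     ≈⟨ *-distribˡ-sum (Λ a f) (λ i → N i * Λ b (D i g)) ⟩
        sum (λ i → Λ a f * (N i * Λ b (D i g)))   ∎

    Λ-const : ∀ k a f → (∀ i → D i a ≈ 0#) → Λ k (a * f) ≈ a * Λ k f
    Λ-const zero    a f Da≈0 = refl
    Λ-const (suc k) a f Da≈0 = begin
      1/suc k * sum (λ i → N i * Λ k (D i (a * f)))   ≈⟨ *-congˡ (sum-cong-≋ λ i → *-congˡ (Λ-cong k (D-const i))) ⟩
      1/suc k * sum (λ i → N i * Λ k (a * D i f))     ≈⟨ *-congˡ (sum-cong-≋ λ i → trans (*-congˡ (Λ-const k a (D i f) Da≈0)) (x*yz≈y*xz _ _ _)) ⟩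
      1/suc k * sum (λ i → a * (N i * Λ k (D i f)))   ≈⟨ *-congˡ (*-distribˡ-sum a (λ i → N i * Λ k (D i f))) ⟨
      1/suc k * (a * sum (λ i → N i * Λ k (D i f)))   ≈⟨ x*yz≈y*xz _ _ _ ⟩
      a * (1/suc k * sum (λ i → N i * Λ k (D i f)))   ∎
      where
      D-const : ∀ i → D i (a * f) ≈ a * D i f
      D-const i = trans (D-* i a f) (trans (+-congʳ (trans (*-congʳ (Da≈0 i)) (zeroˡ f))) (+-identityˡ _))

    Λ-suc-1 : ∀ k → Λ (suc k) 1# ≈ 0#
    Λ-suc-1 k = begin
      1/suc k * sum (λ i → N i * Λ k (D i 1#))  ≈⟨ *-congˡ (sum-cong-≋ λ i → trans
          (*-congˡ (trans (Λ-cong k (D-1 i)) (Φ-0 (Λ-additive k)))) (zeroʳ _)) ⟩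
      1/suc k * sum {n} (λ i → 0#)              ≈⟨ *-congˡ (sum-replicate-zero n) ⟩
      1/suc k * 0#                              ≈⟨ zeroʳ _ ⟩
      0#                                        ∎

    -- Evaluation at t = 1, cut off after order `B`. The full series converges only adically; when
    -- every `N i` has order at least 2, a coefficient of degree at most `B` sees none of the
    -- discarded terms.
    Λ≤ : ℕ → Carrier → Carrier
    Λ≤ B f = conv B (λ k _ → Λ k f)

    Λ≤-additive : ∀ B → Additive (Λ≤ B)
    Λ≤-additive B = record
      { Φ-cong = λ p → conv-cong B (λ k _ → Λ-cong k p)
      ; Φ-+    = λ f g → trans (conv-cong B (λ k _ → Λ-+ k f g)) (conv-∙ B _ _) }

    Λ≤-const : ∀ B a f → (∀ i → D i a ≈ 0#) → Λ≤ B (a * f) ≈ a * Λ≤ B f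
    Λ≤-const B a f Da≈0 = trans (conv-cong B (λ k _ → Λ-const k a f Da≈0)) (sym (Φ-conv (*ˡ-additive a) B _))

    Λ≤-1 : ∀ B → Λ≤ B 1# ≈ 1#
    Λ≤-1 B = conv-single 0 B ≡.refl off
      where
      off : ∀ k (l : ℕ) → k ≢ 0 → Λ k 1# ≈ 0#
      off zero    l ≢0 = contradiction ≡.refl ≢0
      off (suc k) l _  = Λ-suc-1 k

    module Coordinate (j : Fin n) (x : Carrier) (Dx-j : D j x ≈ 1#) (Dx-off : ∀ i → i ≢ j → D i x ≈ 0#) where

      Λ-suc-x : ∀ k → Λ (suc k) x ≈ 1/suc k * (N j * Λ k 1#)
      Λ-suc-x k = *-congˡ (trans (sum-single j (λ i → N i * Λ k (D i x)) λ i i≢j →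
                      trans (*-congˡ (trans (Λ-cong k (Dx-off i i≢j)) (Φ-0 (Λ-additive k)))) (zeroʳ _))
                    (*-congˡ (Λ-cong k Dx-j)))

      Λ-1-x : Λ 1 x ≈ N j
      Λ-1-x = begin
        Λ 1 x                    ≈⟨ Λ-suc-x 0 ⟩
        1/suc 0 * (N j * 1#)     ≈⟨ *-congˡ (trans (*-identityʳ _) (sym (+-identityʳ _))) ⟩
        1/suc 0 * (1 · N j)      ≈⟨ 1/suc-· 0 (N j) ⟩
        N j                      ∎

      -- A coordinate is linear: evaluated at X + t N it is x + t `N j`, with no higher powers of t.
      Λ-2+-x : ∀ k → Λ (suc (suc k)) x ≈ 0#
      Λ-2+-x k = trans (Λ-suc-x (suc k)) (trans (*-congˡ (trans (*-congˡ (Λ-suc-1 k)) (zeroʳ _))) (zeroʳ _))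

      Λ-x* : ∀ k f → Λ (suc k) (x * f) ≈ x * Λ (suc k) f + N j * Λ k f
      Λ-x* k f = begin
        Λ (suc k) (x * f)                                             ≈⟨ Λ-* (suc k) x f ⟩
        x * Λ (suc k) f + conv k (λ a b → Λ (suc a) x * Λ b f)        ≈⟨ +-congˡ (conv-single 0 k ≡.refl off) ⟩
        x * Λ (suc k) f + Λ 1 x * Λ k f                               ≈⟨ +-congˡ (*-congʳ Λ-1-x) ⟩
        x * Λ (suc k) f + N j * Λ k f                                 ∎
        where
        off : ∀ a b → a ≢ 0 → Λ (suc a) x * Λ b f ≈ 0#
        off zero    b ≢0 = contradiction ≡.refl ≢0
        off (suc a) b _  = trans (*-congʳ (Λ-2+-x a)) (zeroˡ _)

      -- Truncation at order B breaks multiplicativity only by a term of high order.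
      Λ≤-x* : ∀ B f → Λ≤ B (x * f) + N j * Λ B f ≈ (x + N j) * Λ≤ B f
      Λ≤-x* zero    f = sym (distribʳ _ _ _)
      Λ≤-x* (suc B) f = begin
        Λ≤ (suc B) (x * f) + N j * Λ (suc B) f
          ≈⟨ +-congʳ (conv-last B (λ k _ → Λ k (x * f))) ⟩
        (Λ≤ B (x * f) + Λ (suc B) (x * f)) + N j * Λ (suc B) f
          ≈⟨ +-congʳ (+-congˡ (Λ-x* B f)) ⟩
        (Λ≤ B (x * f) + (x * Λ (suc B) f + N j * Λ B f)) + N j * Λ (suc B) f
          ≈⟨ +-congʳ (trans (+-congˡ (+-comm _ _)) (sym (+-assoc _ _ _))) ⟩
        ((Λ≤ B (x * f) + N j * Λ B f) + x * Λ (suc B) f) + N j * Λ (suc B) f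
          ≈⟨ trans (+-assoc _ _ _) (+-cong (Λ≤-x* B f) (sym (distribʳ _ _ _))) ⟩
        (x + N j) * Λ≤ B f + (x + N j) * Λ (suc B) f
          ≈⟨ trans (*-congˡ (conv-last B (λ k _ → Λ k f))) (distribˡ _ _ _) ⟨
        (x + N j) * Λ≤ (suc B) f ∎

  -- If V solves ∂V/∂t = (V · ∇) V with V = U at t = 0, then V (t) (X − t U) = U;
  -- V b holds the coefficients of t ^ b.
  module Burgers (U : Fin n → Carrier) (V : ℕ → Fin n → Carrier)
    (initial  : ∀ j → V 0 j ≈ U j)
    (equation : ∀ b j → suc b · V (suc b) j ≈ conv b (λ k l → sum (λ i → V k i * D i (V l j)))) where

    open Taylor (λ i → - U i)

    -- The coefficient of t ^ m in V (t) (X - t U).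
    along : ℕ → Fin n → Carrier
    along m j = conv m (λ a b → Λ a (V b j))

    -- The time derivative along the characteristic is ((V - U) · ∇) V. Replacing V there by U would
    -- be circular for the whole series, but the coefficient of t ^ m involves only coefficients of
    -- V along the characteristic up to order m; by strong induction these are U in order 0 and
    -- vanish otherwise, so everything cancels.
    along-suc : ∀ m j → along (suc m) j ≈ 0#
    along-suc = <-rec (λ m → ∀ j → along (suc m) j ≈ 0#) λ m rec j →
      ·-cancel m (trans (step m j rec) (sym (·-zero (suc m))))
      where
      along′ : ℕ → Fin n → Fin n → Carrier
      along′ m i j = conv m (λ a b → Λ a (D i (V b j)))
      -- The share of the time derivative that comes from the moving point X - t U.
      transport : ∀ m j → conv m (λ a b → suc a · Λ (suc a) (V b j)) ≈ sum (λ i → - U i * along′ m i j)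
      transport m j = begin
        conv m (λ a b → suc a · Λ (suc a) (V b j))               ≈⟨ conv-cong m (λ a b → suc·Λ a (V b j)) ⟩
        conv m (λ a b → sum (λ i → - U i * Λ a (D i (V b j))))   ≈⟨ conv-Fin m (λ i a b → - U i * Λ a (D i (V b j))) ⟩
        sum (λ i → conv m (λ a b → - U i * Λ a (D i (V b j))))   ≈⟨ sum-cong-≋ (λ i → Φ-conv (*ˡ-additive (- U i)) m _) ⟨
        sum (λ i → - U i * along′ m i j)                         ∎
      -- The share that comes from the equation. Multiplicativity of `Λ` and the regrouping by
      -- `conv-medial` produce a product of two series, each already evaluated along the
      -- characteristic.
      evolve : ∀ m j → conv m (λ a b → suc b · Λ a (V (suc b) j)) ≈ sum (λ i → conv m (λ x y → along x i * along′ y i j))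
      evolve m j = begin
        conv m (λ a b → suc b · Λ a (V (suc b) j))
          ≈⟨ conv-cong m (λ a b → trans (sym (Φ-· (Λ-additive a) (suc b) _)) (Λ-cong a (equation b j))) ⟩
        conv m (λ a b → Λ a (conv b (λ k l → sum (λ i → V k i * D i (V l j)))))
          ≈⟨ conv-cong m (λ a b → trans (Φ-conv (Λ-additive a) b _) (conv-cong b λ k l →
               trans (Φ-sum (Λ-additive a) (λ i → V k i * D i (V l j))) (sum-cong-≋ λ i → Λ-* a (V k i) (D i (V l j))))) ⟩
        conv m (λ a b → conv b (λ k l → sum (λ i → conv a (λ a′ a″ → Λ a′ (V k i) * Λ a″ (D i (V l j))))))
          ≈⟨ conv-cong m (λ a b → conv-Fin b (λ i k l → conv a (λ a′ a″ → Λ a′ (V k i) * Λ a″ (D i (V l j))))) ⟩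
        conv m (λ a b → sum (λ i → conv b (λ k l → conv a (λ a′ a″ → Λ a′ (V k i) * Λ a″ (D i (V l j))))))
          ≈⟨ conv-Fin m (λ i a b → conv b (λ k l → conv a (λ a′ a″ → Λ a′ (V k i) * Λ a″ (D i (V l j))))) ⟩
        sum (λ i → conv m (λ a b → conv b (λ k l → conv a (λ a′ a″ → Λ a′ (V k i) * Λ a″ (D i (V l j))))))
          ≈⟨ sum-cong-≋ (λ i → conv-cong m λ a b → conv-swap b a (λ k l a′ a″ → Λ a′ (V k i) * Λ a″ (D i (V l j)))) ⟩
        sum (λ i → conv m (λ a b → conv a (λ a′ a″ → conv b (λ k l → Λ a′ (V k i) * Λ a″ (D i (V l j))))))
          ≈⟨ sum-cong-≋ (λ i → conv-medial m (λ a′ a″ k l → Λ a′ (V k i) * Λ a″ (D i (V l j)))) ⟩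
        sum (λ i → conv m (λ x y → conv x (λ a′ k → conv y (λ a″ l → Λ a′ (V k i) * Λ a″ (D i (V l j))))))
          ≈⟨ sum-cong-≋ (λ i → conv-cong m λ x y → trans (Φ-conv (*ʳ-additive (along′ y i j)) x _)
              (conv-cong x λ a′ k → Φ-conv (*ˡ-additive _) y _)) ⟨
        sum (λ i → conv m (λ x y → along x i * along′ y i j)) ∎
      step : ∀ m j → (∀ {k} → k ℕ.< m → ∀ i → along (suc k) i ≈ 0#) → suc m · along (suc m) j ≈ 0#
      step m j rec = begin
        suc m · along (suc m) j
          ≈⟨ conv-shift m (λ a b → Λ a (V b j)) ⟩
        conv m (λ a b → suc a · Λ (suc a) (V b j)) + conv m (λ a b → suc b · Λ a (V (suc b) j))
          ≈⟨ +-cong (transport m j) (evolve m j) ⟩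
        sum (λ i → - U i * along′ m i j) + sum (λ i → conv m (λ x y → along x i * along′ y i j))
          ≈⟨ +-congˡ (sum-cong-≋ λ i → trans (conv-cong+ m (only-0 i)) (conv-single 0 m ≡.refl (off i))) ⟩
        sum (λ i → - U i * along′ m i j) + sum (λ i → U i * along′ m i j)
          ≈⟨ ∑-distrib-+ {n} (λ i → - U i * along′ m i j) (λ i → U i * along′ m i j) ⟨
        sum (λ i → - U i * along′ m i j + U i * along′ m i j)
          ≈⟨ sum-cong-≋ (λ i → trans (sym (distribʳ _ _ _)) (trans (*-congʳ (-‿inverseˡ (U i))) (zeroˡ _))) ⟩
        sum {n} (λ i → 0#)
          ≈⟨ sum-replicate-zero n ⟩
        0# ∎
        where
        at-0 : Fin n → ℕ → ℕ → Carrier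
        at-0 i zero    y = U i * along′ y i j
        at-0 i (suc x) y = 0#
        off : ∀ i x y → x ≢ 0 → at-0 i x y ≈ 0#
        off i zero    y ≢0 = contradiction ≡.refl ≢0
        off i (suc x) y _  = refl
        only-0 : ∀ i x y → x ℕ.+ y ≡ m → along x i * along′ y i j ≈ at-0 i x y
        only-0 i zero    y eq = *-congʳ (initial i)
        only-0 i (suc x) y eq = trans (*-congʳ (rec (subst (suc x ℕ.≤_) eq (ℕ.m≤m+n (suc x) y)) i)) (zeroˡ _)

-- Orders and substitution

+<+⇒<⊎< : ∀ {x y} a b → x ℕ.+ y ℕ.< a ℕ.+ b → x ℕ.< a ⊎ y ℕ.< b
+<+⇒<⊎< {x} {y} a b lt with x ℕ.<? a | y ℕ.<? b
... | yes x<a | _       = inj₁ x<a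
... | no _    | yes y<b = inj₂ y<b
... | no x≮a  | no y≮b  = contradiction (ℕ.+-mono-≤ (ℕ.≮⇒≥ x≮a) (ℕ.≮⇒≥ y≮b)) (ℕ.<⇒≱ lt)

-- The induction step for monomials: each is 1 or a variable times a monomial of smaller degree.
0-or-%= : ∀ {m} (β : MultiIndex m) → β ≡ Vec.replicate m 0 ⊎ ∃₂ λ j β′ → β ≡ β′ [ j ]%= suc
0-or-%= []          = inj₁ ≡.refl
0-or-%= (suc b ∷ β) = inj₂ (zero , b ∷ β , ≡.refl)
0-or-%= (zero ∷ β) with 0-or-%= β
... | inj₁ eq            = inj₁ (cong (0 ∷_) eq)
... | inj₂ (j , β′ , eq) = inj₂ (suc j , 0 ∷ β′ , cong (0 ∷_) eq)

lookup≤deg : ∀ {m} (α : MultiIndex m) i → lookup α i ℕ.≤ (deg α)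
lookup≤deg (a ∷ α) zero    = ℕ.m≤m+n a (deg α)
lookup≤deg (a ∷ α) (suc i) = ℕ.≤-trans (lookup≤deg α i) (ℕ.m≤n+m (deg α) a)

module Orders {c ℓ} (K : Commutativeℚ-Algebra c ℓ) (n : ℕ) where
  private module K = Commutativeℚ-Algebra K
  module PS = PowerSeries K n
  open PS using (K[[X]]; OnlyDegrees≥; monomial; 0ᵐ; X; ∇; ∑-box; substitute; _⊖_; _⊕_; _≋_; _⊚_; FormalMap; product; _^_) public
  module PSA = PowerSeriesAlgebra K n
  open PSA using (*-splits; splits-cong+; splits-cong; splits-ε; monomial-no; monomial-yes; monomial-*; monomial-*-at; differentialAlgebra) public
  open DifferentialAlgebraProperties differentialAlgebra public
  open Additive

  module KC = Convolution K.+-commutativeMonoid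
  open import Algebra.Properties.Semiring.Sum K.semiring using () renaming (sum to K-sum; sum-cong-≋ to K-sum-cong)
  open import Algebra.Properties.Monoid.Mult K.+-monoid using () renaming (_×_ to _K·_; ×-congʳ to K·-congʳ)
  open import Relation.Binary.Reasoning.Setoid K.setoid
  open import Algebra.Properties.Ring K.ring using (-0#≈0#)

  K·-zero : ∀ k → k K· K.0# K.≈ K.0#
  K·-zero zero    = K.refl
  K·-zero (suc k) = K.trans (K.+-identityˡ _) (K·-zero k)

  infix 4 _≈[_]_
  _≈[_]_ : K[[X]] → ℕ → K[[X]] → Set ℓ
  f ≈[ d ] g = ∀ α → (deg α) ℕ.< d → f α K.≈ g α

  *-cong[] : ∀ {d f f′ g g′} → f ≈[ d ] f′ → g ≈[ d ] g′ → f * g ≈[ d ] f′ * g′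
  *-cong[] {d} {f} {f′} {g} {g′} p q α α<d = begin
    (f * g) α                                 ≈⟨ *-splits f g α ⟩
    PSA.splits α (λ β γ → f β K.* g γ)        ≈⟨ splits-cong+ α (λ β γ eq → K.*-cong
                                                   (p β (below β γ eq (ℕ.m≤m+n (deg β) (deg γ)))) (q γ (below β γ eq (ℕ.m≤n+m (deg γ) (deg β))))) ⟩
    PSA.splits α (λ β γ → f′ β K.* g′ γ)      ≈⟨ *-splits f′ g′ α ⟨
    (f′ * g′) α                               ∎
    where
    below : ∀ β γ → β +ᵐ γ ≡ α → ∀ {x} → x ℕ.≤ (deg β) ℕ.+ (deg γ) → x ℕ.< d
    below β γ eq x≤ = ℕ.≤-<-trans (ℕ.≤-trans x≤ (ℕ.≤-reflexive (≡.trans (≡.sym (deg-+ᵐ β γ)) (cong deg eq)))) α<d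

  order-0 : ∀ {d} → OnlyDegrees≥ d 0#
  order-0 α _ = K.refl

  order-cong : ∀ {d f g} → f ≈ g → OnlyDegrees≥ d f → OnlyDegrees≥ d g
  order-cong p o α lt = K.trans (K.sym (p α)) (o α lt)

  order-mono : ∀ {d e f} → d ℕ.≤ e → OnlyDegrees≥ e f → OnlyDegrees≥ d f
  order-mono d≤e o α lt = o α (ℕ.<-≤-trans lt d≤e)

  order-+ : ∀ {d f g} → OnlyDegrees≥ d f → OnlyDegrees≥ d g → OnlyDegrees≥ d (f + g)
  order-+ p q α lt = K.trans (K.+-cong (p α lt) (q α lt)) (K.+-identityˡ _)

  order-neg : ∀ {d f} → OnlyDegrees≥ d f → OnlyDegrees≥ d (- f)
  order-neg p α lt = K.trans (K.-‿cong (p α lt)) -0#≈0#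

  order-sum : ∀ {d m} (f : Fin m → K[[X]]) → (∀ i → OnlyDegrees≥ d (f i)) → OnlyDegrees≥ d (sum f)
  order-sum {m = zero}  f o = order-0
  order-sum {m = suc m} f o = order-+ (o zero) (order-sum (f ∘ suc) (o ∘ suc))

  order-conv : ∀ {d} N (h : ℕ → ℕ → K[[X]]) → (∀ k l → k ℕ.+ l ≡ N → OnlyDegrees≥ d (h k l)) → OnlyDegrees≥ d (conv N h)
  order-conv zero    h o = o 0 0 ≡.refl
  order-conv (suc N) h o = order-+ (o 0 (suc N) ≡.refl) (order-conv N (λ k l → h (suc k) l) (λ k l eq → o (suc k) l (cong suc eq)))

  order-D : ∀ {d f} i → OnlyDegrees≥ (suc d) f → OnlyDegrees≥ d (D i f)
  order-D {d} {f} i o α lt = K.trans (K·-congʳ (suc (lookup α i))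
      (o (α [ i ]%= suc) (ℕ.≤-trans (ℕ.≤-reflexive (cong suc (deg-%= α i))) (s≤s lt)))) (K·-zero (suc (lookup α i)))

  order-* : ∀ {d e f g} → OnlyDegrees≥ d f → OnlyDegrees≥ e g → OnlyDegrees≥ (d ℕ.+ e) (f * g)
  order-* {d} {e} {f} {g} p q α lt = begin
    (f * g) α                            ≈⟨ *-splits f g α ⟩
    PSA.splits α (λ β γ → f β K.* g γ)   ≈⟨ splits-cong+ α vanish ⟩
    PSA.splits α (λ β γ → K.0#)          ≈⟨ splits-ε α ⟩
    K.0#                                 ∎
    where
    vanish : ∀ β γ → β +ᵐ γ ≡ α → f β K.* g γ K.≈ K.0#
    vanish β γ eq with +<+⇒<⊎< d e (subst (ℕ._< d ℕ.+ e) (≡.trans (cong deg (≡.sym eq)) (deg-+ᵐ β γ)) lt)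
    ... | inj₁ β<d = K.trans (K.*-congʳ (p β β<d)) (K.zeroˡ _)
    ... | inj₂ γ<e = K.trans (K.*-congˡ (q γ γ<e)) (K.zeroʳ _)

  order-any : ∀ f → OnlyDegrees≥ 0 f
  order-any f α ()

  order-*ˡ : ∀ {d f} x → OnlyDegrees≥ d f → OnlyDegrees≥ d (x * f)
  order-*ˡ x o = order-* (order-any x) o

  order-·⁻ : ∀ {d f} k → OnlyDegrees≥ d (suc k · f) → OnlyDegrees≥ d f
  order-·⁻ {f = f} k o = order-cong (1/suc-· k f) (order-*ˡ (1/suc k) o)

  const : K.Carrier → K[[X]]
  const x α = x K.* 1# α

  const-* : ∀ x f α → (const x * f) α K.≈ x K.* f α
  const-* x f α = begin
    (const x * f) α                                   ≈⟨ *-splits (const x) f α ⟩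
    PSA.splits α (λ β γ → (x K.* 1# β) K.* f γ)       ≈⟨ splits-cong α (λ β γ → K.*-assoc _ _ _) ⟩
    PSA.splits α (λ β γ → x K.* (1# β K.* f γ))       ≈⟨ PSA.splits-*ˡ α x (λ β γ → 1# β K.* f γ) ⟨
    x K.* PSA.splits α (λ β γ → 1# β K.* f γ)         ≈⟨ K.*-congˡ (*-splits 1# f α) ⟨
    x K.* (1# * f) α                                  ≈⟨ K.*-congˡ (*-identityˡ f α) ⟩
    x K.* f α                                         ∎

  %=≢0 : ∀ {m} (α : MultiIndex m) i → Vec.replicate m 0 ≢ α [ i ]%= suc
  %=≢0 (a ∷ α) zero    ()
  %=≢0 (a ∷ α) (suc i) eq = %=≢0 α i (Vec.∷-injectiveʳ eq)

  D-const : ∀ x i → D i (const x) ≈ 0#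
  D-const x i α = K.trans (K·-congʳ (suc (lookup α i)) (K.trans (K.*-congˡ (monomial-no (%=≢0 α i))) (K.zeroʳ x))) (K·-zero (suc (lookup α i)))

  -- Locates the only coefficient of a derivative of `X j` that can be nonzero, as needed for `D-X`
  -- and `D-X-off`.
  0ᵐ-or-≢ : ∀ {m} (i j : Fin m) α → (Vec.replicate m 0 [ j ]≔ 1) ≡ α [ i ]%= suc → i ≡ j × α ≡ Vec.replicate m 0
  0ᵐ-or-≢ zero    zero    (a ∷ α) eq = ≡.refl , cong₂ _∷_ (≡.sym (ℕ.suc-injective (Vec.∷-injectiveˡ eq))) (≡.sym (Vec.∷-injectiveʳ eq))
  0ᵐ-or-≢ zero    (suc j) (a ∷ α) eq = contradiction (Vec.∷-injectiveˡ eq) λ ()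
  0ᵐ-or-≢ (suc i) zero    (a ∷ α) eq = contradiction (Vec.∷-injectiveʳ eq) (%=≢0 α i)
  0ᵐ-or-≢ (suc i) (suc j) (a ∷ α) eq with 0ᵐ-or-≢ i j α (Vec.∷-injectiveʳ eq)
  ... | p , q = cong suc p , cong₂ _∷_ (≡.sym (Vec.∷-injectiveˡ eq)) q

  0ᵐ-%= : ∀ {m} (j : Fin m) → Vec.replicate m 0 [ j ]≔ 1 ≡ Vec.replicate m 0 [ j ]%= suc
  0ᵐ-%= zero    = ≡.refl
  0ᵐ-%= (suc j) = cong (0 ∷_) (0ᵐ-%= j)

  D-X-off : ∀ j i → i ≢ j → D i (X j) ≈ 0#
  D-X-off j i i≢j α = K.trans (K·-congʳ (suc (lookup α i)) (monomial-no (λ eq → i≢j (proj₁ (0ᵐ-or-≢ i j α eq))))) (K·-zero (suc (lookup α i)))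

  D-X : ∀ j → D j (X j) ≈ 1#
  D-X j α with Vec.≡-dec ℕ._≟_ 0ᵐ α
  ... | yes ≡.refl = begin
    suc (lookup 0ᵐ j) K· X j (0ᵐ [ j ]%= suc)   ≡⟨ cong₂ (λ k β → suc k K· X j β) (Vec.lookup-replicate j 0) (≡.sym (0ᵐ-%= j)) ⟩
    1 K· X j (0ᵐ [ j ]≔ 1)                      ≈⟨ K.+-identityʳ _ ⟩
    X j (0ᵐ [ j ]≔ 1)                           ≈⟨ monomial-yes (0ᵐ [ j ]≔ 1) ⟩
    K.1#                                        ∎
  ... | no ≢0 = K.trans (K·-congʳ (suc (lookup α j)) (monomial-no (λ eq → ≢0 (≡.sym (proj₂ (0ᵐ-or-≢ j j α eq)))))) (K·-zero (suc (lookup α j)))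

  X-* : ∀ j β → X j * monomial β ≈ monomial (β [ j ]%= suc)
  X-* j β α = K.trans (monomial-* (0ᵐ [ j ]≔ 1) β α) (K.reflexive (cong (λ γ → monomial γ α) (unit+ᵐ β j)))

  conv-coefficient : ∀ N (h : ℕ → ℕ → K[[X]]) α → conv N h α ≡ KC.conv N (λ k l → h k l α)
  conv-coefficient zero    h α = ≡.refl
  conv-coefficient (suc N) h α = cong (h 0 (suc N) α K.+_) (conv-coefficient N (λ k l → h (suc k) l) α)

  sum-coefficient : ∀ {m} (f : Fin m → K[[X]]) α → sum f α ≡ K-sum (λ i → f i α)
  sum-coefficient {zero}  f α = ≡.refl
  sum-coefficient {suc m} f α = cong (f zero α K.+_) (sum-coefficient (f ∘ suc) α)

  ∑-box-cong : ∀ m d {h h′ : MultiIndex m → K.Carrier} → (∀ β → h β K.≈ h′ β) → ∑-box m d h K.≈ ∑-box m d h′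
  ∑-box-cong zero    d eq = eq []
  ∑-box-cong (suc m) d eq = K-sum-cong {suc d} (λ k → ∑-box-cong m d (λ β → eq (toℕ k ∷ β)))

  ∑-box-0 : ∀ m d → ∑-box m d (λ _ → K.0#) K.≈ K.0#
  ∑-box-0 zero    d = K.refl
  ∑-box-0 (suc m) d = K.trans (K-sum-cong {suc d} (λ _ → ∑-box-0 m d)) (K-sum-0 (suc d))
    where open import Algebra.Properties.Monoid.Sum K.+-monoid using () renaming (sum-replicate-zero to K-sum-0)

  ∑-box-single : ∀ {m d} (γ : MultiIndex m) (h : MultiIndex m → K.Carrier) → (∀ i → lookup γ i ℕ.≤ d) →
                 (∀ β → β ≢ γ → h β K.≈ K.0#) → ∑-box m d h K.≈ h γ
  ∑-box-single []      h γ≤d off = K.refl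
  ∑-box-single {suc m} {d} (c ∷ γ) h γ≤d off = begin
    K-sum {suc d} (λ k → ∑-box m d λ β → h (toℕ k ∷ β))
      ≈⟨ K-sum-single c′ (λ k → ∑-box m d λ β → h (toℕ k ∷ β)) (λ k k≢ →
           K.trans (∑-box-cong m d (λ β → off _ (λ eq → k≢ (Fin.toℕ-injective (≡.trans (Vec.∷-injectiveˡ eq) (≡.sym toℕ-c′)))))) (∑-box-0 m d)) ⟩
    ∑-box m d (λ β → h (toℕ c′ ∷ β))
      ≡⟨ cong (λ k → ∑-box m d (λ β → h (k ∷ β))) toℕ-c′ ⟩
    ∑-box m d (λ β → h (c ∷ β))
      ≈⟨ ∑-box-single γ (λ β → h (c ∷ β)) (γ≤d ∘ suc) (λ β β≢ → off _ (β≢ ∘ Vec.∷-injectiveʳ)) ⟩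
    h (c ∷ γ) ∎
    where
    c′ : Fin (suc d)
    c′ = fromℕ< (s≤s (γ≤d zero))
    toℕ-c′ : toℕ c′ ≡ c
    toℕ-c′ = Fin.toℕ-fromℕ< (s≤s (γ≤d zero))
    open ListSum K.+-commutativeMonoid using () renaming (sum-single to K-sum-single)

  -- `∑-box` adds single coefficients whereas `Φ` acts on whole series, so the sum is first
  -- rewritten as a sum of series.
  additive-∑-box : ∀ {Φ} → Additive Φ → ∀ m d (h : MultiIndex m → K[[X]]) →
                   Φ (λ γ → ∑-box m d (λ β → h β γ)) ≈ λ γ → ∑-box m d (λ β → Φ (h β) γ)
  additive-∑-box {Φ} Φ⁺ zero    d h = refl {Φ (h [])}
  additive-∑-box {Φ} Φ⁺ (suc m) d h γ = begin
    Φ (λ γ → ∑-box (suc m) d (λ β → h β γ)) γ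
      ≈⟨ Φ-cong Φ⁺ {λ γ → ∑-box (suc m) d (λ β → h β γ)} {sum {suc d} (λ k γ → ∑-box m d (λ β → h (toℕ k ∷ β) γ))}
          (λ γ → K.reflexive (≡.sym (sum-coefficient {suc d} (λ k γ → ∑-box m d (λ β → h (toℕ k ∷ β) γ)) γ))) γ ⟩
    Φ (sum {suc d} (λ k γ → ∑-box m d (λ β → h (toℕ k ∷ β) γ))) γ
      ≈⟨ Φ-sum Φ⁺ {suc d} (λ k γ → ∑-box m d (λ β → h (toℕ k ∷ β) γ)) γ ⟩
    sum {suc d} (λ k → Φ (λ γ → ∑-box m d (λ β → h (toℕ k ∷ β) γ))) γ
      ≡⟨ sum-coefficient {suc d} (λ k → Φ (λ γ → ∑-box m d (λ β → h (toℕ k ∷ β) γ))) γ ⟩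
    K-sum {suc d} (λ k → Φ (λ γ → ∑-box m d (λ β → h (toℕ k ∷ β) γ)) γ)
      ≈⟨ K-sum-cong {suc d} (λ k → additive-∑-box Φ⁺ m d (λ β → h (toℕ k ∷ β)) γ) ⟩
    K-sum {suc d} (λ k → ∑-box m d (λ β → Φ (h (toℕ k ∷ β)) γ)) ∎

  -- The cut is by a box of exponents rather than by total degree, to match the shape of
  -- `substitute`.
  truncate : ℕ → K[[X]] → K[[X]]
  truncate d f γ = ∑-box n d (λ β → f β K.* monomial β γ)

  truncate≈ : ∀ d f → f ≈[ suc d ] truncate d f
  truncate≈ d f γ (s≤s γ≤d) = K.sym (begin
    ∑-box n d (λ β → f β K.* monomial β γ)  ≈⟨ ∑-box-single γ _ (λ i → ℕ.≤-trans (lookup≤deg γ i) γ≤d)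
        (λ β ≢ → K.trans (K.*-congˡ (monomial-no ≢)) (K.zeroʳ _)) ⟩
    f γ K.* monomial γ γ                    ≈⟨ K.trans (K.*-congˡ (monomial-yes γ)) (K.*-identityʳ _) ⟩
    f γ                                     ∎)

  power-0 : (F : FormalMap) → product (λ j → F j ^ lookup 0ᵐ j) ≈ 1#
  power-0 F = trans (product-cong λ j → reflexive (cong (F j ^_) (Vec.lookup-replicate j 0))) (product-1 n)
    where open import Algebra.Properties.Monoid.Sum *-monoid using () renaming (sum-cong-≋ to product-cong; sum-replicate-zero to product-1)

  power-%= : ∀ {m} (F : Fin m → K[[X]]) (β : MultiIndex m) j →
             product (λ i → F i ^ lookup (β [ j ]%= suc) i) ≈ F j * product (λ i → F i ^ lookup β i)
  power-%= F (b ∷ β) zero    = *-assoc _ _ _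
  power-%= F (b ∷ β) (suc j) = trans {product (λ i → F i ^ lookup ((b ∷ β) [ suc j ]%= suc) i)}
      (*-congˡ {F zero ^ b} (power-%= (F ∘ suc) β j)) (x*yz≈y*xz (F zero ^ b) (F (suc j)) _)
    where open import Algebra.Properties.CommutativeSemigroup *-commutativeSemigroup using () renaming (x∙yz≈y∙xz to x*yz≈y*xz)

  module Substitution (N : FormalMap) (N-order : ∀ i → OnlyDegrees≥ 2 (N i)) where
    open Taylor N public

    F : FormalMap
    F = X ⊕ N

    -- Each step loses at most one degree to `D i` and gains two from `N i`.
    Λ-order : ∀ k {d f} → OnlyDegrees≥ d f → OnlyDegrees≥ (k ℕ.+ d) (Λ k f)
    Λ-order zero    o = o
    Λ-order (suc k) {d} {f} o = order-*ˡ (1/suc k) (order-sum (λ i → N i * Λ k (D i f))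
        (λ i → order-mono (step d) (order-* (N-order i) (Λ-order k (D-order d o i)))))
      where
      D-order : ∀ d → OnlyDegrees≥ d f → ∀ i → OnlyDegrees≥ (ℕ.pred d) (D i f)
      D-order zero    o i = order-any (D i f)
      D-order (suc d) o i = order-D {f = f} i o
      step : ∀ d → suc k ℕ.+ d ℕ.≤ 2 ℕ.+ (k ℕ.+ ℕ.pred d)
      step zero    = ℕ.n≤1+n _
      step (suc d) = ℕ.≤-reflexive (cong suc (ℕ.+-suc k d))

    Λ≤-order : ∀ B {d f} → OnlyDegrees≥ d f → OnlyDegrees≥ d (Λ≤ B f)
    Λ≤-order B {d} {f} o = order-conv B (λ k _ → Λ k f) (λ k _ _ → order-mono (ℕ.m≤n+m d k) (Λ-order k o))

    Λ≤-cong[] : ∀ B {d f g} → f ≈[ d ] g → Λ≤ B f ≈[ d ] Λ≤ B g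
    Λ≤-cong[] B {d} {f} {g} p α lt = begin
      Λ≤ B f α                                  ≈⟨ Φ-cong (Λ≤-additive B) {f} {(f + - g) + g}
          (λ α → K.sym (K.trans (K.+-assoc _ _ _) (K.trans (K.+-congˡ (K.-‿inverseˡ _)) (K.+-identityʳ _)))) α ⟩
      Λ≤ B ((f + - g) + g) α                    ≈⟨ Φ-+ (Λ≤-additive B) (f + - g) g α ⟩
      Λ≤ B (f + - g) α K.+ Λ≤ B g α             ≈⟨ K.+-congʳ (Λ≤-order B (λ α lt → K.trans (K.+-congʳ (p α lt)) (K.-‿inverseʳ _)) α lt) ⟩
      K.0# K.+ Λ≤ B g α                         ≈⟨ K.+-identityˡ _ ⟩
      Λ≤ B g α                                  ∎

    -- The defect `N j * Λ B f` in `Λ≤-x*` has order at least B + 2, hence is invisible up to degree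
    -- B.
    Λ≤-X* : ∀ B j f → Λ≤ B (X j * f) ≈[ suc B ] F j * Λ≤ B f
    Λ≤-X* B j f α lt = begin
      Λ≤ B (X j * f) α                          ≈⟨ K.+-identityʳ _ ⟨
      Λ≤ B (X j * f) α K.+ K.0#                 ≈⟨ K.+-congˡ (order-* (N-order j) (Λ-order B (order-any f)) α
          (ℕ.≤-trans lt (s≤s (ℕ.≤-trans (ℕ.≤-reflexive (≡.sym (ℕ.+-identityʳ B))) (ℕ.n≤1+n _))))) ⟨
      (Λ≤ B (X j * f) + N j * Λ B f) α          ≈⟨ Coordinate.Λ≤-x* j (X j) (D-X j) (D-X-off j) B f α ⟩
      (F j * Λ≤ B f) α                          ∎

    Λ≤-X : ∀ B j → Λ≤ B (X j) ≈[ suc B ] F j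
    Λ≤-X B j α lt = begin
      Λ≤ B (X j) α              ≈⟨ Φ-cong (Λ≤-additive B) {X j} {X j * 1#} (sym (*-identityʳ (X j))) α ⟩
      Λ≤ B (X j * 1#) α         ≈⟨ Λ≤-X* B j 1# α lt ⟩
      (F j * Λ≤ B 1#) α         ≈⟨ *-cong {F j} {F j} {Λ≤ B 1#} {1#} (refl {F j}) (Λ≤-1 B) α ⟩
      (F j * 1#) α              ≈⟨ *-identityʳ (F j) α ⟩
      F j α                     ∎

    Λ≤-monomial : ∀ B m β → (deg β) ≡ m → Λ≤ B (monomial β) ≈[ suc B ] product (λ j → F j ^ lookup β j)
    Λ≤-monomial B m β eq α lt with 0-or-%= β
    ... | inj₁ ≡.refl = K.trans (Λ≤-1 B α) (K.sym (power-0 F α))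
    Λ≤-monomial B zero    _ eq α lt | inj₂ (j , β , ≡.refl) = contradiction (≡.trans (≡.sym (deg-%= β j)) eq) λ ()
    Λ≤-monomial B (suc m) _ eq α lt | inj₂ (j , β , ≡.refl) = begin
      Λ≤ B (monomial (β [ j ]%= suc)) α                         ≈⟨ Φ-cong (Λ≤-additive B) {monomial (β [ j ]%= suc)}
          {X j * monomial β} (λ α → K.sym (X-* j β α)) α ⟩
      Λ≤ B (X j * monomial β) α                                 ≈⟨ Λ≤-X* B j (monomial β) α lt ⟩
      (F j * Λ≤ B (monomial β)) α                               ≈⟨ *-cong[] {f = F j} (λ _ _ → K.refl)
          (Λ≤-monomial B m β (ℕ.suc-injective (≡.trans (≡.sym (deg-%= β j)) eq))) α lt ⟩
      (F j * product (λ i → F i ^ lookup β i)) α                ≈⟨ power-%= F β j α ⟨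
      product (λ i → F i ^ lookup (β [ j ]%= suc) i) α          ∎

    -- Taylor's formula. Up to degree `deg α` the series `f` is a polynomial, both sides are linear
    -- in it, and on a monomial both give the corresponding product of powers of the `F j`.
    substitute≈Λ≤ : ∀ f α → substitute f F α K.≈ Λ≤ (deg α) f α
    substitute≈Λ≤ f α = begin
      ∑-box n (deg α) (λ β → f β K.* product (λ j → F j ^ lookup β j) α)
        ≈⟨ ∑-box-cong n (deg α) (λ β → K.*-congˡ (Λ≤-monomial (deg α) (deg β) β ≡.refl α (ℕ.n<1+n _))) ⟨
      ∑-box n (deg α) (λ β → f β K.* Λ≤ (deg α) (monomial β) α)
        ≈⟨ ∑-box-cong n (deg α) (λ β → scale (deg α) β) ⟨
      ∑-box n (deg α) (λ β → Λ≤ (deg α) (λ γ → f β K.* monomial β γ) α)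
        ≈⟨ additive-∑-box (Λ≤-additive (deg α)) n (deg α) (λ β γ → f β K.* monomial β γ) α ⟨
      Λ≤ (deg α) (truncate (deg α) f) α
        ≈⟨ Λ≤-cong[] (deg α) (truncate≈ (deg α) f) α (ℕ.n<1+n _) ⟨
      Λ≤ (deg α) f α ∎
      where
      scale : ∀ d β → Λ≤ d (λ γ → f β K.* monomial β γ) α K.≈ f β K.* Λ≤ d (monomial β) α
      scale d β = begin
        Λ≤ d (λ γ → f β K.* monomial β γ) α       ≈⟨ Φ-cong (Λ≤-additive d) {λ γ → f β K.* monomial β γ}
            {const (f β) * monomial β} (λ γ → K.sym (const-* (f β) (monomial β) γ)) α ⟩
        Λ≤ d (const (f β) * monomial β) α         ≈⟨ Λ≤-const d (const (f β)) (monomial β) (D-const (f β)) α ⟩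
        (const (f β) * Λ≤ d (monomial β)) α       ≈⟨ const-* (f β) (Λ≤ d (monomial β)) α ⟩
        f β K.* Λ≤ d (monomial β) α               ∎

    -- The lowest-degree part survives: if `f` has order at least `d`, then `Λ k f` with k ≥ 1 has
    -- order above `d`, so in degree `d` only `Λ 0 f`, which is `f`, contributes.
    Λ≤-injective : ∀ f → (∀ α → Λ≤ (deg α) f α K.≈ K.0#) → f ≈ 0#
    Λ≤-injective f Λ≤f≈0 α = orders (suc (deg α)) α (ℕ.n<1+n _)
      where
      orders : ∀ d → OnlyDegrees≥ d f
      orders zero    = order-any f
      orders (suc d) α (s≤s α≤d) with ℕ.m≤n⇒m<n∨m≡n α≤d
      ... | inj₁ α<d    = orders d α α<d
      ... | inj₂ α≡d = begin
        f α                                        ≈⟨ KC.conv-single {(deg α)} 0 (deg α) {λ k _ → Λ k f α} ≡.refl off ⟨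
        KC.conv (deg α) (λ k _ → Λ k f α)            ≡⟨ conv-coefficient (deg α) (λ k _ → Λ k f) α ⟨
        Λ≤ (deg α) f α                               ≈⟨ Λ≤f≈0 α ⟩
        K.0#                                       ∎
        where
        off : ∀ k (l : ℕ) → k ≢ 0 → Λ k f α K.≈ K.0#
        off zero    l ≢0 = contradiction ≡.refl ≢0
        off (suc k) l _  = Λ-order (suc k) (orders d) α (s≤s (ℕ.≤-trans (ℕ.≤-reflexive α≡d) (ℕ.m≤n+m d k)))

  -- The index of `q` is the exponent of t; in the application `q b` collects the trees with b + 1
  -- vertices. Both conditions concern gradients only and thus leave additive constants in the `q b`
  -- free.
  module Inverse (P : K[[X]]) (P-order : ∀ i → OnlyDegrees≥ 2 (∇ P i))
    (q : ℕ → K[[X]]) (initial : ∀ j → D j (q 0) ≈ D j P)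
    (equation : ∀ b j → suc b · D j (q (suc b)) ≈ conv b (λ k l → sum (λ i → D i (q k) * D i (D j (q l)))))
    where

    open Substitution (λ i → - D i P) (λ i → order-neg (P-order i))
    open Burgers (∇ P) (λ b j → D j (q b)) initial equation

    V : ℕ → FormalMap
    V b j = D j (q b)

    -- A product on the right of `equation` has order at least (2 + k) + (1 + l), which is b + 3
    -- when k + l = b, and division by `suc b` preserves orders.
    V-order : ∀ b j → OnlyDegrees≥ (2 ℕ.+ b) (V b j)
    V-order = <-rec (λ b → ∀ j → OnlyDegrees≥ (2 ℕ.+ b) (V b j)) orders
      where
      orders : ∀ b → (∀ {a} → a ℕ.< b → ∀ j → OnlyDegrees≥ (2 ℕ.+ a) (V a j)) → ∀ j → OnlyDegrees≥ (2 ℕ.+ b) (V b j)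
      orders zero    rec j = order-cong (sym (initial j)) (P-order j)
      orders (suc b) rec j = order-·⁻ b (order-cong (sym (equation b j)) (order-conv b _ λ k l eq → order-sum (λ i → V k i * D i (V l j)) λ i →
        order-mono (ℕ.≤-reflexive (degrees k l eq))
          (order-* (rec (s≤s (subst (k ℕ.≤_) eq (ℕ.m≤m+n k l))) i) (order-D {f = V l j} i (rec (s≤s (subst (l ℕ.≤_) eq (ℕ.m≤n+m l k))) j)))))
        where
        degrees : ∀ k l → k ℕ.+ l ≡ b → 3 ℕ.+ b ≡ (2 ℕ.+ k) ℕ.+ (1 ℕ.+ l)
        degrees k l ≡.refl = cong (2 ℕ.+_) (≡.sym (ℕ.+-suc k l))

    -- The adic sum of all `q b`. As the derivatives of `q b` have order at least b + 2, a
    -- nonconstant coefficient at `α` receives nothing from b > `deg α`.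
    Q : K[[X]]
    Q α = KC.conv (deg α) (λ b _ → q b α)

    partial : ℕ → FormalMap
    partial B j = conv B (λ b _ → V b j)

    -- Differentiation moves the cutoff of `Q` to `deg α` + 1, while `partial B` stops at `B`. The
    -- two differ by terms `V b j` with b > `deg α`, all of which vanish at `α`.
    D-Q : ∀ B j → D j Q ≈[ suc B ] partial B j
    D-Q B j α (s≤s α≤B) = begin
      suc (lookup α j) K· Q (α [ j ]%= suc)
        ≡⟨ cong (λ m → suc (lookup α j) K· KC.conv m (λ b _ → q b (α [ j ]%= suc))) (deg-%= α j) ⟩
      suc (lookup α j) K· KC.conv (suc (deg α)) (λ b _ → q b (α [ j ]%= suc))
        ≈⟨ K·-conv (suc (lookup α j)) (suc (deg α)) (λ b _ → q b (α [ j ]%= suc)) ⟩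
      KC.conv (1 ℕ.+ (deg α)) (λ b _ → V b j α)
        ≈⟨ KC.conv-extend (deg α) 1 (λ b → V b j α) high ⟩
      KC.conv (deg α) (λ b _ → V b j α)
        ≈⟨ KC.conv-extend (deg α) (B ∸ (deg α)) (λ b → V b j α) high ⟨
      KC.conv (B ∸ (deg α) ℕ.+ (deg α)) (λ b _ → V b j α)
        ≡⟨ cong (λ m → KC.conv m (λ b _ → V b j α)) (ℕ.m∸n+n≡m α≤B) ⟩
      KC.conv B (λ b _ → V b j α)
        ≡⟨ conv-coefficient B (λ b _ → V b j) α ⟨
      partial B j α ∎
      where
      high : ∀ b → (deg α) ℕ.< b → V b j α K.≈ K.0#
      high b α<b = V-order b j α (ℕ.<-trans α<b (ℕ.m<n+m b (s≤s z≤n)))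
      K·-conv : ∀ k N (h : ℕ → ℕ → K.Carrier) → k K· KC.conv N h K.≈ KC.conv N (λ a b → k K· h a b)
      K·-conv zero    N h = K.sym (KC.conv-ε N)
      K·-conv (suc k) N h = K.trans (K.+-congˡ (K·-conv k N h)) (K.sym (KC.conv-∙ N h (λ a b → k K· h a b)))

    -- V (1) (F) = ∇P up to degree B. Truncating both V and its Taylor expansion at B gives a square
    -- of terms; the triangle inside it consists of the layers `along m j`, of which only m = 0
    -- survives.
    Λ≤-partial : ∀ B j → Λ≤ B (partial B j) ≈[ suc B ] ∇ P j
    Λ≤-partial B j α (s≤s α≤B) = begin
      Λ≤ B (partial B j) α
        ≈⟨ conv-cong B {λ k _ → Λ k (partial B j)} {λ k _ → conv B (λ b _ → Λ k (V b j))} (λ k _ → Φ-conv (Λ-additive k) B (λ b _ → V b j)) α ⟩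
      conv B (λ k _ → conv B (λ b _ → Λ k (V b j))) α
        ≡⟨ conv-coefficient B (λ k _ → conv B (λ b _ → Λ k (V b j))) α ⟩
      KC.conv B (λ k _ → conv B (λ b _ → Λ k (V b j)) α)
        ≈⟨ KC.conv-cong B (λ k _ → K.reflexive (conv-coefficient B (λ b _ → Λ k (V b j)) α)) ⟩
      KC.conv B (λ k _ → KC.conv B (λ b _ → Λ k (V b j) α))
        ≈⟨ KC.triangle≈square B (λ k b → Λ k (V b j) α) high ⟨
      KC.conv B (λ m _ → KC.conv m (λ k b → Λ k (V b j) α))
        ≈⟨ KC.conv-single {B} 0 B {λ m _ → KC.conv m (λ k b → Λ k (V b j) α)} ≡.refl off ⟩
      V 0 j α
        ≈⟨ initial j α ⟩
      ∇ P j α ∎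
      where
      high : ∀ k b → B ℕ.< k ℕ.+ b → Λ k (V b j) α K.≈ K.0#
      high k b lt = Λ-order k (V-order b j) α (ℕ.≤-<-trans α≤B (ℕ.<-≤-trans lt (ℕ.+-monoʳ-≤ k (ℕ.m≤n+m b 2))))
      off : ∀ m (l : ℕ) → m ≢ 0 → KC.conv m (λ k b → Λ k (V b j) α) K.≈ K.0#
      off zero    l ≢0 = contradiction ≡.refl ≢0
      off (suc m) l _  = K.trans (K.reflexive (≡.sym (conv-coefficient (suc m) (λ k b → Λ k (V b j)) α))) (along-suc m j α)

    inverse-gradient : ∀ G → G ⊚ (X ⊖ ∇ P) ≋ X → G ≋ X ⊕ ∇ Q
    inverse-gradient G G⊚F≋X i = conclusion
      where
      open import Algebra.Properties.Group K.+-group using (x∙y⁻¹≈ε⇒x≈y)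
      cancel : ∀ x u → (x K.+ K.- u) K.+ u K.≈ x
      cancel x u = K.trans (K.+-assoc _ _ _) (K.trans (K.+-congˡ (K.-‿inverseˡ u)) (K.+-identityʳ x))
      Λ≤-G′ : ∀ α → Λ≤ (deg α) (X i + D i Q) α K.≈ X i α
      Λ≤-G′ α = begin
        Λ≤ (deg α) (X i + D i Q) α
          ≈⟨ Φ-+ (Λ≤-additive (deg α)) (X i) (D i Q) α ⟩
        Λ≤ (deg α) (X i) α K.+ Λ≤ (deg α) (D i Q) α
          ≈⟨ K.+-cong (Λ≤-X (deg α) i α (ℕ.n<1+n _)) (K.trans (Λ≤-cong[] (deg α) (D-Q (deg α) i) α (ℕ.n<1+n _))
              (Λ≤-partial (deg α) i α (ℕ.n<1+n _))) ⟩
        (X i α K.+ K.- D i P α) K.+ D i P α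
          ≈⟨ cancel (X i α) (D i P α) ⟩
        X i α ∎
      difference : ∀ α → Λ≤ (deg α) (G i + - (X i + D i Q)) α K.≈ K.0#
      difference α = begin
        Λ≤ (deg α) (G i + - (X i + D i Q)) α
          ≈⟨ Φ-+ (Λ≤-additive (deg α)) (G i) (- (X i + D i Q)) α ⟩
        Λ≤ (deg α) (G i) α K.+ Λ≤ (deg α) (- (X i + D i Q)) α
          ≈⟨ K.+-cong (K.trans (K.sym (substitute≈Λ≤ (G i) α)) (G⊚F≋X i α))
               (K.trans (Φ-neg (Λ≤-additive (deg α)) (X i + D i Q) α) (K.-‿cong (Λ≤-G′ α))) ⟩
        X i α K.+ K.- X i α
          ≈⟨ K.-‿inverseʳ _ ⟩
        K.0# ∎
      conclusion : G i ≈ (X i + D i Q)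
      conclusion α = x∙y⁻¹≈ε⇒x≈y (G i α) ((X i + D i Q) α) (Λ≤-injective (G i + - (X i + D i Q)) difference α)

-- Trees on subsets of Fin n

private
  variable
    n : ℕ

x∈p─q⇒x∉q : ∀ (p q : Subset n) {x} → x ∈ˢ p ─ q → x ∉ˢ q
x∈p─q⇒x∉q (s ∷ p) (outside ∷ q) (there x∈) (there x∈q) = x∈p─q⇒x∉q p q x∈ x∈q
x∈p─q⇒x∉q (s ∷ p) (inside  ∷ q) (there x∈) (there x∈q) = x∈p─q⇒x∉q p q x∈ x∈q

∣q∣+∣p─q∣≡∣p∣ : ∀ (p q : Subset n) → q ⊆ p → card q ℕ.+ card (p ─ q) ≡ card p
∣q∣+∣p─q∣≡∣p∣ []            []            q⊆p = ≡.refl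
∣q∣+∣p─q∣≡∣p∣ (inside  ∷ p) (inside  ∷ q) q⊆p = cong suc (∣q∣+∣p─q∣≡∣p∣ p q (Subset.drop-∷-⊆ q⊆p))
∣q∣+∣p─q∣≡∣p∣ (outside ∷ p) (inside  ∷ q) q⊆p = contradiction (q⊆p here) λ ()
∣q∣+∣p─q∣≡∣p∣ (inside  ∷ p) (outside ∷ q) q⊆p = ≡.trans (ℕ.+-suc (card q) _) (cong suc (∣q∣+∣p─q∣≡∣p∣ p q (Subset.drop-∷-⊆ q⊆p)))
∣q∣+∣p─q∣≡∣p∣ (outside ∷ p) (outside ∷ q) q⊆p = ∣q∣+∣p─q∣≡∣p∣ p q (Subset.drop-∷-⊆ q⊆p)

module _ {R : Rel (Fin n) 0ℓ} (R? : Decidable R) (u : Fin n) where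

  Reachable : Subset n → Set
  Reachable S = u ∈ˢ S × (∀ {x} → x ∈ˢ S → Star R u x) × (∀ {x y} → x ∈ˢ S → R x y → y ∈ˢ S)

  private
    -- `k` is fuel: each round adds a vertex to `S`, so by `bound` fuel 0 would leave a set with
    -- more than n elements.
    grow : ∀ k S → n ℕ.≤ k ℕ.+ card S → u ∈ˢ S → (∀ {x} → x ∈ˢ S → Star R u x) → ∃[ S ] Reachable S
    grow k S bound u∈S path with any? (λ x → any? λ y → (x ∈? S) ×-dec R? x y ×-dec ¬? (y ∈? S))
    ... | no closed = S , u∈S , path , close
      where
      close : ∀ {x y} → x ∈ˢ S → R x y → y ∈ˢ S
      close {x} {y} x∈S Rxy with y ∈? S
      ... | yes y∈S = y∈S
      ... | no y∉S  = contradiction (x , y , x∈S , Rxy , y∉S) closed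
    ... | yes (x , y , x∈S , Rxy , y∉S) = step k bound
      where
      S′ : Subset n
      S′ = S ∪ ⁅ y ⁆
      larger : card S ℕ.< card S′
      larger = Subset.p⊂q⇒∣p∣<∣q∣ (Subset.p⊆p∪q ⁅ y ⁆ , y , Subset.q⊆p∪q S ⁅ y ⁆ (Subset.x∈⁅x⁆ y) , y∉S)
      path′ : ∀ {z} → z ∈ˢ S′ → Star R u z
      path′ {z} z∈ with Subset.x∈p∪q⁻ S ⁅ y ⁆ z∈
      ... | inj₁ z∈S = path z∈S
      ... | inj₂ z∈y with ≡.refl ← Subset.x∈⁅y⁆⇒x≡y y z∈y = path x∈S ◅◅ (Rxy ◅ ε⋆)
      step : ∀ k → n ℕ.≤ k ℕ.+ card S → ∃[ S ] Reachable S
      step zero    bound = contradiction (Subset.∣p∣≤n S′) (ℕ.<⇒≱ (ℕ.≤-<-trans bound larger))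
      step (suc k) bound = grow k S′ (ℕ.≤-trans bound (ℕ.≤-trans (ℕ.≤-reflexive (≡.sym (ℕ.+-suc k (card S))))
          (ℕ.+-monoʳ-≤ k larger))) (Subset.p⊆p∪q ⁅ y ⁆ u∈S) path′

  reachable : ∃[ S ] Reachable S
  reachable = grow n ⁅ u ⁆ (ℕ.m≤m+n n _) (Subset.x∈⁅x⁆ u) λ x∈ → subst (Star R u) (≡.sym (Subset.x∈⁅y⁆⇒x≡y u x∈)) ε⋆

closed⇒Star-closed : {R : Rel (Fin n) 0ℓ} {S : Subset n} → (∀ {x y} → x ∈ˢ S → R x y → y ∈ˢ S) → ∀ {x y} → x ∈ˢ S → Star R x y → y ∈ˢ S
closed⇒Star-closed close x∈S ε⋆        = x∈S
closed⇒Star-closed close x∈S (r ◅ rs) = closed⇒Star-closed close (close x∈S r) rs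

star? : {R : Rel (Fin n) 0ℓ} → Decidable R → Decidable (Star R)
star? R? u v with reachable R? u
... | S , u∈S , path , close with v ∈? S
...   | yes v∈S = yes (path v∈S)
...   | no v∉S  = no λ uv → v∉S (closed⇒Star-closed close u∈S uv)

T-ext : ∀ {a b} → (T a → T b) → (T b → T a) → a ≡ b
T-ext {true}  {true}  f g = ≡.refl
T-ext {true}  {false} f g = contradiction (f tt) id
T-ext {false} {true}  f g = contradiction (g tt) id
T-ext {false} {false} f g = ≡.refl

-- Adjacency matrices: unlike functions, they have decidable propositional equality.
Mat : ℕ → Set
Mat n = Vec (Vec Bool n) n

entry : Mat n → Fin n → Fin n → Bool
entry M x y = lookup (lookup M x) y

Adj : Mat n → Rel (Fin n) 0ℓ
Adj M x y = T (entry M x y)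

adj? : (M : Mat n) → Decidable (Adj M)
adj? M x y = T? (entry M x y)

mat : (Fin n → Fin n → Bool) → Mat n
mat f = Vec.tabulate λ x → Vec.tabulate (f x)

entry-mat : ∀ (f : Fin n → Fin n → Bool) x y → entry (mat f) x y ≡ f x y
entry-mat f x y = ≡.trans (cong (λ r → lookup r y) (Vec.lookup∘tabulate (λ x → Vec.tabulate (f x)) x)) (Vec.lookup∘tabulate (f x) y)

Vec-ext : ∀ {A : Set} {n} {xs ys : Vec A n} → (∀ i → lookup xs i ≡ lookup ys i) → xs ≡ ys
Vec-ext eq = ≡.trans (≡.sym (Vec.tabulate∘lookup _)) (≡.trans (Vec.tabulate-cong eq) (Vec.tabulate∘lookup _))

mat-ext : {M M′ : Mat n} → (∀ {x y} → Adj M x y → Adj M′ x y) → (∀ {x y} → Adj M′ x y → Adj M x y) → M ≡ M′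
mat-ext f g = Vec-ext λ x → Vec-ext λ y → T-ext (f {x} {y}) (g {x} {y})

module _ {R : Rel (Fin n) 0ℓ} (R? : Decidable R) where
  graph : Mat n
  graph = mat λ x y → ⌊ R? x y ⌋

  graph⁺ : ∀ {x y} → R x y → Adj graph x y
  graph⁺ {x} {y} r = subst T (≡.sym (entry-mat _ x y)) (fromWitness {a? = R? x y} r)

  graph⁻ : ∀ {x y} → Adj graph x y → R x y
  graph⁻ {x} {y} a = toWitness {a? = R? x y} (subst T (entry-mat _ x y) a)

Joins : Fin n → Fin n → Rel (Fin n) 0ℓ
Joins u v x y = (x ≡ u × y ≡ v) ⊎ (x ≡ v × y ≡ u)

joins? : (u v : Fin n) → Decidable (Joins u v)
joins? u v x y = ((x ≟ u) ×-dec (y ≟ v)) ⊎-dec ((x ≟ v) ×-dec (y ≟ u))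

joins-sym : {u v : Fin n} → Symmetric (Joins u v)
joins-sym (inj₁ (p , q)) = inj₂ (q , p)
joins-sym (inj₂ (p , q)) = inj₁ (q , p)

joins-swap : {u v x y : Fin n} → Joins u v x y → Joins v u x y
joins-swap (inj₁ p) = inj₂ p
joins-swap (inj₂ p) = inj₁ p

Without : Mat n → Fin n → Fin n → Rel (Fin n) 0ℓ
Without M u v x y = Adj M x y × ¬ Joins u v x y

without? : (M : Mat n) (u v : Fin n) → Decidable (Without M u v)
without? M u v x y = adj? M x y ×-dec ¬? (joins? u v x y)

-- Acyclicity is stated as: every edge is a bridge. This avoids lists of vertices, is decidable
-- through reachability and passes directly to the pieces when an edge is cut. `supported` forces
-- the matrix to vanish outside `A`, so that each tree on `A` is counted once.
record TreeOn (A : Subset n) (M : Mat n) : Set where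
  field
    symmetric : Symmetric (Adj M)
    supported : ∀ {x y} → Adj M x y → x ∈ˢ A
    nonempty  : Nonempty A
    connected : ∀ {x y} → x ∈ˢ A → y ∈ˢ A → Star (Adj M) x y
    bridge    : ∀ {x y} → Adj M x y → ¬ Star (Without M x y) x y

  supportedʳ : ∀ {x y} → Adj M x y → y ∈ˢ A
  supportedʳ = supported ∘ symmetric

  irreflexive : ∀ {x y} → Adj M x y → x ≢ y
  irreflexive a ≡.refl = bridge a ε⋆

  without-sym : ∀ {u v} → Symmetric (Without M u v)
  without-sym (a , ¬j) = symmetric a , ¬j ∘ joins-sym

abstract
  treeOn? : (A : Subset n) (M : Mat n) → Dec (TreeOn A M)
  treeOn? A M = map′
    (λ (s , t , n , c , b) → record
      { symmetric = λ {x} {y} → s x y ; supported = λ {x} {y} → t x y ; nonempty = n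
      ; connected = λ {x} {y} → c x y ; bridge = λ {x} {y} → b x y })
    (λ t → let open TreeOn t in (λ x y → symmetric) , (λ x y → supported) , nonempty , (λ x y → connected) , (λ x y → bridge))
    ( (all? λ x → all? λ y → adj? M x y →-dec adj? M y x)
      ×-dec (all? λ x → all? λ y → adj? M x y →-dec (x ∈? A))
      ×-dec any? (_∈? A)
      ×-dec (all? λ x → all? λ y → (x ∈? A) →-dec ((y ∈? A) →-dec star? (adj? M) x y))
      ×-dec (all? λ x → all? λ y → adj? M x y →-dec ¬? (star? (without? M x y) x y)) )

-- Cutting a tree at an edge and gluing two trees along one

Within : Mat n → Subset n → Rel (Fin n) 0ℓ
Within M B x y = Adj M x y × x ∈ˢ B × y ∈ˢ B

within? : (M : Mat n) (B : Subset n) → Decidable (Within M B)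
within? M B x y = adj? M x y ×-dec (x ∈? B) ×-dec (y ∈? B)

restrict : Mat n → Subset n → Mat n
restrict M B = graph (within? M B)

component : Mat n → Fin n → Fin n → Subset n
component M u v = proj₁ (reachable (without? M u v) u)

Join : Mat n → Mat n → Fin n → Fin n → Rel (Fin n) 0ℓ
Join M₁ M₂ u v x y = Adj M₁ x y ⊎ Adj M₂ x y ⊎ Joins u v x y

join? : (M₁ M₂ : Mat n) (u v : Fin n) → Decidable (Join M₁ M₂ u v)
join? M₁ M₂ u v x y = adj? M₁ x y ⊎-dec adj? M₂ x y ⊎-dec joins? u v x y

join : Mat n → Mat n → Fin n → Fin n → Mat n
join M₁ M₂ u v = graph (join? M₁ M₂ u v)

-- Two trees on complementary parts of `A` with a chosen vertex in each: the data equivalent to a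
-- tree on `A` with an oriented edge from `u` to `v`.
record Splitting (A B : Subset n) (M₁ M₂ : Mat n) (u v : Fin n) : Set where
  field
    B⊆A   : B ⊆ A
    tree₁ : TreeOn B M₁
    tree₂ : TreeOn (A ─ B) M₂
    u∈B   : u ∈ˢ B
    v∈A─B : v ∈ˢ A ─ B

  module T₁ = TreeOn tree₁
  module T₂ = TreeOn tree₂

  ∉B : ∀ {x} → x ∈ˢ A ─ B → x ∉ˢ B
  ∉B = x∈p─q⇒x∉q A B

  v∉B : v ∉ˢ B
  v∉B = ∉B v∈A─B

  u≢v : u ≢ v
  u≢v ≡.refl = v∉B u∈B

module Split {A : Subset n} {M : Mat n} (tree : TreeOn A M) {u v : Fin n} (uv : Adj M u v) where
  open TreeOn tree

  B C : Subset n
  B = component M u v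
  C = A ─ B

  private
    reach : Reachable (without? M u v) u B
    reach = proj₂ (reachable (without? M u v) u)

    path-in-B : ∀ {x} → x ∈ˢ B → Star (Without M u v) u x
    path-in-B = proj₁ (proj₂ reach)

    B-closed : ∀ {x y} → x ∈ˢ B → Without M u v x y → y ∈ˢ B
    B-closed = proj₂ (proj₂ reach)

    u∈B : u ∈ˢ B
    u∈B = proj₁ reach

    v∉B : v ∉ˢ B
    v∉B v∈B = bridge uv (path-in-B v∈B)

    A-closed : ∀ {x y} → x ∈ˢ A → Without M u v x y → y ∈ˢ A
    A-closed _ (a , _) = supportedʳ a

    B⊆A : B ⊆ A
    B⊆A x∈B = closed⇒Star-closed A-closed (supported uv) (path-in-B x∈B)

    C-closed : ∀ {x y} → x ∈ˢ C → Without M u v x y → y ∈ˢ C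
    C-closed x∈C w = Subset.x∈p∧x∉q⇒x∈p─q (supportedʳ (proj₁ w)) λ y∈B → x∈p─q⇒x∉q A B x∈C (B-closed y∈B (without-sym w))

    v∈C : v ∈ˢ C
    v∈C = Subset.x∈p∧x∉q⇒x∈p─q (supportedʳ uv) v∉B

    -- Whenever the walk crosses the deleted edge, it is restarted at the endpoint reached; what
    -- remains after the last crossing avoids that edge.
    halves : ∀ {x y} → Star (Without M u v) u x ⊎ Star (Without M u v) v x → Star (Adj M) x y → Star (Without M u v) u y ⊎ Star (Without M u v) v y
    halves s ε⋆ = s
    halves s (_◅_ {x} {y} a as) with joins? u v x y
    ... | yes (inj₁ (_ , ≡.refl)) = halves (inj₂ ε⋆) as
    ... | yes (inj₂ (_ , ≡.refl)) = halves (inj₁ ε⋆) as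
    ... | no ¬j = halves ([ (λ p → inj₁ (p ◅◅ ((a , ¬j) ◅ ε⋆))) , (λ p → inj₂ (p ◅◅ ((a , ¬j) ◅ ε⋆))) ]′ s) as

    path-in-C : ∀ {x} → x ∈ˢ C → Star (Without M u v) v x
    path-in-C x∈C with halves (inj₁ ε⋆) (connected (supported uv) (Subset.p─q⊆p A B x∈C))
    ... | inj₁ p = contradiction (closed⇒Star-closed B-closed u∈B p) (x∈p─q⇒x∉q A B x∈C)
    ... | inj₂ p = p

    confine : ∀ {S : Subset n} {x y} → (∀ {x y} → x ∈ˢ S → Without M u v x y → y ∈ˢ S) → x ∈ˢ S → Star (Without M u v) x y →
        Star (Adj (restrict M S)) x y
    confine close x∈S ε⋆        = ε⋆
    confine {S} close x∈S (w ◅ ws) = graph⁺ (within? M S) (proj₁ w , x∈S , close x∈S w) ◅ confine close (close x∈S w) ws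

    -- Serves both sides, with roots `u` and `v`. A bypass inside the piece is also one in `M`, so
    -- bridges are inherited.
    restrict-tree : ∀ {S : Subset n} {r} → (∀ {x y} → x ∈ˢ S → Without M u v x y → y ∈ˢ S) → r ∈ˢ S →
                    (∀ {x} → x ∈ˢ S → Star (Without M u v) r x) → TreeOn S (restrict M S)
    restrict-tree {S} {r} close r∈S path = record
      { symmetric = sym′
      ; supported = λ a → proj₁ (proj₂ (graph⁻ (within? M S) a))
      ; nonempty  = r , r∈S
      ; connected = λ x∈S y∈S → Star.reverse sym′ (confine close r∈S (path x∈S)) ◅◅ confine close r∈S (path y∈S)
      ; bridge    = λ a p → bridge (proj₁ (graph⁻ (within? M S) a)) (Star.map (λ (b , ¬j) → proj₁ (graph⁻ (within? M S) b) , ¬j) p)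
      }
      where
      sym′ : Symmetric (Adj (restrict M S))
      sym′ a with b , x∈S , y∈S ← graph⁻ (within? M S) a = graph⁺ (within? M S) (symmetric b , y∈S , x∈S)

  splitting : Splitting A B (restrict M B) (restrict M C) u v
  splitting = record
    { B⊆A = B⊆A ; u∈B = u∈B ; v∈A─B = v∈C
    ; tree₁ = restrict-tree B-closed u∈B path-in-B
    ; tree₂ = restrict-tree C-closed v∈C path-in-C }

  -- An edge other than {u, v} stays on the side of its first endpoint, so the restrictions lose
  -- only {u, v}, which `join` restores.
  join-restrict : join (restrict M B) (restrict M C) u v ≡ M
  join-restrict = mat-ext to from
    where
    to : ∀ {x y} → Adj (join (restrict M B) (restrict M C) u v) x y → Adj M x y
    to a with graph⁻ (join? (restrict M B) (restrict M C) u v) a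
    ... | inj₁ b = proj₁ (graph⁻ (within? M B) b)
    ... | inj₂ (inj₁ b) = proj₁ (graph⁻ (within? M C) b)
    ... | inj₂ (inj₂ (inj₁ (≡.refl , ≡.refl))) = uv
    ... | inj₂ (inj₂ (inj₂ (≡.refl , ≡.refl))) = symmetric uv
    from : ∀ {x y} → Adj M x y → Adj (join (restrict M B) (restrict M C) u v) x y
    from {x} {y} a = graph⁺ (join? (restrict M B) (restrict M C) u v) (classify (joins? u v x y) (x ∈? B))
      where
      classify : Dec (Joins u v x y) → Dec (x ∈ˢ B) → Join (restrict M B) (restrict M C) u v x y
      classify (yes j) _         = inj₂ (inj₂ j)
      classify (no ¬j) (yes x∈B) = inj₁ (graph⁺ (within? M B) (a , x∈B , B-closed x∈B (a , ¬j)))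
      classify (no ¬j) (no x∉B)  = inj₂ (inj₁ (graph⁺ (within? M C) (a , x∈C , C-closed x∈C (a , ¬j))))
        where
        x∈C : x ∈ˢ C
        x∈C = Subset.x∈p∧x∉q⇒x∈p─q (supported a) x∉B

module Joined {A B : Subset n} {M₁ M₂ : Mat n} {u v : Fin n} (s : Splitting A B M₁ M₂ u v) where
  open Splitting s

  J : Mat n
  J = join M₁ M₂ u v

  J⁺ : ∀ {x y} → Join M₁ M₂ u v x y → Adj J x y
  J⁺ = graph⁺ (join? M₁ M₂ u v)

  J⁻ : ∀ {x y} → Adj J x y → Join M₁ M₂ u v x y
  J⁻ = graph⁻ (join? M₁ M₂ u v)

  uv : Adj J u v
  uv = J⁺ (inj₂ (inj₂ (inj₁ (≡.refl , ≡.refl))))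

  private
    sym : Symmetric (Adj J)
    sym a with J⁻ a
    ... | inj₁ b        = J⁺ (inj₁ (T₁.symmetric b))
    ... | inj₂ (inj₁ b) = J⁺ (inj₂ (inj₁ (T₂.symmetric b)))
    ... | inj₂ (inj₂ j) = J⁺ (inj₂ (inj₂ (joins-sym j)))

    supp : ∀ {x y} → Adj J x y → x ∈ˢ A
    supp a with J⁻ a
    ... | inj₁ b                                = B⊆A (T₁.supported b)
    ... | inj₂ (inj₁ b)                         = Subset.p─q⊆p A B (T₂.supported b)
    ... | inj₂ (inj₂ (inj₁ (≡.refl , ≡.refl)))  = B⊆A u∈B
    ... | inj₂ (inj₂ (inj₂ (≡.refl , ≡.refl)))  = Subset.p─q⊆p A B v∈A─B

    from-u : ∀ {x} → x ∈ˢ A → Star (Adj J) u x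
    from-u {x} x∈A with x ∈? B
    ... | yes x∈B = Star.map (J⁺ ∘ inj₁) (T₁.connected u∈B x∈B)
    ... | no x∉B  = uv ◅ Star.map (J⁺ ∘ inj₂ ∘ inj₁) (T₂.connected v∈A─B (Subset.x∈p∧x∉q⇒x∈p─q x∈A x∉B))

    B-closed : ∀ {x y} → x ∈ˢ B → Without J u v x y → y ∈ˢ B
    B-closed x∈B (a , ¬j) with J⁻ a
    ... | inj₁ b        = T₁.supportedʳ b
    ... | inj₂ (inj₁ b) = contradiction x∈B (∉B (T₂.supported b))
    ... | inj₂ (inj₂ j) = contradiction j ¬j

    uv-bridge : ¬ Star (Without J u v) u v
    uv-bridge p = v∉B (closed⇒Star-closed B-closed u∈B p)

    -- Collapsing everything outside S to r turns walks in J into walks in M.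
    retract : ∀ {M : Mat n} (S : Subset n) (r : Fin n) →
              (∀ {x y} → Adj J x y → (Adj M x y × x ∈ˢ S × y ∈ˢ S) ⊎ ((x ∈ˢ S → x ≡ r) × (y ∈ˢ S → y ≡ r))) →
              ∀ {x y} → x ∈ˢ S → y ∈ˢ S → Star (Without J x y) x y → Star (Without M x y) x y
    retract {M} S r cases {x} {y} x∈S y∈S p = subst₂ (fold-in x∈S) (fold-in y∈S) (Star.kleisliStar fold step p)
      where
      fold : Fin n → Fin n
      fold z with z ∈? S
      ... | yes _ = z
      ... | no _  = r
      fold-in : ∀ {z} → z ∈ˢ S → fold z ≡ z
      fold-in {z} z∈S with z ∈? S
      ... | yes _  = ≡.refl
      ... | no z∉S = contradiction z∈S z∉S
      fold-r : ∀ {z} → (z ∈ˢ S → z ≡ r) → fold z ≡ r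
      fold-r {z} eq with z ∈? S
      ... | yes z∈S = eq z∈S
      ... | no _    = ≡.refl
      subst₂ : ∀ {a a′ b b′} → a ≡ a′ → b ≡ b′ → Star (Without M x y) a b → Star (Without M x y) a′ b′
      subst₂ ≡.refl ≡.refl p = p
      step : ∀ {a b} → Without J x y a b → Star (Without M x y) (fold a) (fold b)
      step (a , ¬j) with cases a
      ... | inj₁ (b , z∈S , w∈S) = subst₂ (≡.sym (fold-in z∈S)) (≡.sym (fold-in w∈S)) ((b , ¬j) ◅ ε⋆)
      ... | inj₂ (p , q)         = subst₂ (≡.sym (fold-r p)) (≡.sym (fold-r q)) ε⋆

    bridge₁ : ∀ {x y} → Adj M₁ x y → ¬ Star (Without J x y) x y
    bridge₁ b p = T₁.bridge b (retract {M = M₁} B u cases (T₁.supported b) (T₁.supportedʳ b) p)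
      where
      cases : ∀ {x y} → Adj J x y → (Adj M₁ x y × x ∈ˢ B × y ∈ˢ B) ⊎ ((x ∈ˢ B → x ≡ u) × (y ∈ˢ B → y ≡ u))
      cases a with J⁻ a
      ... | inj₁ b = inj₁ (b , T₁.supported b , T₁.supportedʳ b)
      ... | inj₂ (inj₁ b) = inj₂ ((λ ∈B → contradiction ∈B (∉B (T₂.supported b))) , λ ∈B → contradiction ∈B (∉B (T₂.supportedʳ b)))
      ... | inj₂ (inj₂ (inj₁ (≡.refl , ≡.refl))) = inj₂ ((λ _ → ≡.refl) , λ ∈B → contradiction ∈B v∉B)
      ... | inj₂ (inj₂ (inj₂ (≡.refl , ≡.refl))) = inj₂ ((λ ∈B → contradiction ∈B v∉B) , λ _ → ≡.refl)

    bridge₂ : ∀ {x y} → Adj M₂ x y → ¬ Star (Without J x y) x y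
    bridge₂ b p = T₂.bridge b (retract {M = M₂} (A ─ B) v cases (T₂.supported b) (T₂.supportedʳ b) p)
      where
      cases : ∀ {x y} → Adj J x y → (Adj M₂ x y × x ∈ˢ A ─ B × y ∈ˢ A ─ B) ⊎ ((x ∈ˢ A ─ B → x ≡ v) × (y ∈ˢ A ─ B → y ≡ v))
      cases a with J⁻ a
      ... | inj₁ b = inj₂ ((λ ∈C → contradiction (T₁.supported b) (∉B ∈C)) , λ ∈C → contradiction (T₁.supportedʳ b) (∉B ∈C))
      ... | inj₂ (inj₁ b) = inj₁ (b , T₂.supported b , T₂.supportedʳ b)
      ... | inj₂ (inj₂ (inj₁ (≡.refl , ≡.refl))) = inj₂ ((λ ∈C → contradiction u∈B (∉B ∈C)) , λ _ → ≡.refl)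
      ... | inj₂ (inj₂ (inj₂ (≡.refl , ≡.refl))) = inj₂ ((λ _ → ≡.refl) , λ ∈C → contradiction u∈B (∉B ∈C))

    bridges : ∀ {x y} → Adj J x y → ¬ Star (Without J x y) x y
    bridges a with J⁻ a
    ... | inj₁ b                               = bridge₁ b
    ... | inj₂ (inj₁ b)                        = bridge₂ b
    ... | inj₂ (inj₂ (inj₁ (≡.refl , ≡.refl))) = uv-bridge
    ... | inj₂ (inj₂ (inj₂ (≡.refl , ≡.refl))) = λ p → uv-bridge
        (Star.reverse (λ (a , ¬j) → sym a , ¬j ∘ joins-sym) (Star.map (λ (a , ¬j) → a , ¬j ∘ joins-swap) p))

  tree : TreeOn A J
  tree = record
    { symmetric = sym ; supported = supp ; nonempty = u , B⊆A u∈B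
    ; connected = λ x∈A y∈A → Star.reverse sym (from-u x∈A) ◅◅ from-u y∈A
    ; bridge = bridges }

  -- `B` is closed under the steps of the glued tree that avoid {u, v}, and the first tree connects
  -- all of it to `u`.
  component-join : component J u v ≡ B
  component-join with reachable (without? J u v) u
  ... | S , u∈S , path , close = Subset.⊆-antisym
    (λ x∈S → closed⇒Star-closed B-closed u∈B (path x∈S))
    (λ x∈B → closed⇒Star-closed close u∈S (Star.map (λ b → J⁺ (inj₁ b) , not-uv b) (T₁.connected u∈B x∈B)))
    where
    not-uv : ∀ {x y} → Adj M₁ x y → ¬ Joins u v x y
    not-uv b (inj₁ (_ , ≡.refl)) = v∉B (T₁.supportedʳ b)
    not-uv b (inj₂ (≡.refl , _)) = v∉B (T₁.supported b)

  restrict-join₁ : restrict J B ≡ M₁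
  restrict-join₁ = mat-ext to (λ b → graph⁺ (within? J B) (J⁺ (inj₁ b) , T₁.supported b , T₁.supportedʳ b))
    where
    to : ∀ {x y} → Adj (restrict J B) x y → Adj M₁ x y
    to r with graph⁻ (within? J B) r
    ... | a , x∈B , y∈B with J⁻ a
    ... | inj₁ b = b
    ... | inj₂ (inj₁ b) = contradiction x∈B (∉B (T₂.supported b))
    ... | inj₂ (inj₂ (inj₁ (_ , ≡.refl))) = contradiction y∈B v∉B
    ... | inj₂ (inj₂ (inj₂ (≡.refl , _))) = contradiction x∈B v∉B

  restrict-join₂ : restrict J (A ─ B) ≡ M₂
  restrict-join₂ = mat-ext to (λ b → graph⁺ (within? J (A ─ B)) (J⁺ (inj₂ (inj₁ b)) , T₂.supported b , T₂.supportedʳ b))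
    where
    to : ∀ {x y} → Adj (restrict J (A ─ B)) x y → Adj M₂ x y
    to r with graph⁻ (within? J (A ─ B)) r
    ... | a , x∈C , y∈C with J⁻ a
    ... | inj₁ b = contradiction (T₁.supported b) (∉B x∈C)
    ... | inj₂ (inj₁ b) = b
    ... | inj₂ (inj₂ (inj₁ (≡.refl , _))) = contradiction u∈B (∉B x∈C)
    ... | inj₂ (inj₂ (inj₂ (_ , ≡.refl))) = contradiction u∈B (∉B y∈C)

-- Edge lists and the number of edges of a tree

pairs : ∀ n → List (Fin n × Fin n)
pairs n = cartesianProduct (allFin n) (allFin n)

pairs! : ∀ n → Unique (pairs n)
pairs! n = Unique.cartesianProduct⁺ (Unique.allFin⁺ n) (Unique.allFin⁺ n)

∈-pairs : (e : Fin n × Fin n) → e ∈ pairs n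
∈-pairs (x , y) = List∈.∈-cartesianProduct⁺ (List∈.∈-allFin x) (List∈.∈-allFin y)

module EdgeList (adj : Fin n → Fin n → Bool) where

  edge? : (e : Fin n × Fin n) → Dec (proj₁ e <ᶠ proj₂ e × T (adj (proj₁ e) (proj₂ e)))
  edge? (u , v) = (u <? v) ×-dec T? (adj u v)

  -- Repeats the filter of `Graph.edges`, so that the edge list of a `Tree` is definitionally
  -- `edgesOf` of its adjacency.
  edgesOf : List (Fin n × Fin n)
  edgesOf = filter (λ (u , v) → (u <? v) ×-dec T? (adj u v)) (pairs n)

  edgesOf! : Unique edgesOf
  edgesOf! = Unique.filter⁺ edge? (pairs! n)

  ∈-edgesOf⁺ : ∀ {x y} → x <ᶠ y → T (adj x y) → (x , y) ∈ edgesOf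
  ∈-edgesOf⁺ x<y a = List∈.∈-filter⁺ edge? (∈-pairs _) (x<y , a)

  ∈-edgesOf⁻ : ∀ {x y} → (x , y) ∈ edgesOf → x <ᶠ y × T (adj x y)
  ∈-edgesOf⁻ e∈ = proj₂ (List∈.∈-filter⁻ edge? {xs = pairs n} e∈)

module _ (M : Mat n) where
  open EdgeList (entry M) public
    renaming (edgesOf to edges; edgesOf! to edges!; ∈-edgesOf⁺ to ∈-edges⁺; ∈-edgesOf⁻ to ∈-edges⁻)

  arcs : List (Fin n × Fin n)
  arcs = filter (λ (u , v) → adj? M u v) (pairs n)

-- Edge lists contain only increasing pairs, whereas the edge used for gluing and the image of an
-- edge under a bijection may point either way.
ordered : Fin n × Fin n → Fin n × Fin n
ordered (u , v) with u <? v
... | yes _ = u , v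
... | no _  = v , u

ordered-< : {x y : Fin n} → x <ᶠ y → ordered (x , y) ≡ (x , y)
ordered-< {x = x} {y} x<y with x <? y
... | yes _  = ≡.refl
... | no x≮y = contradiction x<y x≮y

ordered-swap : (u v : Fin n) → u ≢ v → ordered (u , v) ≡ ordered (v , u)
ordered-swap u v u≢v with u <? v | v <? u
... | yes u<v | yes v<u = contradiction v<u (Fin.<-asym u<v)
... | yes _   | no _    = ≡.refl
... | no _    | yes _   = ≡.refl
... | no u≮v  | no v≮u  with Fin.<-cmp u v
... | tri< u<v _ _ = contradiction u<v u≮v
... | tri≈ _ u≡v _ = contradiction u≡v u≢v
... | tri> _ _ v<u = contradiction v<u v≮u

ordered-∈⁻ : (M : Mat n) {u v : Fin n} → ordered (u , v) ∈ edges M → Adj M u v ⊎ Adj M v u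
ordered-∈⁻ M {u} {v} e∈ with u <? v
... | yes _ = inj₁ (proj₂ (∈-edges⁻ M e∈))
... | no _  = inj₂ (proj₂ (∈-edges⁻ M e∈))

∈-ordered : {u v x y : Fin n} → Joins u v x y → x <ᶠ y → (x , y) ≡ ordered (u , v)
∈-ordered (inj₁ (≡.refl , ≡.refl)) x<y = ≡.sym (ordered-< x<y)
∈-ordered {u = u} {v} (inj₂ (≡.refl , ≡.refl)) v<u = ≡.trans (≡.sym (ordered-< v<u)) (ordered-swap v u λ { ≡.refl → Fin.<-irrefl ≡.refl v<u })

ordered-Joins : {u v x y : Fin n} → (x , y) ≡ ordered (u , v) → Joins u v x y
ordered-Joins {u = u} {v} eq with u <? v
ordered-Joins ≡.refl | yes _ = inj₁ (≡.refl , ≡.refl)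
ordered-Joins ≡.refl | no _  = inj₂ (≡.refl , ≡.refl)

module _ {A B : Subset n} {M₁ M₂ : Mat n} {u v : Fin n} (s : Splitting A B M₁ M₂ u v) where
  open Splitting s
  open Joined s using (J; J⁺; J⁻)

  edges-join : edges (join M₁ M₂ u v) ↭ ordered (u , v) ∷ edges M₁ ++ edges M₂
  edges-join = unique∧set⇒↭ (edges! J) (All.tabulate not-uv ∷ Unique.++⁺ (edges! M₁) (edges! M₂) disjoint) to from
    where
    not-uv : ∀ {e} → e ∈ edges M₁ ++ edges M₂ → ordered (u , v) ≢ e
    not-uv e∈ ≡.refl with List∈.∈-++⁻ (edges M₁) e∈
    ... | inj₁ e∈₁ = [ (λ a → v∉B (T₁.supportedʳ a)) , (λ a → v∉B (T₁.supported a)) ]′ (ordered-∈⁻ M₁ e∈₁)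
    ... | inj₂ e∈₂ = [ (λ a → ∉B (T₂.supported a) u∈B) , (λ a → ∉B (T₂.supportedʳ a) u∈B) ]′ (ordered-∈⁻ M₂ e∈₂)
    disjoint : ∀ {e} → e ∈ edges M₁ × e ∈ edges M₂ → ⊥
    disjoint (e∈₁ , e∈₂) = ∉B (T₂.supported (proj₂ (∈-edges⁻ M₂ e∈₂))) (T₁.supported (proj₂ (∈-edges⁻ M₁ e∈₁)))
    to : ∀ {e} → e ∈ edges J → e ∈ ordered (u , v) ∷ edges M₁ ++ edges M₂
    to e∈ with x<y , a ← ∈-edges⁻ J e∈ with J⁻ a
    ... | inj₁ b        = there (List∈.∈-++⁺ˡ (∈-edges⁺ M₁ x<y b))
    ... | inj₂ (inj₁ b) = there (List∈.∈-++⁺ʳ (edges M₁) (∈-edges⁺ M₂ x<y b))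
    ... | inj₂ (inj₂ j) = here (∈-ordered j x<y)
    from : ∀ {e} → e ∈ ordered (u , v) ∷ edges M₁ ++ edges M₂ → e ∈ edges J
    from (here eq) = ∈-edges⁺ J (less eq) (J⁺ (inj₂ (inj₂ (ordered-Joins eq))))
      where
      less : ∀ {x y} → (x , y) ≡ ordered (u , v) → x <ᶠ y
      less eq with u <? v
      less ≡.refl | yes u<v = u<v
      less ≡.refl | no u≮v with Fin.<-cmp u v
      ... | tri< u<v _ _ = contradiction u<v u≮v
      ... | tri≈ _ u≡v _ = contradiction u≡v u≢v
      ... | tri> _ _ v<u = v<u
    from (there e∈) with List∈.∈-++⁻ (edges M₁) e∈
    ... | inj₁ e∈₁ with x<y , a ← ∈-edges⁻ M₁ e∈₁ = ∈-edges⁺ J x<y (J⁺ (inj₁ a))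
    ... | inj₂ e∈₂ with x<y , a ← ∈-edges⁻ M₂ e∈₂ = ∈-edges⁺ J x<y (J⁺ (inj₂ (inj₁ a)))

module _ {A : Subset n} {M : Mat n} (tree : TreeOn A M) where
  open TreeOn tree

  arcs↭ : arcs M ↭ edges M ++ map swap (edges M)
  arcs↭ = unique∧set⇒↭ (Unique.filter⁺ (λ (u , v) → adj? M u v) (pairs! n))
            (Unique.++⁺ (edges! M) (Unique.map⁺ (cong swap) (edges! M)) disjoint) to from
    where
    disjoint : ∀ {e} → e ∈ edges M × e ∈ map swap (edges M) → ⊥
    disjoint (e∈ , e∈′) with List∈.∈-map⁻ swap e∈′
    ... | (y , x) , e′∈ , ≡.refl = Fin.<-asym (proj₁ (∈-edges⁻ M e∈)) (proj₁ (∈-edges⁻ M e′∈))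
    to : ∀ {e} → e ∈ arcs M → e ∈ edges M ++ map swap (edges M)
    to {x , y} e∈ with a ← proj₂ (List∈.∈-filter⁻ (λ (u , v) → adj? M u v) {xs = pairs n} e∈) with Fin.<-cmp x y
    ... | tri< x<y _ _ = List∈.∈-++⁺ˡ (∈-edges⁺ M x<y a)
    ... | tri≈ _ x≡y _ = contradiction x≡y (irreflexive a)
    ... | tri> _ _ y<x = List∈.∈-++⁺ʳ (edges M) (List∈.∈-map⁺ swap (∈-edges⁺ M y<x (symmetric a)))
    from : ∀ {e} → e ∈ edges M ++ map swap (edges M) → e ∈ arcs M
    from e∈ with List∈.∈-++⁻ (edges M) e∈
    ... | inj₁ e∈₁ = List∈.∈-filter⁺ (λ (u , v) → adj? M u v) (∈-pairs _) (proj₂ (∈-edges⁻ M e∈₁))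
    ... | inj₂ e∈₂ with List∈.∈-map⁻ swap e∈₂
    ... | (y , x) , e′∈ , ≡.refl = List∈.∈-filter⁺ (λ (u , v) → adj? M u v) (∈-pairs _) (symmetric (proj₂ (∈-edges⁻ M e′∈)))

  length-arcs : length (arcs M) ≡ length (edges M) ℕ.+ length (edges M)
  length-arcs = ≡.trans (Perm.↭-length arcs↭) (≡.trans (List.length-++ (edges M)) (cong (length (edges M) ℕ.+_) (List.length-map swap (edges M))))

  no-edges⇒singleton : (∀ {x y} → ¬ Adj M x y) → card A ≡ 1
  no-edges⇒singleton none = ≡.trans (cong card (Subset.⊆-antisym sub sup)) (Subset.∣⁅x⁆∣≡1 a)
    where
    a : Fin n
    a = proj₁ nonempty
    stay : ∀ {x y} → Star (Adj M) x y → x ≡ y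
    stay ε⋆       = ≡.refl
    stay (b ◅ _) = contradiction b none
    sub : A ⊆ ⁅ a ⁆
    sub x∈A = subst (_∈ˢ ⁅ a ⁆) (stay (connected (proj₂ nonempty) x∈A)) (Subset.x∈⁅x⁆ a)
    sup : ⁅ a ⁆ ⊆ A
    sup x∈a = subst (_∈ˢ A) (≡.sym (Subset.x∈⁅y⁆⇒x≡y a x∈a)) (proj₂ nonempty)

card-positive : {A : Subset n} → Nonempty A → 0 ℕ.< card A
card-positive {A = A} (x , x∈A) = ℕ.≤-trans (ℕ.≤-reflexive (≡.sym (Subset.∣⁅x⁆∣≡1 x)))
    (Subset.p⊆q⇒∣p∣≤∣q∣ λ y∈x → subst (_∈ˢ A) (≡.sym (Subset.x∈⁅y⁆⇒x≡y x y∈x)) x∈A)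

-- Cutting an edge leaves two smaller trees whose vertex numbers add up to the whole and whose edge
-- numbers add up to one less. A tree without edges has a single vertex by connectedness.
length-edges : ∀ k {A : Subset n} {M : Mat n} → card A ≡ k → TreeOn A M → suc (length (edges M)) ≡ k
length-edges {n} = <-rec (λ k → ∀ {A : Subset n} {M : Mat n} → card A ≡ k → TreeOn A M → suc (length (edges M)) ≡ k) count
  where
  count : ∀ k → (∀ {j} → j ℕ.< k → ∀ {A : Subset n} {M : Mat n} → card A ≡ j → TreeOn A M → suc (length (edges M)) ≡ j) →
          ∀ {A : Subset n} {M : Mat n} → card A ≡ k → TreeOn A M → suc (length (edges M)) ≡ k
  count k rec {A} {M} ∣A∣≡k tree with edges M in eq
  ... | [] = ≡.trans (≡.sym (no-edges⇒singleton tree none)) ∣A∣≡k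
    where
    open TreeOn tree
    empty : ∀ {e} → e ∈ edges M → ⊥
    empty e∈ with () ← subst (_ ∈_) eq e∈
    none : ∀ {x y} → ¬ Adj M x y
    none {x} {y} a with Fin.<-cmp x y
    ... | tri< x<y _ _ = empty (∈-edges⁺ M x<y a)
    ... | tri≈ _ x≡y _ = irreflexive a x≡y
    ... | tri> _ _ y<x = empty (∈-edges⁺ M y<x (symmetric a))
  ... | (u , v) ∷ es = ≡.trans (cong (suc ∘ length) (≡.sym eq)) (begin
    suc (length (edges M))                                         ≡⟨ cong (suc ∘ length ∘ edges) join-restrict ⟨
    suc (length (edges (join M₁ M₂ u v)))                          ≡⟨ cong suc (Perm.↭-length (edges-join splitting)) ⟩
    suc (suc (length (edges M₁ ++ edges M₂)))                      ≡⟨ cong (λ l → suc (suc l)) (List.length-++ (edges M₁)) ⟩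
    suc (suc (length (edges M₁) ℕ.+ length (edges M₂)))            ≡⟨ cong (λ l → suc l) (ℕ.+-suc (length (edges M₁)) (length (edges M₂))) ⟨
    suc (length (edges M₁)) ℕ.+ suc (length (edges M₂))            ≡⟨ cong₂ ℕ._+_ (rec smaller₁ ≡.refl tree₁) (rec smaller₂ ≡.refl tree₂) ⟩
    card B ℕ.+ card (A ─ B)                                        ≡⟨ ∣q∣+∣p─q∣≡∣p∣ A B B⊆A ⟩
    card A                                                         ≡⟨ ∣A∣≡k ⟩
    k                                                              ∎)
    where
    open ≡.≡-Reasoning
    uv : Adj M u v
    uv = proj₂ (∈-edges⁻ M (subst (_ ∈_) (≡.sym eq) (here ≡.refl)))
    open Split tree uv using (B; splitting; join-restrict)
    open Splitting splitting
    M₁ M₂ : Mat n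
    M₁ = restrict M B
    M₂ = restrict M (A ─ B)
    total : card B ℕ.+ card (A ─ B) ≡ k
    total = ≡.trans (∣q∣+∣p─q∣≡∣p∣ A B B⊆A) ∣A∣≡k
    smaller₁ : card B ℕ.< k
    smaller₁ = subst (card B ℕ.<_) total (ℕ.m<m+n (card B) (card-positive (v , v∈A─B)))
    smaller₂ : card (A ─ B) ℕ.< k
    smaller₂ = subst (card (A ─ B) ℕ.<_) total (ℕ.m<n+m (card (A ─ B)) (card-positive (u , u∈B)))

-- Weights of trees

vectors : ∀ {a} {A : Set a} → List A → ∀ k → List (Vec A k)
vectors xs zero    = [] ∷ []
vectors xs (suc k) = cartesianProductWith _∷_ xs (vectors xs k)

vectors! : ∀ {a} {A : Set a} {xs : List A} → Unique xs → ∀ k → Unique (vectors xs k)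
vectors! xs! zero    = [] ∷ []
vectors! xs! (suc k) = Unique.cartesianProductWith⁺ _∷_ Vec.∷-injective xs! (vectors! xs! k)

∈-vectors : ∀ {a} {A : Set a} {xs : List A} → (∀ x → x ∈ xs) → ∀ {k} (v : Vec A k) → v ∈ vectors xs k
∈-vectors all∈ []      = here ≡.refl
∈-vectors all∈ (x ∷ v) = List∈.∈-cartesianProductWith⁺ _∷_ (all∈ x) (∈-vectors all∈ v)

booleans : List Bool
booleans = true ∷ false ∷ []

booleans! : Unique booleans
booleans! = ((λ ()) ∷ []) ∷ [] ∷ []

∈-booleans : ∀ b → b ∈ booleans
∈-booleans true  = here ≡.refl
∈-booleans false = there (here ≡.refl)

subsets : ∀ N → List (Subset N)
subsets = vectors booleans

subsets! : ∀ N → Unique (subsets N)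
subsets! = vectors! booleans!

∈-subsets : ∀ {N} (B : Subset N) → B ∈ subsets N
∈-subsets = ∈-vectors ∈-booleans

matrices : ∀ N → List (Mat N)
matrices N = vectors (vectors booleans N) N

matrices! : ∀ N → Unique (matrices N)
matrices! N = vectors! (vectors! booleans! N) N

∈-matrices : ∀ {N} (M : Mat N) → M ∈ matrices N
∈-matrices = ∈-vectors (∈-vectors ∈-booleans)

-- The conjuncts are nested in the order in which `unfold` below peels them off one by one.
splitting? : ∀ {N} (A B : Subset N) M₁ M₂ u v → Dec (Splitting A B M₁ M₂ u v)
splitting? {N} A B M₁ M₂ u v = map′ to from
  ((B ⊆? A) ×-dec treeOn? B M₁ ×-dec (u ∈? B) ×-dec treeOn? (A ─ B) M₂ ×-dec (v ∈? A ─ B))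
  where
  Fields : Set
  Fields = B ⊆ A × TreeOn B M₁ × u ∈ˢ B × TreeOn (A ─ B) M₂ × v ∈ˢ A ─ B
  to : Fields → Splitting A B M₁ M₂ u v
  to (b , t₁ , p , t₂ , q) = record { B⊆A = b ; tree₁ = t₁ ; u∈B = p ; tree₂ = t₂ ; v∈A─B = q }
  from : Splitting A B M₁ M₂ u v → Fields
  from s = let open Splitting s in B⊆A , tree₁ , u∈B , tree₂ , v∈A─B

module Weights {c ℓ n} (𝔸 : DifferentialAlgebra c ℓ n) where
  open DifferentialAlgebraProperties 𝔸
  open Additive
  open ListSum +-commutativeMonoid
  open import Algebra.Properties.CommutativeMonoid.Sum *-commutativeMonoid using ()
    renaming (sum to Π; sum-cong-≋ to Π-cong; ∑-distrib-+ to Π-*; sum-replicate-zero to Π-1)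
  open import Relation.Binary.Reasoning.Setoid setoid

  private
    variable
      N N′ : ℕ

  -- What has been differentiated so far at each vertex.
  State : ℕ → Set c
  State N = Fin N → Carrier

  infix 4 _≋_
  _≋_ : State N → State N → Set ℓ
  s ≋ t = ∀ v → s v ≈ t v

  D[_] : ∀ {p} {P : Set p} → Dec P → Fin n → Carrier → Carrier
  D[ yes _ ] i f = D i f
  D[ no _  ] i f = f

  -- Attaches a half-edge with label `i` to the vertex `u`.
  ∂ : Fin n → Fin N → State N → State N
  ∂ i u s v = D[ v ≟ u ] i (s v)

  ∂-at : ∀ i (u : Fin N) s → ∂ i u s u ≈ D i (s u)
  ∂-at i u s with u ≟ u
  ... | yes _  = refl
  ... | no u≢u = contradiction ≡.refl u≢u

  ∂-cong : ∀ i (u : Fin N) {s t} → s ≋ t → ∂ i u s ≋ ∂ i u t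
  ∂-cong i u eq v with v ≟ u
  ... | yes _ = D-cong i (eq v)
  ... | no _  = eq v

  ∂-comm : ∀ i j (u v : Fin N) s → ∂ i u (∂ j v s) ≋ ∂ j v (∂ i u s)
  ∂-comm i j u v s w with w ≟ u | w ≟ v
  ... | yes _ | yes _ = D-comm i j (s w)
  ... | yes _ | no _  = refl
  ... | no _  | yes _ = refl
  ... | no _  | no _  = refl

  -- Σ over labelings of Π over vertices, one edge label at a time (see sum-labeled).
  L : List (Fin N × Fin N) → State N → Carrier
  L []             s = Π s
  L ((u , v) ∷ es) s = sum λ i → L es (∂ i u (∂ i v s))

  L-cong : ∀ (es : List (Fin N × Fin N)) {s t} → s ≋ t → L es s ≈ L es t
  L-cong []             eq = Π-cong eq
  L-cong ((u , v) ∷ es) eq = sum-cong-≋ λ i → L-cong es (∂-cong i u (∂-cong i v eq))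

  L-flip : ∀ (u v : Fin N) es s → L ((u , v) ∷ es) s ≈ L ((v , u) ∷ es) s
  L-flip u v es s = sum-cong-≋ λ i → L-cong es (∂-comm i i u v s)

  L-ordered : ∀ (u v : Fin N) es s → L (ordered (u , v) ∷ es) s ≈ L ((u , v) ∷ es) s
  L-ordered u v es s with u <? v
  ... | yes _ = refl
  ... | no _  = L-flip v u es s

  -- Derivatives commute, so two edges may be labeled in either order. This is what allows edge
  -- lists to be known only up to permutation.
  L-↭ : ∀ {es fs : List (Fin N × Fin N)} → es ↭ fs → ∀ s → L es s ≈ L fs s
  L-↭ Perm.refl s = refl
  L-↭ (Perm.prep (u , v) p) s = sum-cong-≋ λ i → L-↭ p (∂ i u (∂ i v s))
  L-↭ {fs = _ ∷ _ ∷ fs} (Perm.swap (u , v) (x , y) p) s = trans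
    (sum-cong-≋ λ i → sum-cong-≋ λ j → trans (L-↭ p _) (L-cong fs λ w → exchange i j w))
    (∑-comm λ i j → L fs (∂ i u (∂ i v (∂ j x (∂ j y s)))))
    where
    exchange : ∀ i j → ∂ j x (∂ j y (∂ i u (∂ i v s))) ≋ ∂ i u (∂ i v (∂ j x (∂ j y s)))
    exchange i j w = begin
      ∂ j x (∂ j y (∂ i u (∂ i v s))) w  ≈⟨ ∂-cong j x (∂-comm j i y u (∂ i v s)) w ⟩
      ∂ j x (∂ i u (∂ j y (∂ i v s))) w  ≈⟨ ∂-comm j i x u (∂ j y (∂ i v s)) w ⟩
      ∂ i u (∂ j x (∂ j y (∂ i v s))) w  ≈⟨ ∂-cong i u (∂-cong j x (∂-comm j i y v s)) w ⟩
      ∂ i u (∂ j x (∂ i v (∂ j y s))) w  ≈⟨ ∂-cong i u (∂-comm j i x v (∂ j y s)) w ⟩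
      ∂ i u (∂ i v (∂ j x (∂ j y s))) w  ∎
  L-↭ (Perm.trans p q) s = trans (L-↭ p s) (L-↭ q s)

  Π-zero : ∀ (s : State N) v → s v ≈ 0# → Π s ≈ 0#
  Π-zero s zero    eq = trans (*-congʳ eq) (zeroˡ _)
  Π-zero s (suc v) eq = trans (*-congˡ (Π-zero (s ∘ suc) v eq)) (zeroʳ _)

  ∂-zero : ∀ i (u : Fin N) s v → s v ≈ 0# → ∂ i u s v ≈ 0#
  ∂-zero i u s v eq with v ≟ u
  ... | yes _ = trans (D-cong i eq) (Φ-0 (D-additive i))
  ... | no _  = eq

  L-zero : ∀ es (s : State N) v → s v ≈ 0# → L es s ≈ 0#
  L-zero []             s v eq = Π-zero s v eq
  L-zero ((x , y) ∷ es) s v eq = trans (sum-cong-≋ λ i → L-zero es _ v (∂-zero i x (∂ i y s) v (∂-zero i y s v eq))) (sum-replicate-zero n)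

  D-Π : ∀ i (s : State N) → D i (Π s) ≈ sum λ u → Π (∂ i u s)
  D-Π {zero}  i s = D-1 i
  D-Π {suc N} i s = begin
    D i (s zero * Π (s ∘ suc))
      ≈⟨ D-* i _ _ ⟩
    D i (s zero) * Π (s ∘ suc) + s zero * D i (Π (s ∘ suc))
      ≈⟨ +-congˡ (*-congˡ (D-Π i (s ∘ suc))) ⟩
    D i (s zero) * Π (s ∘ suc) + s zero * sum (λ u → Π (∂ i u (s ∘ suc)))
      ≈⟨ +-congˡ (*-distribˡ-sum (s zero) (λ u → Π (∂ i u (s ∘ suc)))) ⟩
    D i (s zero) * Π (s ∘ suc) + sum (λ u → s zero * Π (∂ i u (s ∘ suc)))
      ≈⟨ +-congˡ (sum-cong-≋ λ u → *-congˡ (Π-cong λ v → later u v)) ⟩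
    sum (λ u → Π (∂ i u s)) ∎
    where
    later : ∀ u v → ∂ i u (s ∘ suc) v ≈ ∂ i (suc u) s (suc v)
    later u v with v ≟ u
    ... | yes _ = refl
    ... | no _  = refl

  -- By the product rule the derivative hits one vertex at a time: differentiating a weight means
  -- attaching a half-edge at every possible place.
  D-L : ∀ i es (s : State N) → D i (L es s) ≈ sum λ u → L es (∂ i u s)
  D-L i []             s = D-Π i s
  D-L i ((x , y) ∷ es) s = begin
    D i (sum λ j → L es (∂ j x (∂ j y s)))
      ≈⟨ Φ-sum (D-additive i) (λ j → L es (∂ j x (∂ j y s))) ⟩
    sum (λ j → D i (L es (∂ j x (∂ j y s))))
      ≈⟨ sum-cong-≋ (λ j → D-L i es (∂ j x (∂ j y s))) ⟩
    sum (λ j → sum λ u → L es (∂ i u (∂ j x (∂ j y s))))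
      ≈⟨ ∑-comm (λ j u → L es (∂ i u (∂ j x (∂ j y s)))) ⟩
    sum (λ u → sum λ j → L es (∂ i u (∂ j x (∂ j y s))))
      ≈⟨ sum-cong-≋ (λ u → sum-cong-≋ λ j → L-cong es λ w → trans (∂-comm i j u x (∂ j y s) w) (∂-cong j x (∂-comm i j u y s) w)) ⟩
    sum (λ u → L ((x , y) ∷ es) (∂ i u s)) ∎

  Constant : State N → Fin N → Set ℓ
  Constant s v = ∀ i → D i (s v) ≈ 0#

  infixl 7 _⊛_
  _⊛_ : State N → State N → State N
  (s ⊛ t) v = s v * t v

  ∂-⊛ˡ : ∀ i (u : Fin N) s t → Constant t u → ∂ i u (s ⊛ t) ≋ ∂ i u s ⊛ t
  ∂-⊛ˡ i u s t const v with v ≟ u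
  ... | yes ≡.refl = trans (D-* i (s v) (t v)) (trans (+-congˡ (trans (*-congˡ (const i)) (zeroʳ _))) (+-identityʳ _))
  ... | no _       = refl

  ∂-⊛ʳ : ∀ i (u : Fin N) s t → Constant s u → ∂ i u (s ⊛ t) ≋ s ⊛ ∂ i u t
  ∂-⊛ʳ i u s t const v with v ≟ u
  ... | yes ≡.refl = trans (D-* i (s v) (t v)) (trans (+-congʳ (trans (*-congʳ (const i)) (zeroˡ _))) (+-identityˡ _))
  ... | no _       = refl

  ∂-constant : ∀ i (u : Fin N) s v → Constant s v → Constant (∂ i u s) v
  ∂-constant i u s v const j with v ≟ u
  ... | yes _ = trans (D-comm j i (s v)) (trans (D-cong i (const j)) (Φ-0 (D-additive i)))
  ... | no _  = const j

  ConstantOn : List (Fin N × Fin N) → State N → Set ℓ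
  ConstantOn es s = ∀ {x y} → (x , y) ∈ es → Constant s x × Constant s y

  L-Π* : ∀ es (s t : State N) → ConstantOn es s → L es (s ⊛ t) ≈ Π s * L es t
  L-Π* []             s t const = Π-* s t
  L-Π* ((x , y) ∷ es) s t const = begin
    sum (λ i → L es (∂ i x (∂ i y (s ⊛ t))))
      ≈⟨ sum-cong-≋ (λ i → L-cong es λ v → trans (∂-cong i x (∂-⊛ʳ i y s t (proj₂ (const (here ≡.refl)))) v)
          (∂-⊛ʳ i x s (∂ i y t) (proj₁ (const (here ≡.refl))) v)) ⟩
    sum (λ i → L es (s ⊛ ∂ i x (∂ i y t)))
      ≈⟨ sum-cong-≋ (λ i → L-Π* es s (∂ i x (∂ i y t)) (const ∘ there)) ⟩
    sum (λ i → Π s * L es (∂ i x (∂ i y t)))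
      ≈⟨ *-distribˡ-sum (Π s) (λ i → L es (∂ i x (∂ i y t))) ⟨
    Π s * L ((x , y) ∷ es) t ∎

  -- A derivative belonging to an edge in `es` passes over `t`, which is constant at both ends of
  -- that edge, and likewise for `fs` and `s`. Hence the weight of a disjoint union is a product.
  L-++ : ∀ es fs (s t : State N) → ConstantOn es t → ConstantOn fs s → L (es ++ fs) (s ⊛ t) ≈ L es s * L fs t
  L-++ []             fs s t _ constˢ = L-Π* fs s t constˢ
  L-++ ((x , y) ∷ es) fs s t constᵗ constˢ = begin
    sum (λ i → L (es ++ fs) (∂ i x (∂ i y (s ⊛ t))))
      ≈⟨ sum-cong-≋ (λ i → L-cong (es ++ fs) λ v → trans (∂-cong i x (∂-⊛ˡ i y s t (proj₂ (constᵗ (here ≡.refl)))) v)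
          (∂-⊛ˡ i x (∂ i y s) t (proj₁ (constᵗ (here ≡.refl))) v)) ⟩
    sum (λ i → L (es ++ fs) (∂ i x (∂ i y s) ⊛ t))
      ≈⟨ sum-cong-≋ (λ i → L-++ es fs (∂ i x (∂ i y s)) t (constᵗ ∘ there) λ {a} {b} e∈ →
           ∂-constant i x (∂ i y s) a (∂-constant i y s a (proj₁ (constˢ e∈))) , ∂-constant i x (∂ i y s) b
               (∂-constant i y s b (proj₂ (constˢ e∈)))) ⟩
    sum (λ i → L es (∂ i x (∂ i y s)) * L fs t)
      ≈⟨ *-distribʳ-sum (L fs t) (λ i → L es (∂ i x (∂ i y s))) ⟨
    L ((x , y) ∷ es) s * L fs t ∎

  additive-∑ : ∀ {a} {A : Set a} {Φ} → Additive Φ → (xs : List A) (f : A → Carrier) → Φ (∑ xs f) ≈ ∑ xs (Φ ∘ f)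
  additive-∑ Φ⁺ []       f = Φ-0 Φ⁺
  additive-∑ Φ⁺ (x ∷ xs) f = trans (Φ-+ Φ⁺ _ _) (+-congˡ (additive-∑ Φ⁺ xs f))

  additive-[] : ∀ {p} {P : Set p} {Φ} → Additive Φ → (d : Dec P) (x : Carrier) → Φ ([ d ] x) ≈ [ d ] Φ x
  additive-[] Φ⁺ (yes _) x = refl
  additive-[] Φ⁺ (no _)  x = Φ-0 Φ⁺

  ·-additive : ∀ k → Additive (k ·_)
  ·-additive k = record { Φ-cong = ×-congʳ k ; Φ-+ = λ f g → ×-distrib-+ f g k }

  sum-∑ : ∀ {a} {A : Set a} {m} (xs : List A) (f : Fin m → A → Carrier) → sum (λ i → ∑ xs (f i)) ≈ ∑ xs (λ x → sum (λ i → f i x))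
  sum-∑ {m = zero}  xs f = sym (∑-ε xs)
  sum-∑ {m = suc m} xs f = trans (+-congˡ (sum-∑ xs (f ∘ suc))) (sym (∑-∙ xs (f zero) _))

  sum-[] : ∀ {p} {P : Set p} {m} (d : Dec P) (f : Fin m → Carrier) → sum (λ i → [ d ] f i) ≈ [ d ] sum f
  sum-[] (yes _) f = refl
  sum-[] {m = m} (no _) f = sum-replicate-zero m

  module Potential (P : Carrier) where

    inside-P : ∀ {p} {X : Set p} → Dec X → Carrier
    inside-P (yes _) = P
    inside-P (no _)  = 1#

    -- Vertices outside `A` carry 1: they do not affect the product, and a half-edge placed there
    -- gives 0.
    potential : Subset N → State N
    potential A v = inside-P (v ∈? A)

    potential-in : ∀ {A : Subset N} {v} → v ∈ˢ A → potential A v ≈ P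
    potential-in {A = A} {v} v∈A with v ∈? A
    ... | yes _  = refl
    ... | no v∉A = contradiction v∈A v∉A

    potential-out : ∀ {A : Subset N} {v} → v ∉ˢ A → potential A v ≈ 1#
    potential-out {A = A} {v} v∉A with v ∈? A
    ... | yes v∈A = contradiction v∈A v∉A
    ... | no _    = refl

    potential-constant : ∀ {A : Subset N} {v} → v ∉ˢ A → Constant (potential A) v
    potential-constant v∉A i = trans (D-cong i (potential-out v∉A)) (D-1 i)

    potential-─ : ∀ {A B : Subset N} → B ⊆ A → potential A ≋ potential B ⊛ potential (A ─ B)
    potential-─ {A = A} {B} B⊆A v with v ∈? B
    ... | yes v∈B = trans (potential-in (B⊆A v∈B)) (sym (trans (*-congˡ (potential-out λ v∈ → x∈p─q⇒x∉q A B v∈ v∈B)) (*-identityʳ P)))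
    ... | no v∉B  = trans inner (sym (*-identityˡ _))
      where
      inner : potential A v ≈ potential (A ─ B) v
      inner with v ∈? A
      ... | yes v∈A = sym (potential-in (Subset.x∈p∧x∉q⇒x∈p─q v∈A v∉B))
      ... | no v∉A  = sym (potential-out (v∉A ∘ Subset.p─q⊆p A B))

    weight : Subset N → Mat N → Carrier
    weight A M = L (edges M) (potential A)

    S : Subset N → Carrier
    S {N} A = ∑ (matrices N) λ M → [ treeOn? A M ] weight A M

    half : Subset N → Mat N → Fin n → Fin N → Carrier
    half A M i u = L (edges M) (∂ i u (potential A))

    -- This lets the root in `rooted` range over all of `Fin N` without a test for membership in
    -- `A`.
    half-out : ∀ {A : Subset N} M i {u} → u ∉ˢ A → half A M i u ≈ 0#
    half-out {A = A} M i {u} u∉A = L-zero (edges M) _ u (trans (∂-at i u (potential A)) (potential-constant u∉A i))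

    rooted : Subset N → Fin n → Carrier
    rooted {N} A i = ∑ (matrices N) λ M → [ treeOn? A M ] ∑ (allFin N) (half A M i)

    D-S : ∀ (A : Subset N) i → D i (S A) ≈ rooted A i
    D-S {N} A i = trans (additive-∑ (D-additive i) (matrices N) _) (∑-cong (matrices N) λ M →
      trans (additive-[] (D-additive i) (treeOn? A M) _) ([]-cong (treeOn? A M) λ _ →
        trans (D-L i (edges M) (potential A)) (sym (reflexive (∑-allFin (half A M i))))))

    -- Once the label `i` of the gluing edge is fixed, this edge is a pair of half-edges, one in
    -- each tree, and the remaining weight factors by `L-++`.
    weight-join : ∀ {A B : Subset N} {M₁ M₂ u v} → Splitting A B M₁ M₂ u v →
                  weight A (join M₁ M₂ u v) ≈ sum λ i → half B M₁ i u * half (A ─ B) M₂ i v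
    weight-join {A = A} {B} {M₁} {M₂} {u} {v} s = begin
      L (edges (join M₁ M₂ u v)) (potential A)
        ≈⟨ L-↭ (edges-join s) (potential A) ⟩
      L (ordered (u , v) ∷ edges M₁ ++ edges M₂) (potential A)
        ≈⟨ L-ordered u v (edges M₁ ++ edges M₂) (potential A) ⟩
      sum (λ i → L (edges M₁ ++ edges M₂) (∂ i u (∂ i v (potential A))))
        ≈⟨ sum-cong-≋ (λ i → L-cong (edges M₁ ++ edges M₂) (factor i)) ⟩
      sum (λ i → L (edges M₁ ++ edges M₂) (∂ i u (potential B) ⊛ ∂ i v (potential (A ─ B))))
        ≈⟨ sum-cong-≋ (λ i → L-++ (edges M₁) (edges M₂) _ _ (const₁ i) (const₂ i)) ⟩
      sum (λ i → half B M₁ i u * half (A ─ B) M₂ i v) ∎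
      where
      open Splitting s
      factor : ∀ i → ∂ i u (∂ i v (potential A)) ≋ ∂ i u (potential B) ⊛ ∂ i v (potential (A ─ B))
      factor i w = begin
        ∂ i u (∂ i v (potential A)) w                              ≈⟨ ∂-cong i u (∂-cong i v (potential-─ B⊆A)) w ⟩
        ∂ i u (∂ i v (potential B ⊛ potential (A ─ B))) w          ≈⟨ ∂-cong i u
            (∂-⊛ʳ i v (potential B) (potential (A ─ B)) (potential-constant v∉B)) w ⟩
        ∂ i u (potential B ⊛ ∂ i v (potential (A ─ B))) w          ≈⟨ ∂-⊛ˡ i u (potential B) _
            (∂-constant i v (potential (A ─ B)) u (potential-constant λ u∈ → ∉B u∈ u∈B)) w ⟩
        (∂ i u (potential B) ⊛ ∂ i v (potential (A ─ B))) w        ∎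
      const₁ : ∀ i → ConstantOn (edges M₁) (∂ i v (potential (A ─ B)))
      const₁ i {x} {y} e∈ with a ← proj₂ (∈-edges⁻ M₁ e∈) =
        ∂-constant i v (potential (A ─ B)) x (potential-constant λ x∈ → ∉B x∈ (T₁.supported a)) ,
        ∂-constant i v (potential (A ─ B)) y (potential-constant λ y∈ → ∉B y∈ (T₁.supportedʳ a))
      const₂ : ∀ i → ConstantOn (edges M₂) (∂ i u (potential B))
      const₂ i {x} {y} e∈ with a ← proj₂ (∈-edges⁻ M₂ e∈) =
        ∂-constant i u (potential B) x (potential-constant (∉B (T₂.supported a))) ,
        ∂-constant i u (potential B) y (potential-constant (∉B (T₂.supportedʳ a)))

    ∑-const : ∀ {a} {A : Set a} (xs : List A) x → ∑ xs (λ _ → x) ≈ length xs · x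
    ∑-const []       x = refl
    ∑-const (_ ∷ xs) x = +-congˡ (∑-const xs x)

    -- Both sides count trees on A with a distinguished oriented edge.
    S-split : ∀ m (A : Subset N) → card A ≡ suc m →
              (m ℕ.+ m) · S A ≈ ∑ (subsets N) λ B → [ B ⊆? A ] sum λ i → D i (S B) * D i (S (A ─ B))
    S-split {N} m A ∣A∣≡ = begin
      (m ℕ.+ m) · S A
        ≈⟨ additive-∑ (·-additive (m ℕ.+ m)) (matrices N) _ ⟩
      ∑ (matrices N) (λ M → (m ℕ.+ m) · [ treeOn? A M ] weight A M)
        -- A tree with m + 1 vertices has m edges, hence `m ℕ.+ m` arcs.
        ≈⟨ ∑-cong (matrices N) count-arcs ⟩
      ∑ (matrices N) (λ M → ∑ (pairs N) λ (u , v) → [ treeOn? A M ×-dec adj? M u v ] weight A M)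
        ≈⟨ ∑-cartesianProduct (matrices N) (pairs N) _ ⟨
      ∑ (cartesianProduct (matrices N) (pairs N)) (λ (M , u , v) → [ treeOn? A M ×-dec adj? M u v ] weight A M)
        ≈⟨ ∑-filter arc? (cartesianProduct (matrices N) (pairs N)) _ ⟨
      ∑ arcs-in-trees (λ (M , _ , _) → weight A M)
        ≈⟨ ∑-cong∈ arcs-in-trees (λ {x} x∈ → weight-cut (proj₂ (List∈.∈-filter⁻ arc? {xs = cartesianProduct (matrices N) (pairs N)} x∈))) ⟩
      ∑ arcs-in-trees (product-weight ∘ cut)
        ≈⟨ ∑-bijection cut glue arcs-in-trees! splittings! cut-glue glue-cut product-weight ⟩
      ∑ splittings product-weight
        ≈⟨ ∑-filter split? all-pieces product-weight ⟩
      ∑ all-pieces (λ z → [ split? z ] product-weight z)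
        ≈⟨ trans (∑-cartesianProduct (subsets N) _ _) (∑-cong (subsets N) λ B →
             trans (∑-cartesianProduct (matrices N) _ _) (∑-cong (matrices N) λ M₁ →
             trans (∑-cartesianProduct (allFin N) _ _) (∑-cong (allFin N) λ u →
             ∑-cartesianProduct (matrices N) _ _))) ⟩
      ∑ (subsets N) (λ B → ∑ (matrices N) λ M₁ → ∑ (allFin N) λ u → ∑ (matrices N) λ M₂ → ∑ (allFin N) λ v →
        [ splitting? A B M₁ M₂ u v ] product-weight (B , M₁ , u , M₂ , v))
        ≈⟨ ∑-cong (subsets N) factor ⟩
      ∑ (subsets N) (λ B → [ B ⊆? A ] sum λ i → D i (S B) * D i (S (A ─ B))) ∎
      where
      Pieces : Set
      Pieces = Subset N × Mat N × Fin N × Mat N × Fin N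

      all-pieces : List Pieces
      all-pieces = cartesianProduct (subsets N) (cartesianProduct (matrices N)
          (cartesianProduct (allFin N) (cartesianProduct (matrices N) (allFin N))))

      all-pieces! : Unique all-pieces
      all-pieces! = Unique.cartesianProduct⁺ (subsets! N) (Unique.cartesianProduct⁺ (matrices! N)
        (Unique.cartesianProduct⁺ (Unique.allFin⁺ N) (Unique.cartesianProduct⁺ (matrices! N) (Unique.allFin⁺ N))))

      ∈-all-pieces : ∀ z → z ∈ all-pieces
      ∈-all-pieces (B , M₁ , u , M₂ , v) = List∈.∈-cartesianProduct⁺ (∈-subsets B) (List∈.∈-cartesianProduct⁺ (∈-matrices M₁)
        (List∈.∈-cartesianProduct⁺ (List∈.∈-allFin u) (List∈.∈-cartesianProduct⁺ (∈-matrices M₂) (List∈.∈-allFin v))))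

      Arc : Set
      Arc = Mat N × Fin N × Fin N

      arc? : (x : Arc) → Dec (TreeOn A (proj₁ x) × Adj (proj₁ x) (proj₁ (proj₂ x)) (proj₂ (proj₂ x)))
      arc? (M , u , v) = treeOn? A M ×-dec adj? M u v

      arcs-in-trees : List Arc
      arcs-in-trees = filter arc? (cartesianProduct (matrices N) (pairs N))

      arcs-in-trees! : Unique arcs-in-trees
      arcs-in-trees! = Unique.filter⁺ arc? (Unique.cartesianProduct⁺ (matrices! N) (pairs! N))

      IsSplitting : Pieces → Set
      IsSplitting (B , M₁ , u , M₂ , v) = Splitting A B M₁ M₂ u v

      split? : ∀ z → Dec (IsSplitting z)
      split? (B , M₁ , u , M₂ , v) = splitting? A B M₁ M₂ u v

      splittings : List Pieces
      splittings = filter split? all-pieces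

      splittings! : Unique splittings
      splittings! = Unique.filter⁺ split? all-pieces!

      cut : Arc → Pieces
      cut (M , u , v) = let B = component M u v in B , restrict M B , u , restrict M (A ─ B) , v

      glue : Pieces → Arc
      glue (B , M₁ , u , M₂ , v) = join M₁ M₂ u v , u , v

      product-weight : Pieces → Carrier
      product-weight (B , M₁ , u , M₂ , v) = sum λ i → half B M₁ i u * half (A ─ B) M₂ i v

      cut-glue : ∀ {x} → x ∈ arcs-in-trees → cut x ∈ splittings × glue (cut x) ≡ x
      cut-glue {M , u , v} x∈ with tree , uv ← proj₂ (List∈.∈-filter⁻ arc? {xs = cartesianProduct (matrices N) (pairs N)} x∈) =
        List∈.∈-filter⁺ split? (∈-all-pieces (cut (M , u , v))) (Split.splitting tree uv) , cong (_, u , v) (Split.join-restrict tree uv)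

      glue-cut : ∀ {z} → z ∈ splittings → glue z ∈ arcs-in-trees × cut (glue z) ≡ z
      glue-cut {B , M₁ , u , M₂ , v} z∈ with s ← proj₂ (List∈.∈-filter⁻ split? {xs = all-pieces} z∈) =
        List∈.∈-filter⁺ arc? (List∈.∈-cartesianProduct⁺ (∈-matrices _) (∈-pairs _)) (Joined.tree s , Joined.uv s) , same s
        where
        same : Splitting A B M₁ M₂ u v → cut (glue (B , M₁ , u , M₂ , v)) ≡ (B , M₁ , u , M₂ , v)
        same s rewrite Joined.component-join s | Joined.restrict-join₁ s | Joined.restrict-join₂ s = ≡.refl

      weight-cut : ∀ {x} → TreeOn A (proj₁ x) × Adj (proj₁ x) (proj₁ (proj₂ x)) (proj₂ (proj₂ x)) → weight A (proj₁ x) ≈ product-weight (cut x)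
      weight-cut {M , u , v} (tree , uv) = trans (reflexive (cong (weight A) (≡.sym (Split.join-restrict tree uv))))
          (weight-join (Split.splitting tree uv))

      count-arcs : ∀ M → (m ℕ.+ m) · [ treeOn? A M ] weight A M ≈ ∑ (pairs N) (λ (u , v) → [ treeOn? A M ×-dec adj? M u v ] weight A M)
      count-arcs M = begin
        (m ℕ.+ m) · [ treeOn? A M ] weight A M
          ≈⟨ additive-[] (·-additive (m ℕ.+ m)) (treeOn? A M) _ ⟩
        [ treeOn? A M ] (m ℕ.+ m) · weight A M
          ≈⟨ []-cong (treeOn? A M) (λ tree → trans (reflexive (cong (_· weight A M) (number tree)))
               (trans (sym (∑-const (arcs M) (weight A M))) (∑-filter (λ (u , v) → adj? M u v) (pairs N) _))) ⟩
        [ treeOn? A M ] ∑ (pairs N) (λ (u , v) → [ adj? M u v ] weight A M)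
          ≈⟨ []-∑ (treeOn? A M) (pairs N) _ ⟩
        ∑ (pairs N) (λ (u , v) → [ treeOn? A M ] [ adj? M u v ] weight A M)
          ≈⟨ ∑-cong (pairs N) (λ (u , v) → reflexive ([]-× (treeOn? A M) (adj? M u v))) ⟨
        ∑ (pairs N) (λ (u , v) → [ treeOn? A M ×-dec adj? M u v ] weight A M) ∎
        where
        number : TreeOn A M → m ℕ.+ m ≡ length (arcs M)
        number tree = ≡.trans (cong₂ ℕ._+_ m≡ m≡) (≡.sym (length-arcs tree))
          where
          m≡ : m ≡ length (edges M)
          m≡ = ℕ.suc-injective (≡.sym (length-edges (suc m) ∣A∣≡ tree))

      module _ (B : Subset N) where
        term : Fin n → Mat N → Fin N → Mat N → Fin N → Carrier
        term i M₁ u M₂ v = half B M₁ i u * half (A ─ B) M₂ i v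

        unfold : ∀ M₁ u M₂ v → [ splitting? A B M₁ M₂ u v ] product-weight (B , M₁ , u , M₂ , v) ≈
                               [ B ⊆? A ] [ treeOn? B M₁ ] [ treeOn? (A ─ B) M₂ ] sum (λ i → term i M₁ u M₂ v)
        unfold M₁ u M₂ v = begin
          [ splitting? A B M₁ M₂ u v ] w
            ≡⟨⟩
          [ (B ⊆? A) ×-dec treeOn? B M₁ ×-dec (u ∈? B) ×-dec treeOn? (A ─ B) M₂ ×-dec (v ∈? A ─ B) ] w
            ≡⟨ []-× (B ⊆? A) (treeOn? B M₁ ×-dec (u ∈? B) ×-dec treeOn? (A ─ B) M₂ ×-dec (v ∈? A ─ B)) ⟩
          [ B ⊆? A ] [ treeOn? B M₁ ×-dec (u ∈? B) ×-dec treeOn? (A ─ B) M₂ ×-dec (v ∈? A ─ B) ] w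
            ≈⟨ []-cong (B ⊆? A) (λ _ → begin
                 [ treeOn? B M₁ ×-dec (u ∈? B) ×-dec treeOn? (A ─ B) M₂ ×-dec (v ∈? A ─ B) ] w
                   ≡⟨ []-× (treeOn? B M₁) ((u ∈? B) ×-dec treeOn? (A ─ B) M₂ ×-dec (v ∈? A ─ B)) ⟩
                 [ treeOn? B M₁ ] [ (u ∈? B) ×-dec treeOn? (A ─ B) M₂ ×-dec (v ∈? A ─ B) ] w
                   ≈⟨ []-cong (treeOn? B M₁) (λ _ → inner) ⟩
                 [ treeOn? B M₁ ] [ treeOn? (A ─ B) M₂ ] w ∎) ⟩
          [ B ⊆? A ] [ treeOn? B M₁ ] [ treeOn? (A ─ B) M₂ ] w ∎
          where
          w : Carrier
          w = sum (λ i → term i M₁ u M₂ v)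
          absorb : ∀ {p} {X : Set p} (d : Dec X) {x} → (¬ X → x ≈ 0#) → [ d ] x ≈ x
          absorb (yes _) _    = refl
          absorb (no ¬x) vanish = sym (vanish ¬x)
          -- Where `u` or `v` lies on the wrong side the term is 0 anyway, so the two membership
          -- brackets disappear and the sums over both trees become independent.
          inner : [ (u ∈? B) ×-dec treeOn? (A ─ B) M₂ ×-dec (v ∈? A ─ B) ] w ≈ [ treeOn? (A ─ B) M₂ ] w
          inner = begin
            [ (u ∈? B) ×-dec treeOn? (A ─ B) M₂ ×-dec (v ∈? A ─ B) ] w
              ≡⟨ []-× (u ∈? B) (treeOn? (A ─ B) M₂ ×-dec (v ∈? A ─ B)) ⟩
            [ u ∈? B ] [ treeOn? (A ─ B) M₂ ×-dec (v ∈? A ─ B) ] w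
              ≈⟨ []-cong (u ∈? B) (λ _ → trans (reflexive ([]-× (treeOn? (A ─ B) M₂) (v ∈? A ─ B))) ([]-cong (treeOn? (A ─ B) M₂) λ _ →
                   absorb (v ∈? A ─ B) λ v∉ → trans (sum-cong-≋ λ i → trans (*-congˡ (half-out M₂ i v∉)) (zeroʳ _)) (sum-replicate-zero n))) ⟩
            [ u ∈? B ] [ treeOn? (A ─ B) M₂ ] w
              ≈⟨ absorb (u ∈? B) (λ u∉ → trans ([]-cong (treeOn? (A ─ B) M₂) λ _ →
                   trans (sum-cong-≋ λ i → trans (*-congʳ (half-out M₁ i u∉)) (zeroˡ _)) (sum-replicate-zero n)) ([]-ε (treeOn? (A ─ B) M₂))) ⟩
            [ treeOn? (A ─ B) M₂ ] w ∎

        expand : ∀ i → rooted B i * rooted (A ─ B) i ≈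
                 ∑ (matrices N) λ M₁ → ∑ (allFin N) λ u → ∑ (matrices N) λ M₂ → ∑ (allFin N) λ v →
                   [ treeOn? B M₁ ] [ treeOn? (A ─ B) M₂ ] term i M₁ u M₂ v
        expand i = trans (additive-∑ (*ʳ-additive _) (matrices N) _) (∑-cong (matrices N) λ M₁ →
          trans (additive-[] (*ʳ-additive _) (treeOn? B M₁) _) (trans ([]-cong (treeOn? B M₁) λ _ →
            trans (additive-∑ (*ʳ-additive _) (allFin N) _) (∑-cong (allFin N) λ u →
              trans (additive-∑ (*ˡ-additive _) (matrices N) _) (∑-cong (matrices N) λ M₂ →
                trans (additive-[] (*ˡ-additive _) (treeOn? (A ─ B) M₂) _)
                  (trans ([]-cong (treeOn? (A ─ B) M₂) λ _ → additive-∑ (*ˡ-additive _) (allFin N) _) ([]-∑ (treeOn? (A ─ B) M₂) (allFin N) _)))))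
            (trans ([]-∑ (treeOn? B M₁) (allFin N) _) (∑-cong (allFin N) λ u →
              trans ([]-∑ (treeOn? B M₁) (matrices N) _) (∑-cong (matrices N) λ M₂ → []-∑ (treeOn? B M₁) (allFin N) _)))))

        factor : (∑ (matrices N) λ M₁ → ∑ (allFin N) λ u → ∑ (matrices N) λ M₂ → ∑ (allFin N) λ v →
                   [ splitting? A B M₁ M₂ u v ] product-weight (B , M₁ , u , M₂ , v)) ≈
                 [ B ⊆? A ] sum (λ i → D i (S B) * D i (S (A ─ B)))
        factor = begin
          (∑ (matrices N) λ M₁ → ∑ (allFin N) λ u → ∑ (matrices N) λ M₂ → ∑ (allFin N) λ v →
            [ splitting? A B M₁ M₂ u v ] product-weight (B , M₁ , u , M₂ , v))
            ≈⟨ (∑-cong (matrices N) λ M₁ → ∑-cong (allFin N) λ u → ∑-cong (matrices N) λ M₂ → ∑-cong (allFin N) λ v → unfold M₁ u M₂ v) ⟩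
          (∑ (matrices N) λ M₁ → ∑ (allFin N) λ u → ∑ (matrices N) λ M₂ → ∑ (allFin N) λ v → [ B ⊆? A ] all M₁ u M₂ v)
            ≈⟨ trans ([]-∑ (B ⊆? A) (matrices N) _) (∑-cong (matrices N) λ M₁ → trans ([]-∑ (B ⊆? A) (allFin N) _) (∑-cong (allFin N) λ u →
                 trans ([]-∑ (B ⊆? A) (matrices N) _) (∑-cong (matrices N) λ M₂ → []-∑ (B ⊆? A) (allFin N) _))) ⟨
          [ B ⊆? A ] (∑ (matrices N) λ M₁ → ∑ (allFin N) λ u → ∑ (matrices N) λ M₂ → ∑ (allFin N) λ v → all M₁ u M₂ v)
            ≈⟨ []-cong (B ⊆? A) (λ _ → collect) ⟩
          [ B ⊆? A ] sum (λ i → D i (S B) * D i (S (A ─ B))) ∎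
          where
          all : Mat N → Fin N → Mat N → Fin N → Carrier
          all M₁ u M₂ v = [ treeOn? B M₁ ] [ treeOn? (A ─ B) M₂ ] sum (λ i → term i M₁ u M₂ v)
          collect : (∑ (matrices N) λ M₁ → ∑ (allFin N) λ u → ∑ (matrices N) λ M₂ → ∑ (allFin N) λ v → all M₁ u M₂ v) ≈ sum
              (λ i → D i (S B) * D i (S (A ─ B)))
          collect = sym (begin
            sum (λ i → D i (S B) * D i (S (A ─ B)))
              ≈⟨ sum-cong-≋ (λ i → trans (*-cong (D-S B i) (D-S (A ─ B) i)) (expand i)) ⟩
            sum (λ i → ∑ (matrices N) λ M₁ → ∑ (allFin N) λ u → ∑ (matrices N) λ M₂ → ∑ (allFin N) λ v →
                         [ treeOn? B M₁ ] [ treeOn? (A ─ B) M₂ ] term i M₁ u M₂ v)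
              ≈⟨ trans (sum-∑ {m = n} (matrices N) _) (∑-cong (matrices N) λ M₁ → trans (sum-∑ {m = n} (allFin N) _) (∑-cong (allFin N) λ u →
                   trans (sum-∑ {m = n} (matrices N) _) (∑-cong (matrices N) λ M₂ → trans (sum-∑ {m = n} (allFin N) _) (∑-cong (allFin N) λ v →
                     trans (sum-[] {m = n} (treeOn? B M₁) _) ([]-cong (treeOn? B M₁) λ _ → sum-[] {m = n} (treeOn? (A ─ B) M₂) _))))) ⟩
            (∑ (matrices N) λ M₁ → ∑ (allFin N) λ u → ∑ (matrices N) λ M₂ → ∑ (allFin N) λ v → all M₁ u M₂ v) ∎)

-- The recursion for the tree series

card≡0⇒∉ : ∀ {N} (A : Subset N) → card A ≡ 0 → ∀ {x} → x ∉ˢ A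
card≡0⇒∉ A eq x∈A = contradiction (card-positive (_ , x∈A)) (ℕ.<-irrefl (≡.sym eq))

card≡1⇒singleton : ∀ {N} (A : Subset N) → card A ≡ 1 → ∃[ x ] x ∈ˢ A × (∀ {y} → y ∈ˢ A → y ≡ x)
card≡1⇒singleton (inside ∷ A)  eq = zero , here , λ { here → ≡.refl ; (there y∈A) → contradiction y∈A (card≡0⇒∉ A (ℕ.suc-injective eq)) }
card≡1⇒singleton (outside ∷ A) eq with x , x∈A , only ← card≡1⇒singleton A eq = suc x , there x∈A , λ { (there y∈A) → cong suc (only y∈A) }

module TreeSeries {c ℓ n} (𝔸 : DifferentialAlgebra c ℓ n) (P : DifferentialAlgebra.Carrier 𝔸) where
  open DifferentialAlgebraProperties 𝔸
  open Additive
  open ListSum +-commutativeMonoid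
  open Weights 𝔸
  open Potential P
  open import Algebra.Properties.CommutativeMonoid.Sum *-commutativeMonoid using ()
    renaming (sum to Π)
  open ListSum *-commutativeMonoid using () renaming (sum-single to Π-single)
  open import Relation.Binary.Reasoning.Setoid setoid

  -- The sum of (m choose k) times `h k l` over k + l = m, written through Pascal's rule: one
  -- summand for each subset of an m-element set.
  binomial : ℕ → (ℕ → ℕ → Carrier) → Carrier
  binomial zero    h = h 0 0
  binomial (suc m) h = binomial m (λ k l → h (suc k) l) + binomial m (λ k l → h k (suc l))

  -- Each element of `A` goes to `B` or to the rest, which is the recursion of `binomial`; positions
  -- outside `A` leave no choice.
  ∑-subsets : ∀ {N} (A : Subset N) (h : ℕ → ℕ → Carrier) →
              ∑ (subsets N) (λ B → [ B ⊆? A ] h (card B) (card (A ─ B))) ≈ binomial (card A) h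
  ∑-subsets []            h = +-identityʳ _
  ∑-subsets {suc N} (s ∷ A) h = begin
    ∑ (subsets (suc N)) f
      ≈⟨ ∑-product booleans (subsets N) f ⟩
    ∑ (subsets N) (λ B → f (inside ∷ B)) + (∑ (subsets N) (λ B → f (outside ∷ B)) + 0#)
      ≈⟨ +-congˡ (+-identityʳ _) ⟩
    ∑ (subsets N) (λ B → f (inside ∷ B)) + ∑ (subsets N) (λ B → f (outside ∷ B))
      ≈⟨ halves s ⟩
    binomial (card (s ∷ A)) h ∎
    where
    f : Subset (suc N) → Carrier
    f B = [ B ⊆? (s ∷ A) ] h (card B) (card ((s ∷ A) ─ B))
    ∑-product : ∀ (bs : List Bool) (xs : List (Subset N)) (g : Subset (suc N) → Carrier) →
                ∑ (List.cartesianProductWith _∷_ bs xs) g ≈ ∑ bs (λ b → ∑ xs (λ B → g (b ∷ B)))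
    ∑-product []       xs g = refl
    ∑-product (b ∷ bs) xs g = trans (∑-++ (map (b ∷_) xs) _ g) (+-cong (reflexive (∑-map (b ∷_) xs g)) (∑-product bs xs g))
    halves : ∀ s → ∑ (subsets N) (λ B → [ (inside ∷ B) ⊆? (s ∷ A) ] h (card (inside ∷ B)) (card ((s ∷ A) ─ (inside ∷ B)))) +
                   ∑ (subsets N) (λ B → [ (outside ∷ B) ⊆? (s ∷ A) ] h (card (outside ∷ B)) (card ((s ∷ A) ─ (outside ∷ B)))) ≈
                   binomial (card (s ∷ A)) h
    halves true  = +-cong
      (trans (∑-cong (subsets N) λ B → []-⇔ ((inside ∷ B) ⊆? (inside ∷ A)) (B ⊆? A) Subset.drop-∷-⊆ Subset.s⊆s) (∑-subsets A (λ k l → h (suc k) l)))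
      (trans (∑-cong (subsets N) λ B → []-⇔ ((outside ∷ B) ⊆? (inside ∷ A)) (B ⊆? A) Subset.drop-∷-⊆ Subset.out⊆) (∑-subsets A (λ k l → h k (suc l))))
    halves false = trans (+-cong
      (trans (∑-cong (subsets N) λ B → []-no ((inside ∷ B) ⊆? (outside ∷ A))
          {h (card (inside ∷ B)) (card ((outside ∷ A) ─ (inside ∷ B)))} λ sub → contradiction (sub here) λ ()) (∑-ε (subsets N)))
      (trans (∑-cong (subsets N) λ B → []-⇔ ((outside ∷ B) ⊆? (outside ∷ A)) (B ⊆? A) Subset.drop-∷-⊆ Subset.out⊆) (∑-subsets A h)))
      (+-identityˡ _)

  S-empty : ∀ {N} (A : Subset N) → card A ≡ 0 → S A ≈ 0#
  S-empty {N} A eq = ∑-ε∈ (matrices N) λ {M} _ → []-no (treeOn? A M) λ t → card≡0⇒∉ A eq (proj₂ (TreeOn.nonempty t))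

  S-single : ∀ {N} (A : Subset N) → card A ≡ 1 → S A ≈ P
  S-single {N} A eq with a , a∈A , only ← card≡1⇒singleton A eq = begin
    S A                                          ≈⟨ ∑-single (treeOn? A) (weight A) (matrices! N) (∈-matrices none) tree unique ⟩
    weight A none                                ≡⟨ cong (λ es → L es (potential A)) (no-edges tree) ⟩
    Π (potential A)                              ≈⟨ Π-single a (potential A) (λ v v≢a → potential-out (v≢a ∘ only)) ⟩
    potential A a                                ≈⟨ potential-in a∈A ⟩
    P                                            ∎
    where
    none : Mat N
    none = graph {R = λ _ _ → ⊥} (λ _ _ → no λ ())
    ¬adj : ∀ {x y} → ¬ Adj none x y
    ¬adj {x} {y} a = graph⁻ {N} {R = λ _ _ → ⊥} (λ _ _ → no λ ()) {x} {y} a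
    tree : TreeOn A none
    tree = record
      { symmetric = λ a → contradiction a ¬adj ; supported = λ a → contradiction a ¬adj ; nonempty = a , a∈A
      ; connected = λ x∈A y∈A → subst (Star _ _) (≡.trans (only x∈A) (≡.sym (only y∈A))) ε⋆
      ; bridge = λ a → contradiction a ¬adj }
    no-edges : ∀ {M : Mat N} → TreeOn A M → edges M ≡ []
    no-edges {M} t with edges M | length-edges 1 eq t
    ... | [] | _ = ≡.refl
    unique : ∀ {M : Mat N} → TreeOn A M → M ≡ none
    unique {M} t = mat-ext (λ {x} {y} a → contradiction (adj-no a) λ ()) (λ a → contradiction a ¬adj)
      where
      open TreeOn t
      adj-no : ∀ {x y} → Adj M x y → ⊥
      adj-no a = irreflexive a (≡.trans (only (supported a)) (≡.sym (only (supportedʳ a))))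

  s : ℕ → Carrier
  s m = S (⊤ {m})

  pairing : Carrier → Carrier → Carrier
  pairing f g = sum λ i → D i f * D i g

  pairing-cong : ∀ {f f′ g g′} → f ≈ f′ → g ≈ g′ → pairing f g ≈ pairing f′ g′
  pairing-cong p q = sum-cong-≋ λ i → *-cong (D-cong i p) (D-cong i q)

  pairing-0ʳ : ∀ f → pairing f 0# ≈ 0#
  pairing-0ʳ f = trans (sum-cong-≋ λ i → trans (*-congˡ (Φ-0 (D-additive i))) (zeroʳ _)) (sum-replicate-zero n)

  pairing-0ˡ : ∀ f → pairing 0# f ≈ 0#
  pairing-0ˡ f = trans (sum-cong-≋ λ i → trans (*-congʳ (Φ-0 (D-additive i))) (zeroˡ _)) (sum-replicate-zero n)

  -- The splits with `B` empty or all of `A` vanish because `S` of the empty set is 0. So `S` is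
  -- evaluated only on sets of at most `m` elements, which is what the strong induction in `S≈s` can
  -- supply.
  S-binomial : ∀ m {N} (A : Subset N) → card A ≡ suc m →
               (∀ {N} (B : Subset N) → card B ℕ.≤ m → S B ≈ s (card B)) →
               (m ℕ.+ m) · S A ≈ binomial (suc m) (λ k l → pairing (s k) (s l))
  S-binomial m {N} A eq S≈s = begin
    (m ℕ.+ m) · S A                                                                          ≈⟨ S-split m A eq ⟩
    ∑ (subsets N) (λ B → [ B ⊆? A ] pairing (S B) (S (A ─ B)))                               ≈⟨ ∑-cong (subsets N)
        (λ B → []-cong (B ⊆? A) (replace B)) ⟩
    ∑ (subsets N) (λ B → [ B ⊆? A ] pairing (s (card B)) (s (card (A ─ B))))                 ≈⟨ ∑-subsets A (λ k l → pairing (s k) (s l)) ⟩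
    binomial (card A) (λ k l → pairing (s k) (s l))                                          ≡⟨ cong
        (λ m → binomial m (λ k l → pairing (s k) (s l))) eq ⟩
    binomial (suc m) (λ k l → pairing (s k) (s l))                                           ∎
    where
    replace : ∀ B → B ⊆ A → pairing (S B) (S (A ─ B)) ≈ pairing (s (card B)) (s (card (A ─ B)))
    replace B B⊆A = cases (card B) (card (A ─ B)) ≡.refl ≡.refl (≡.trans (∣q∣+∣p─q∣≡∣p∣ A B B⊆A) eq)
      where
      s-0 : s 0 ≈ 0#
      s-0 = S-empty (⊤ {0}) ≡.refl
      cases : ∀ k l → card B ≡ k → card (A ─ B) ≡ l → k ℕ.+ l ≡ suc m → pairing (S B) (S (A ─ B)) ≈ pairing (s (card B)) (s (card (A ─ B)))
      cases zero l b≡ c≡ _ = trans (trans (pairing-cong (S-empty B b≡) refl) (pairing-0ˡ _))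
        (sym (trans (pairing-cong (trans (reflexive (cong s b≡)) s-0) refl) (pairing-0ˡ _)))
      cases (suc k) zero b≡ c≡ _ = trans (trans (pairing-cong refl (S-empty (A ─ B) c≡)) (pairing-0ʳ _))
        (sym (trans (pairing-cong refl (trans (reflexive (cong s c≡)) s-0)) (pairing-0ʳ _)))
      cases (suc k) (suc l) b≡ c≡ k+l≡ = pairing-cong
        (S≈s B (ℕ.≤-trans (ℕ.≤-reflexive b≡) (subst (suc k ℕ.≤_) (ℕ.suc-injective (≡.trans (≡.sym (ℕ.+-suc (suc k) l)) k+l≡)) (ℕ.m≤m+n (suc k) l))))
        (S≈s (A ─ B) (ℕ.≤-trans (ℕ.≤-reflexive c≡) (subst (suc l ℕ.≤_) (ℕ.suc-injective k+l≡) (ℕ.m≤n+m (suc l) k))))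

  -- From two vertices on, the recursion determines `S A` by smaller cardinalities, since its
  -- leading factor is then a positive integer and can be cancelled. For one vertex that factor is
  -- 0, so this case is computed directly.
  S≈s : ∀ m {N} (A : Subset N) → card A ≡ m → S A ≈ s m
  S≈s = <-rec (λ m → ∀ {N} (A : Subset N) → card A ≡ m → S A ≈ s m) step
    where
    step : ∀ m → (∀ {k} → k ℕ.< m → ∀ {N} (A : Subset N) → card A ≡ k → S A ≈ s k) → ∀ {N} (A : Subset N) → card A ≡ m → S A ≈ s m
    step zero          rec A eq = trans (S-empty A eq) (sym (S-empty (⊤ {0}) ≡.refl))
    step (suc zero)    rec A eq = trans (S-single A eq) (sym (S-single (⊤ {1}) ≡.refl))
    -- `suc (m ℕ.+ suc m)` is definitionally the factor `suc m ℕ.+ suc m` of the recursion.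
    step (suc (suc m)) rec A eq = ·-cancel (m ℕ.+ suc m) (trans (S-binomial (suc m) A eq smaller)
        (sym (S-binomial (suc m) (⊤ {suc (suc m)}) (Subset.∣⊤∣≡n (suc (suc m))) smaller)))
      where
      smaller : ∀ {N} (B : Subset N) → card B ℕ.≤ suc m → S B ≈ s (card B)
      smaller B B≤ = rec (s≤s B≤) B ≡.refl

  1/_! : ℕ → Carrier
  1/ zero !  = 1#
  1/ suc m ! = 1/suc m * 1/ m !

  !·1/! : ∀ m x → (m !) · (1/ m ! * x) ≈ x
  !·1/! zero    x = trans (+-identityʳ _) (*-identityˡ x)
  !·1/! (suc m) x = begin
    (suc m ℕ.* m !) · ((1/suc m * 1/ m !) * x)       ≡⟨ cong (_· ((1/suc m * 1/ m !) * x)) (ℕ.*-comm (suc m) (m !)) ⟩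
    (m ! ℕ.* suc m) · ((1/suc m * 1/ m !) * x)       ≈⟨ ×-assocˡ _ (m !) (suc m) ⟨
    (m !) · (suc m · ((1/suc m * 1/ m !) * x))       ≈⟨ ×-congʳ (m !) (trans (×-congʳ (suc m) (*-assoc _ _ _)) (·-1/suc m (1/ m ! * x))) ⟩
    (m !) · (1/ m ! * x)                             ≈⟨ !·1/! m x ⟩
    x                                                ∎

  !-cancel : ∀ m {x y} → (m !) · x ≈ (m !) · y → x ≈ y
  !-cancel m {x} {y} eq = trans (sym (1/!·! x)) (trans (*-congˡ eq) (1/!·! y))
    where
    1/!·! : ∀ x → 1/ m ! * ((m !) · x) ≈ x
    1/!·! x = trans (×-comm-* (m !) _ _) (!·1/! m x)

  q : ℕ → Carrier
  q m = 1/ m ! * s m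

  !·q : ∀ m → (m !) · q m ≈ s m
  !·q m = !·1/! m (s m)

  binomial-cong : ∀ m {h h′} → (∀ k l → h k l ≈ h′ k l) → binomial m h ≈ binomial m h′
  binomial-cong zero    eq = eq 0 0
  binomial-cong (suc m) eq = +-cong (binomial-cong m λ k l → eq (suc k) l) (binomial-cong m λ k l → eq k (suc l))

  -- Dividing by factorials turns a binomial sum into a Cauchy product, as for exponential
  -- generating functions. Pascal's rule on the left corresponds to `conv-shift` on the right.
  binomial-! : ∀ m h → binomial m (λ k l → (k !) · ((l !) · h k l)) ≈ (m !) · conv m h
  binomial-! zero    h = +-congʳ (+-identityʳ _)
  binomial-! (suc m) h = begin
    binomial m (λ k l → (suc k !) · ((l !) · h (suc k) l)) + binomial m (λ k l → (k !) · ((suc l !) · h k (suc l)))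
      ≈⟨ +-cong (binomial-cong m left) (binomial-cong m right) ⟩
    binomial m (λ k l → (k !) · ((l !) · (suc k · h (suc k) l))) + binomial m (λ k l → (k !) · ((l !) · (suc l · h k (suc l))))
      ≈⟨ +-cong (binomial-! m _) (binomial-! m _) ⟩
    (m !) · conv m (λ k l → suc k · h (suc k) l) + (m !) · conv m (λ k l → suc l · h k (suc l))
      ≈⟨ ×-distrib-+ _ _ (m !) ⟨
    (m !) · (conv m (λ k l → suc k · h (suc k) l) + conv m (λ k l → suc l · h k (suc l)))
      ≈⟨ ×-congʳ (m !) (conv-shift m h) ⟨
    (m !) · (suc m · conv (suc m) h)
      ≈⟨ ×-assocˡ _ (m !) (suc m) ⟩
    (m ! ℕ.* suc m) · conv (suc m) h
      ≡⟨ cong (_· conv (suc m) h) (ℕ.*-comm (m !) (suc m)) ⟩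
    (suc m !) · conv (suc m) h ∎
    where
    swap· : ∀ a b x → a · (b · x) ≈ b · (a · x)
    swap· a b x = trans (×-assocˡ x a b) (trans (reflexive (cong (_· x) (ℕ.*-comm a b))) (sym (×-assocˡ x b a)))
    left : ∀ k l → (suc k !) · ((l !) · h (suc k) l) ≈ (k !) · ((l !) · (suc k · h (suc k) l))
    left k l = trans (sym (×-assocˡ _ (suc k) (k !))) (trans (swap· (suc k) (k !) _) (×-congʳ (k !) (swap· (suc k) (l !) _)))
    right : ∀ k l → (k !) · ((suc l !) · h k (suc l)) ≈ (k !) · ((l !) · (suc l · h k (suc l)))
    right k l = ×-congʳ (k !) (trans (sym (×-assocˡ _ (suc l) (l !))) (swap· (suc l) (l !) _))

  pairing-· : ∀ a b f g → pairing (a · f) (b · g) ≈ a · (b · pairing f g)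
  pairing-· a b f g = begin
    sum (λ i → D i (a · f) * D i (b · g))     ≈⟨ sum-cong-≋ (λ i → *-cong (Φ-· (D-additive i) a f) (Φ-· (D-additive i) b g)) ⟩
    sum (λ i → (a · D i f) * (b · D i g))     ≈⟨ sum-cong-≋ {n}
        (λ i → trans (×-assoc-* a (D i f) (b · D i g)) (×-congʳ a (×-comm-* b (D i f) (D i g)))) ⟩
    sum (λ i → a · (b · (D i f * D i g)))     ≈⟨ Φ-sum (·-additive a) (λ i → b · (D i f * D i g)) ⟨
    a · sum (λ i → b · (D i f * D i g))       ≈⟨ ×-congʳ a (Φ-sum (·-additive b) (λ i → D i f * D i g)) ⟨
    a · (b · pairing f g)                     ∎

  q-0 : q 0 ≈ 0#
  q-0 = trans (*-identityˡ _) (S-empty (⊤ {0}) ≡.refl)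

  q-1 : q 1 ≈ P
  q-1 = !-cancel 1 (trans (!·q 1) (trans (S-single (⊤ {1}) ≡.refl) (sym (+-identityʳ P))))

  -- The recursion for m + 2 vertices divided by (m + 2)!. The extreme terms of the convolution
  -- vanish because `q 0` is 0, which shifts both indices by one.
  q-equation : ∀ m → (suc m ℕ.+ suc m) · q (suc (suc m)) ≈ conv m (λ k l → pairing (q (suc k)) (q (suc l)))
  q-equation m = !-cancel (suc (suc m)) (begin
    M! · ((suc m ℕ.+ suc m) · q (suc (suc m)))
      ≈⟨ trans (×-assocˡ _ M! (suc m ℕ.+ suc m)) (trans (reflexive (cong (_· q (suc (suc m))) (ℕ.*-comm M! (suc m ℕ.+ suc m))))
          (sym (×-assocˡ _ (suc m ℕ.+ suc m) M!))) ⟩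
    (suc m ℕ.+ suc m) · (M! · q (suc (suc m)))
      ≈⟨ ×-congʳ (suc m ℕ.+ suc m) (!·q (suc (suc m))) ⟩
    (suc m ℕ.+ suc m) · s (suc (suc m))
      ≈⟨ S-binomial (suc m) (⊤ {suc (suc m)}) (Subset.∣⊤∣≡n (suc (suc m))) (λ B _ → S≈s (card B) B ≡.refl) ⟩
    binomial (suc (suc m)) (λ k l → pairing (s k) (s l))
      ≈⟨ binomial-cong (suc (suc m)) (λ k l → trans (pairing-cong (sym (!·q k)) (sym (!·q l))) (pairing-· (k !) (l !) (q k) (q l))) ⟩
    binomial (suc (suc m)) (λ k l → (k !) · ((l !) · pairing (q k) (q l)))
      ≈⟨ binomial-! (suc (suc m)) (λ k l → pairing (q k) (q l)) ⟩
    M! · conv (suc (suc m)) (λ k l → pairing (q k) (q l))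
      ≈⟨ ×-congʳ M! ends ⟩
    M! · conv m (λ k l → pairing (q (suc k)) (q (suc l))) ∎)
    where
    M! : ℕ
    M! = suc (suc m) !
    ends : conv (suc (suc m)) (λ k l → pairing (q k) (q l)) ≈ conv m (λ k l → pairing (q (suc k)) (q (suc l)))
    ends = begin
      pairing (q 0) (q (suc (suc m))) + conv (suc m) (λ k l → pairing (q (suc k)) (q l))
        ≈⟨ +-cong (trans (pairing-cong q-0 refl) (pairing-0ˡ _)) (conv-last m (λ k l → pairing (q (suc k)) (q l))) ⟩
      0# + (conv m (λ k l → pairing (q (suc k)) (q (suc l))) + pairing (q (suc (suc m))) (q 0))
        ≈⟨ trans (+-identityˡ _) (trans (+-congˡ (trans (pairing-cong refl q-0) (pairing-0ʳ _))) (+-identityʳ _)) ⟩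
      conv m (λ k l → pairing (q (suc k)) (q (suc l))) ∎

  -- Differentiating the symmetric pairing gives two sums that `conv-comm` identifies; their common
  -- factor 2 cancels against the two orientations of an edge.
  D-q-equation : ∀ b j → suc b · D j (q (suc (suc b))) ≈ conv b (λ k l → sum (λ i → D i (q (suc k)) * D i (D j (q (suc l)))))
  D-q-equation b j = ·-cancel 1 (begin
    2 · (suc b · D j Q)
      ≈⟨ +-congˡ (+-identityʳ _) ⟩
    suc b · D j Q + suc b · D j Q
      ≈⟨ ×-homo-+ _ (suc b) (suc b) ⟨
    (suc b ℕ.+ suc b) · D j Q
      ≈⟨ Φ-· (D-additive j) (suc b ℕ.+ suc b) Q ⟨
    D j ((suc b ℕ.+ suc b) · Q)
      ≈⟨ D-cong j (q-equation b) ⟩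
    D j (conv b (λ k l → pairing (q (suc k)) (q (suc l))))
      ≈⟨ trans (Φ-conv (D-additive j) b _) (conv-cong b λ k l → D-pairing (q (suc k)) (q (suc l))) ⟩
    conv b (λ k l → mixed (q (suc l)) (q (suc k)) + mixed (q (suc k)) (q (suc l)))
      ≈⟨ conv-∙ b _ _ ⟩
    conv b (λ k l → mixed (q (suc l)) (q (suc k))) + C
      ≈⟨ +-cong (conv-comm b (λ k l → mixed (q (suc l)) (q (suc k)))) (sym (+-identityʳ C)) ⟩
    2 · C ∎)
    where
    Q : Carrier
    Q = q (suc (suc b))
    mixed : Carrier → Carrier → Carrier
    mixed f g = sum (λ i → D i f * D i (D j g))
    C : Carrier
    C = conv b (λ k l → mixed (q (suc k)) (q (suc l)))
    D-pairing : ∀ f g → D j (pairing f g) ≈ mixed g f + mixed f g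
    D-pairing f g = begin
      D j (sum λ i → D i f * D i g)
        ≈⟨ Φ-sum (D-additive j) (λ i → D i f * D i g) ⟩
      sum (λ i → D j (D i f * D i g))
        ≈⟨ sum-cong-≋ (λ i → trans (D-* j _ _) (+-cong (trans (*-congʳ (D-comm j i f)) (*-comm _ _)) (*-congˡ (D-comm j i g)))) ⟩
      sum (λ i → D i g * D i (D j f) + D i f * D i (D j g))
        ≈⟨ ∑-distrib-+ (λ i → D i g * D i (D j f)) (λ i → D i f * D i (D j g)) ⟩
      mixed g f + mixed f g ∎

-- Trees as acyclic connected graphs

module _ {V : Set} {R : Rel V 0ℓ} where

  -- The list holds all vertices after the start, the last one included. Once the path is closed up,
  -- this is the format of the walk in `IsCycle`.
  data Path : V → List V → V → Set where
    []  : ∀ {x} → Path x [] x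
    _∷_ : ∀ {x y z ws} → R x z → Path z ws y → Path x (z ∷ ws) y

  module _ (_≟ⱽ_ : (x y : V) → Dec (x ≡ y)) where
    open DecMembership _≟ⱽ_ using () renaming (_∈?_ to _∈ˡ?_)

    suffix : ∀ {x y z ws} → Path z ws y → Unique (z ∷ ws) → x ∈ z ∷ ws → ∃[ ws′ ] Path x ws′ y × Unique (x ∷ ws′)
    suffix p        u          (here ≡.refl) = _ , p , u
    suffix (r ∷ rs) (_ ∷ u)    (there x∈)    = suffix rs u x∈

    -- Loop erasure: if the new start already lies on the simple path found so far, only the part
    -- from there on is kept.
    simplePath : ∀ {x y} → Star R x y → ∃[ ws ] Path x ws y × Unique (x ∷ ws)
    simplePath ε⋆ = [] , [] , ([] ∷ [])
    simplePath {x} (_◅_ {j = z} r rs) with ws , p , u ← simplePath rs with x ∈ˡ? z ∷ ws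
    ... | yes x∈ = suffix p u x∈
    ... | no x∉  = z ∷ ws , r ∷ p , (All.¬Any⇒All¬ (z ∷ ws) x∉ ∷ u)

-- A cycle v, w, w′, ... contains a walk from w back to v that avoids the edge {v, w}, against
-- `bridge`.
toTree : ∀ {N} (M : Mat N) → TreeOn ⊤ M → Tree
toTree {N} M tree = record
  { graph = record { order = N ; adj = entry M ; symmetric = symmetric ; irreflexive = λ { ≡.refl a → irreflexive a ≡.refl } }
  ; nonEmpty = nonZero (proj₁ nonempty)
  ; connected = λ _ _ → connected Subset.∈⊤ Subset.∈⊤
  ; acyclic = acyclic }
  where
  open TreeOn tree
  nonZero : ∀ {N} → Fin N → NonZero N
  nonZero {suc N} _ = _
  module _ {v w : Fin N} where
    walk : ∀ b zs → All (λ z → z ≢ v × z ≢ w) (b ∷ zs) → Linked (Adj M) (b ∷ (zs ∷ʳ v)) → Star (Without M v w) b v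
    walk b [] ((b≢v , b≢w) ∷ []) (a ∷ [-]) = (a , λ { (inj₁ (b≡v , _)) → b≢v b≡v ; (inj₂ (b≡w , _)) → b≢w b≡w }) ◅ ε⋆
    walk b (c ∷ zs) ((b≢v , b≢w) ∷ ≢s) (a ∷ as) = (a , λ { (inj₁ (b≡v , _)) → b≢v b≡v ; (inj₂ (b≡w , _)) → b≢w b≡w }) ◅ walk c zs ≢s as
  acyclic : ∀ v ws → ¬ Graph.IsCycle _ v ws
  acyclic v ws record { long = long ; closed = closed ; distinct = distinct } = cycle ws long closed distinct
    where
    cycle : ∀ ws → 2 ℕ.≤ length ws → Linked (Adj M) (v ∷ (ws ∷ʳ v)) → Unique (v ∷ ws) → ⊥
    cycle (w ∷ w′ ∷ ws) _ (vw ∷ ww′ ∷ as) ((v≢w ∷ v≢w′ ∷ v≢ws) ∷ (w≢w′ ∷ w≢ws) ∷ _) =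
      bridge vw (Star.reverse without-sym
        -- Only this step starts at w itself, and it differs from the edge {v, w} because w′ ≠ v.
        -- All later steps start outside {v, w}, as `walk` requires.
        ((ww′ , λ { (inj₁ (w≡v , _)) → v≢w (≡.sym w≡v) ; (inj₂ (_ , w′≡v)) → v≢w′ (≡.sym w′≡v) }) ◅
          walk w′ ws (((v≢w′ ∘ ≡.sym) , (w≢w′ ∘ ≡.sym)) ∷ All.zipWith (λ (v≢ , w≢) → (v≢ ∘ ≡.sym) , (w≢ ∘ ≡.sym)) (v≢ws , w≢ws)) as))
    cycle (w ∷ []) (s≤s ()) _ _

-- A bypass of an edge, made simple, closes up with that edge to a cycle. It is long enough: an
-- empty bypass would make the edge a loop, and a bypass of one step would be the excluded edge.
fromTree : (t : Tree) → TreeOn ⊤ (mat (Tree.adj t))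
fromTree t = record
  { symmetric = ⁺ ∘ Tree.symmetric t ∘ ⁻
  ; supported = λ _ → Subset.∈⊤
  ; nonempty  = vertex (Tree.nonEmpty t) , Subset.∈⊤
  ; connected = λ {x} {y} _ _ → Star.map ⁺ (connected x y)
  ; bridge    = λ a p → no-bypass (⁻ a) (Star.map (λ (b , ¬j) → ⁻ b , ¬j) p)
  }
  where
  open Tree t hiding (symmetric)
  ⁺ : ∀ {x y} → x ~ y → Adj (mat adj) x y
  ⁺ {x} {y} = subst T (≡.sym (entry-mat adj x y))
  ⁻ : ∀ {x y} → Adj (mat adj) x y → x ~ y
  ⁻ {x} {y} = subst T (entry-mat adj x y)
  vertex : ∀ {N} → NonZero N → Fin N
  vertex {suc N} _ = zero
  close : ∀ {R : Rel Vertex 0ℓ} → (∀ {x y} → R x y → x ~ y) → ∀ {a y x ws} → Path {R = R} a ws y → y ~ x → Linked _~_ (a ∷ (ws ∷ʳ x))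
  close R⇒~ []       yx = yx ∷ [-]
  close R⇒~ (r ∷ rs) yx = R⇒~ r ∷ close R⇒~ rs yx
  no-bypass : ∀ {x y} → x ~ y → ¬ Star (λ a b → a ~ b × ¬ Joins x y a b) x y
  no-bypass {x} {y} xy p with simplePath _≟_ p
  ... | []         , []     , _ = irreflexive ≡.refl xy
  ... | z ∷ []     , r ∷ [] , _ = proj₂ r (inj₁ (≡.refl , ≡.refl))
  ... | z ∷ w ∷ ws , path   , distinct = acyclic x (z ∷ w ∷ ws) record
    { distinct = distinct ; closed = close proj₁ path (Tree.symmetric t xy) ; long = s≤s (s≤s z≤n) }

pullback : ∀ {N} {M : Mat N} (f : Fin N → Fin N) → Bijective _≡_ _≡_ f → TreeOn ⊤ M → TreeOn ⊤ (mat λ u v → entry M (f u) (f v))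
pullback {N} {M} f (inj , surj) tree = record
  { symmetric = ⁺ ∘ symmetric ∘ ⁻
  ; supported = λ _ → Subset.∈⊤
  ; nonempty  = proj₁ nonempty , Subset.∈⊤
  ; connected = λ {x} {y} _ _ → subst₂ (f⁻¹∘f x) (f⁻¹∘f y) (Star.gmap f⁻¹ lift (connected {f x} {f y} Subset.∈⊤ Subset.∈⊤))
  ; bridge    = λ a p → bridge (⁻ a) (Star.gmap f (λ (b , ¬j) → ⁻ b , λ
      { (inj₁ (p , q)) → ¬j (inj₁ (inj p , inj q)) ; (inj₂ (p , q)) → ¬j (inj₂ (inj p , inj q)) }) p)
  }
  where
  open TreeOn tree
  M′ : Mat N
  M′ = mat λ u v → entry M (f u) (f v)
  ⁺ : ∀ {x y} → Adj M (f x) (f y) → Adj M′ x y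
  ⁺ {x} {y} = subst T (≡.sym (entry-mat (λ u v → entry M (f u) (f v)) x y))
  ⁻ : ∀ {x y} → Adj M′ x y → Adj M (f x) (f y)
  ⁻ {x} {y} = subst T (entry-mat (λ u v → entry M (f u) (f v)) x y)
  f⁻¹ : Fin N → Fin N
  f⁻¹ = proj₁ ∘ surj
  f∘f⁻¹ : ∀ x → f (f⁻¹ x) ≡ x
  f∘f⁻¹ x = proj₂ (surj x) ≡.refl
  f⁻¹∘f : ∀ x → f⁻¹ (f x) ≡ x
  f⁻¹∘f x = inj (f∘f⁻¹ (f x))
  lift : ∀ {x y} → Adj M x y → Adj M′ (f⁻¹ x) (f⁻¹ y)
  lift {x} {y} a = ⁺ (≡.subst₂ (Adj M) (≡.sym (f∘f⁻¹ x)) (≡.sym (f∘f⁻¹ y)) a)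
  subst₂ : ∀ {a a′ b b′} → a ≡ a′ → b ≡ b′ → Star (Adj M′) a b → Star (Adj M′) a′ b′
  subst₂ ≡.refl ≡.refl p = p

-- Sums over labelings

incident? : ∀ {N} (es : List (Fin N × Fin N)) (v : Fin N) (e : Fin (length es)) →
            Dec (v ≡ proj₁ (List.lookup es e) ⊎ v ≡ proj₂ (List.lookup es e))
incident? es v e = (v ≟ proj₁ (List.lookup es e)) ⊎-dec (v ≟ proj₂ (List.lookup es e))

incidentTo : ∀ {N} (es : List (Fin N × Fin N)) → Fin N → List (Fin (length es))
incidentTo es v = filter (incident? es v) (allFin (length es))

filter-map : ∀ {a b p} {A : Set a} {B : Set b} {P : B → Set p} (P? : ∀ x → Dec (P x)) (f : A → B) xs →
             filter P? (map f xs) ≡ map f (filter (P? ∘ f) xs)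
filter-map P? f []       = ≡.refl
filter-map P? f (x ∷ xs) with does (P? (f x))
... | true  = cong (f x ∷_) (filter-map P? f xs)
... | false = filter-map P? f xs

filter-allFin-suc : ∀ {m p} {P : Fin (suc m) → Set p} (P? : ∀ x → Dec (P x)) →
                    filter P? (List.tabulate suc) ≡ map suc (filter (P? ∘ suc) (allFin m))
filter-allFin-suc {m} P? = ≡.trans (cong (filter P?) (≡.sym (List.map-tabulate id suc))) (filter-map P? suc (allFin m))

edgesOf-distinct : ∀ {N} (adj : Fin N → Fin N → Bool) → All (λ e → proj₁ e ≢ proj₂ e) (EdgeList.edgesOf adj)
edgesOf-distinct adj = All.tabulate λ e∈ eq → Fin.<-irrefl eq (proj₁ (EdgeList.∈-edgesOf⁻ adj e∈))

_×²_ : ∀ {a b} {A : Set a} {B : Set b} → (A → B) → A × A → B × B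
f ×² (x , y) = f x , f y

module FinFunSum {c ℓ} (M : CommutativeMonoid c ℓ) where
  open CommutativeMonoid M
  open import Algebra.Properties.CommutativeMonoid.Sum M using (sum; sum-cong-≋)
  open ListSum M
  open import Relation.Binary.Reasoning.Setoid setoid

  sum-combine : ∀ m p (h : Fin (m ℕ.* p) → Carrier) → sum h ≈ sum {m} (λ i → sum {p} (λ k → h (combine i k)))
  sum-combine m p h = begin
    sum h
      ≡⟨ ∑-allFin h ⟨
    ∑ (allFin (m ℕ.* p)) h
      ≈⟨ ∑-bijection (uncurry combine) (remQuot p) (Unique.cartesianProduct⁺ (Unique.allFin⁺ m) (Unique.allFin⁺ p)) (Unique.allFin⁺ (m ℕ.* p))
           (λ {x} _ → List∈.∈-allFin _ , Fin.remQuot-combine (proj₁ x) (proj₂ x))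
           (λ {y} _ → List∈.∈-cartesianProduct⁺ (List∈.∈-allFin _) (List∈.∈-allFin _) , Fin.combine-remQuot {m} p y) h ⟨
    ∑ (cartesianProduct (allFin m) (allFin p)) (uncurry h′)
      ≈⟨ ∑-cartesianProduct (allFin m) (allFin p) (uncurry h′) ⟩
    ∑ (allFin m) (λ i → ∑ (allFin p) (h′ i))
      ≡⟨ ∑-allFin {n = m} (λ i → ∑ (allFin p) (h′ i)) ⟩
    sum (λ i → ∑ (allFin p) (h′ i))
      ≈⟨ sum-cong-≋ {m} (λ i → reflexive (∑-allFin (h′ i))) ⟩
    sum (λ i → sum (h′ i)) ∎
    where
    h′ : Fin m → Fin p → Carrier
    h′ i k = h (combine i k)

  extend : ∀ {m p} → Fin m → (Fin p → Fin m) → Fin (suc p) → Fin m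
  extend i f zero    = i
  extend i f (suc j) = f j

  finToFun-combine : ∀ {m p} (i : Fin m) (k : Fin (m ℕ.^ p)) → finToFun {m} {suc p} (combine i k) ≗ extend i (finToFun k)
  finToFun-combine {m} {p} i k zero    = cong proj₁ (Fin.remQuot-combine i k)
  finToFun-combine {m} {p} i k (suc j) = cong (λ r → finToFun (proj₂ r) j) (Fin.remQuot-combine i k)

  -- `h` has to respect `_≗_` because decoding a combined code agrees with `extend` only pointwise.
  sum-finToFun : ∀ m p (h : (Fin (suc p) → Fin m) → Carrier) → (∀ {f g} → f ≗ g → h f ≈ h g) →
                 sum {m ℕ.^ suc p} (λ k → h (finToFun k)) ≈ sum {m} (λ i → sum {m ℕ.^ p} (λ k → h (extend i (finToFun k))))
  sum-finToFun m p h h-cong = trans (sum-combine m (m ℕ.^ p) (λ k → h (finToFun k)))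
      (sum-cong-≋ {m} λ i → sum-cong-≋ {m ℕ.^ p} λ k → h-cong (finToFun-combine i k))

module Labelings {c ℓ n} (𝔸 : DifferentialAlgebra c ℓ n) where
  open DifferentialAlgebraProperties 𝔸
  open Weights 𝔸
  open FinFunSum +-commutativeMonoid
  open import Algebra.Properties.CommutativeMonoid.Sum *-commutativeMonoid using ()
    renaming (sum to Π; sum-cong-≋ to Π-cong)
  open import Relation.Binary.Reasoning.Setoid setoid

  private
    variable
      N N′ : ℕ

  derive : ∀ {E : Set} → (E → Fin n) → List E → Carrier → Carrier
  derive l es f = foldr (λ e → D (l e)) f es

  derive-label : ∀ {E : Set} {l l′ : E → Fin n} → l ≗ l′ → ∀ es f → derive l es f ≡ derive l′ es f
  derive-label eq []       f = ≡.refl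
  derive-label eq (e ∷ es) f = cong₂ D (eq e) (derive-label eq es f)

  derive-map : ∀ {E E′ : Set} (l : E′ → Fin n) (g : E → E′) es f → derive l (map g es) f ≡ derive (l ∘ g) es f
  derive-map l g []       f = ≡.refl
  derive-map l g (e ∷ es) f = cong (D (l (g e))) (derive-map l g es f)

  derive-D : ∀ {E : Set} (l : E → Fin n) i es f → D i (derive l es f) ≈ derive l es (D i f)
  derive-D l i []       f = refl
  derive-D l i (e ∷ es) f = trans (D-comm i (l e) _) (D-cong (l e) (derive-D l i es f))

  -- The summand of `𝒬` for one labeling, with an arbitrary state in place of `P` so that edges can
  -- be removed one at a time.
  labeled : (es : List (Fin N × Fin N)) → State N → (Fin (length es) → Fin n) → Carrier
  labeled es s l = Π λ v → derive l (incidentTo es v) (s v)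

  -- The label of the first edge acts once at each end. A loop would be listed once by `incidentTo`
  -- but differentiate twice on the right, hence `u ≢ v`.
  labeled-∷ : ∀ {u v : Fin N} es s i l → u ≢ v → labeled ((u , v) ∷ es) s (extend i l) ≈ labeled es (∂ i u (∂ i v s)) l
  labeled-∷ {u = u} {v} es s i l u≢v = Π-cong at
    where
    later : ∀ w → filter (incident? ((u , v) ∷ es) w) (List.tabulate suc) ≡ map suc (incidentTo es w)
    later w = filter-allFin-suc (incident? ((u , v) ∷ es) w)
    derive-later : ∀ w f → derive (extend i l) (filter (incident? ((u , v) ∷ es) w) (List.tabulate suc)) f ≡ derive l (incidentTo es w) f
    derive-later w f = ≡.trans (cong (λ xs → derive (extend i l) xs f) (later w)) (derive-map (extend i l) suc (incidentTo es w) f)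
    at : ∀ w → derive (extend i l) (incidentTo ((u , v) ∷ es) w) (s w) ≈ derive l (incidentTo es w) (∂ i u (∂ i v s) w)
    at w with w ≟ u | w ≟ v
    ... | yes ≡.refl | yes ≡.refl = contradiction ≡.refl u≢v
    ... | yes _ | no _  = trans (D-cong i (reflexive (derive-later w (s w)))) (derive-D l i (incidentTo es w) (s w))
    ... | no _  | yes _ = trans (D-cong i (reflexive (derive-later w (s w)))) (derive-D l i (incidentTo es w) (s w))
    ... | no _  | no _  = reflexive (derive-later w (s w))

  sum-labeled : ∀ (es : List (Fin N × Fin N)) s → All (λ e → proj₁ e ≢ proj₂ e) es →
                sum {n ℕ.^ length es} (λ k → labeled es s (finToFun k)) ≈ L es s
  sum-labeled []             s []           = +-identityʳ _
  sum-labeled ((u , v) ∷ es) s (u≢v ∷ ≢s) = begin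
    sum {n ℕ.^ length ((u , v) ∷ es)} (λ k → labeled ((u , v) ∷ es) s (finToFun k))
      ≈⟨ sum-finToFun n (length es) (labeled ((u , v) ∷ es) s) (λ eq → Π-cong λ w → reflexive (derive-label eq (incidentTo ((u , v) ∷ es) w) (s w))) ⟩
    sum (λ i → sum {n ℕ.^ length es} (λ k → labeled ((u , v) ∷ es) s (extend i (finToFun k))))
      ≈⟨ sum-cong-≋ (λ i → sum-cong-≋ {n ℕ.^ length es} λ k → labeled-∷ es s i (finToFun k) u≢v) ⟩
    sum (λ i → sum {n ℕ.^ length es} (λ k → labeled es (∂ i u (∂ i v s)) (finToFun k)))
      ≈⟨ sum-cong-≋ (λ i → sum-labeled es (∂ i u (∂ i v s)) ≢s) ⟩
    L ((u , v) ∷ es) s ∎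

  ∂-rename : (f : Fin N → Fin N′) → Injective _≡_ _≡_ f → ∀ i u s → ∂ i (f u) s ∘ f ≋ ∂ i u (s ∘ f)
  ∂-rename f inj i u s v with f v ≟ f u | v ≟ u
  ... | yes _     | yes _   = refl
  ... | no _      | no _    = refl
  ... | yes fv≡fu | no v≢u  = contradiction (inj fv≡fu) v≢u
  ... | no fv≢fu  | yes v≡u = contradiction (cong f v≡u) fv≢fu

  Π-rename : (f : Fin N → Fin N′) → Bijective _≡_ _≡_ f → ∀ s → Π s ≈ Π (s ∘ f)
  Π-rename {N} {N′} f (inj , surj) s = sym (begin
    Π (s ∘ f)                    ≡⟨ Product.∑-allFin (s ∘ f) ⟨
    Product.∑ (allFin N) (s ∘ f) ≈⟨ Product.∑-bijection f (proj₁ ∘ surj) (Unique.allFin⁺ N) (Unique.allFin⁺ N′)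
                                      (λ {x} _ → List∈.∈-allFin _ , inj (proj₂ (surj (f x)) ≡.refl))
                                      (λ {y} _ → List∈.∈-allFin _ , proj₂ (surj y) ≡.refl) s ⟩
    Product.∑ (allFin N′) s      ≡⟨ Product.∑-allFin s ⟩
    Π s                          ∎)
    where module Product = ListSum *-commutativeMonoid

  L-rename : (f : Fin N → Fin N′) → Bijective _≡_ _≡_ f → ∀ es s → L (map (f ×²_) es) s ≈ L es (s ∘ f)
  L-rename f bij []             s = Π-rename f bij s
  L-rename f bij ((u , v) ∷ es) s = sum-cong-≋ λ i → begin
    L (map (f ×²_) es) (∂ i (f u) (∂ i (f v) s))  ≈⟨ L-rename f bij es (∂ i (f u) (∂ i (f v) s)) ⟩
    L es (∂ i (f u) (∂ i (f v) s) ∘ f)            ≈⟨ L-cong es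
        (λ w → trans (∂-rename f (proj₁ bij) i u (∂ i (f v) s) w) (∂-cong i u (∂-rename f (proj₁ bij) i v s) w)) ⟩
    L es (∂ i u (∂ i v (s ∘ f)))                  ∎

  L-map-ordered : ∀ (es : List (Fin N × Fin N)) s → L (map ordered es) s ≈ L es s
  L-map-ordered []             s = refl
  L-map-ordered ((u , v) ∷ es) s = trans (L-ordered u v (map ordered es) s) (sum-cong-≋ λ i → L-map-ordered es (∂ i u (∂ i v s)))

  module _ {adj : Fin N → Fin N → Bool} {adj′ : Fin N′ → Fin N′ → Bool}
           (symmetric′ : ∀ {x y} → T (adj′ x y) → T (adj′ y x)) (symmetric : ∀ {x y} → T (adj x y) → T (adj y x))
           (f : Fin N → Fin N′) (bij : Bijective _≡_ _≡_ f) (resp : ∀ u v → adj u v ≡ adj′ (f u) (f v)) where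
    open EdgeList

    private
      f⁻¹ : Fin N′ → Fin N
      f⁻¹ = proj₁ ∘ proj₂ bij
      f∘f⁻¹ : ∀ x → f (f⁻¹ x) ≡ x
      f∘f⁻¹ x = proj₂ (proj₂ bij x) ≡.refl
      f⁻¹∘f : ∀ x → f⁻¹ (f x) ≡ x
      f⁻¹∘f x = proj₁ bij (f∘f⁻¹ (f x))

      ∈-ordered-edges : ∀ {m} {adj : Fin m → Fin m → Bool} → (∀ {x y} → T (adj x y) → T (adj y x)) → ∀ {x y} → x ≢ y → T
          (adj x y) → ordered (x , y) ∈ edgesOf adj
      ∈-ordered-edges {adj = adj} sym′ {x} {y} x≢y a with x <? y
      ... | yes x<y = ∈-edgesOf⁺ adj x<y a
      ... | no x≮y with Fin.<-cmp x y
      ... | tri< x<y _ _ = contradiction x<y x≮y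
      ... | tri≈ _ x≡y _ = contradiction x≡y x≢y
      ... | tri> _ _ y<x = ∈-edgesOf⁺ adj y<x (sym′ a)

      ordered-ordered : ∀ {m m′} (h : Fin m → Fin m′) {x y} → h x ≢ h y → ordered (h ×² ordered (x , y)) ≡ ordered (h x , h y)
      ordered-ordered h {x} {y} ≢ with x <? y
      ... | yes _ = ≡.refl
      ... | no _  = ordered-swap (h y) (h x) (≢ ∘ ≡.sym)

      round : ∀ {m m′} (h : Fin m → Fin m′) (h′ : Fin m′ → Fin m) → (∀ x → h′ (h x) ≡ x) → ∀ {x y} → x <ᶠ y → ordered
          (h′ ×² ordered (h x , h y)) ≡ (x , y)
      round h h′ inv {x} {y} x<y = ≡.trans (ordered-ordered h′ λ eq → Fin.<-irrefl (≡.trans (≡.sym (inv x)) (≡.trans eq (inv y))) x<y)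
        (≡.trans (cong₂ (λ a b → ordered (a , b)) (inv x) (inv y)) (ordered-< x<y))

    -- A bijection need not be monotone, so the image of a listed edge is put back into increasing
    -- order.
    edges-rename : map (ordered ∘ (f ×²_)) (edgesOf adj) ↭ edgesOf adj′
    edges-rename = bijection⇒↭ (ordered ∘ (f ×²_)) (ordered ∘ (f⁻¹ ×²_)) (edgesOf! adj) (edgesOf! adj′) to from
      where
      to : ∀ {e} → e ∈ edgesOf adj → ordered (f ×² e) ∈ edgesOf adj′ × ordered (f⁻¹ ×² ordered (f ×² e)) ≡ e
      to {x , y} e∈ with x<y , a ← ∈-edgesOf⁻ adj e∈ =
        ∈-ordered-edges {adj = adj′} symmetric′ (λ eq → Fin.<-irrefl (proj₁ bij eq) x<y) (subst T (resp x y) a) , round f f⁻¹ f⁻¹∘f x<y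
      from : ∀ {e} → e ∈ edgesOf adj′ → ordered (f⁻¹ ×² e) ∈ edgesOf adj × ordered (f ×² ordered (f⁻¹ ×² e)) ≡ e
      from {x , y} e∈ with x<y , a ← ∈-edgesOf⁻ adj′ e∈ =
        ∈-ordered-edges {adj = adj} symmetric (λ eq → Fin.<-irrefl (≡.trans (≡.sym (f∘f⁻¹ x)) (≡.trans (cong f eq) (f∘f⁻¹ y))) x<y)
          (subst T (≡.sym (≡.trans (resp (f⁻¹ x) (f⁻¹ y)) (cong₂ adj′ (f∘f⁻¹ x) (f∘f⁻¹ y)))) a) , round f⁻¹ f f∘f⁻¹ x<y

    L-isomorphic : ∀ s → L (edgesOf adj) (s ∘ f) ≈ L (edgesOf adj′) s
    L-isomorphic s = begin
      L (edgesOf adj) (s ∘ f)                          ≈⟨ L-rename f bij (edgesOf adj) s ⟨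
      L (map (f ×²_) (edgesOf adj)) s                  ≈⟨ L-map-ordered (map (f ×²_) (edgesOf adj)) s ⟨
      L (map ordered (map (f ×²_) (edgesOf adj))) s    ≡⟨ cong (λ es → L es s) (List.map-∘ (edgesOf adj)) ⟨
      L (map (ordered ∘ (f ×²_)) (edgesOf adj)) s      ≈⟨ L-↭ edges-rename s ⟩
      L (edgesOf adj′) s                               ∎

-- Counting isomorphisms

module ℕ∑ = ListSum ℕ.+-0-commutativeMonoid
open ℕ∑ using () renaming (∑ to ∑ⁿ; [_]_ to ⟦_⟧_)

∑ⁿ-1 : ∀ {a} {A : Set a} (xs : List A) → ∑ⁿ xs (λ _ → 1) ≡ length xs
∑ⁿ-1 []       = ≡.refl
∑ⁿ-1 (_ ∷ xs) = cong suc (∑ⁿ-1 xs)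

length-filter : ∀ {a p} {A : Set a} {P : A → Set p} (P? : ∀ x → Dec (P x)) xs → length (filter P? xs) ≡ ∑ⁿ xs (λ x → ⟦ P? x ⟧ 1)
length-filter P? xs = ≡.trans (≡.sym (∑ⁿ-1 (filter P? xs))) (ℕ∑.∑-filter P? xs (λ _ → 1))

length-bijection : ∀ {a b} {A : Set a} {B : Set b} {xs : List A} {ys : List B} (f : A → B) (g : B → A) → Unique xs → Unique ys →
                   (∀ {x} → x ∈ xs → f x ∈ ys × g (f x) ≡ x) → (∀ {y} → y ∈ ys → g y ∈ xs × f (g y) ≡ y) → length xs ≡ length ys
length-bijection {xs = xs} f g xs! ys! fwd bwd = ≡.trans (≡.sym (List.length-map f xs)) (Perm.↭-length (bijection⇒↭ f g xs! ys! fwd bwd))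

module _ {m p : ℕ} where

  Inj : (Fin p → Fin m) → Set
  Inj = Injective _≡_ _≡_

  injective? : (f : Fin p → Fin m) → Dec (Inj f)
  injective? f = map′ (λ inj {x} {y} → inj x y) (λ inj x y → inj {x} {y}) (all? λ x → all? λ y → (f x ≟ f y) →-dec (x ≟ y))

  Image : (Fin p → Fin m) → Fin m → Set
  Image f i = ∃[ j ] f j ≡ i

  image? : ∀ f i → Dec (Image f i)
  image? f i = any? λ j → f j ≟ i

  image-size : (f : Fin p → Fin m) → Inj f → length (filter (image? f) (allFin m)) ≡ p
  image-size f inj = ≡.trans (≡.sym (Perm.↭-length (unique∧set⇒↭ (Unique.map⁺ inj (Unique.allFin⁺ p))
      (Unique.filter⁺ (image? f) (Unique.allFin⁺ m)) to from)))
    (≡.trans (List.length-map f (allFin p)) (List.length-tabulate id))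
    where
    to : ∀ {i} → i ∈ map f (allFin p) → i ∈ filter (image? f) (allFin m)
    to i∈ with j , _ , ≡.refl ← List∈.∈-map⁻ f i∈ = List∈.∈-filter⁺ (image? f) (List∈.∈-allFin _) (j , ≡.refl)
    from : ∀ {i} → i ∈ filter (image? f) (allFin m) → i ∈ map f (allFin p)
    from i∈ with j , ≡.refl ← proj₂ (List∈.∈-filter⁻ (image? f) {xs = allFin m} i∈) = List∈.∈-map⁺ f (List∈.∈-allFin j)

  complement-size : (f : Fin p → Fin m) → Inj f → ∑ⁿ (allFin m) (λ i → ⟦ ¬? (image? f i) ⟧ 1) ≡ m ∸ p
  complement-size f inj = begin
    out                    ≡⟨ ℕ.m+n∸m≡n p out ⟨
    p ℕ.+ out ∸ p          ≡⟨ cong (λ k → k ℕ.+ out ∸ p) (≡.trans (≡.sym (image-size f inj)) (length-filter (image? f) (allFin m))) ⟩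
    inn ℕ.+ out ∸ p        ≡⟨ cong (_∸ p) total ⟩
    m ∸ p                  ∎
    where
    open ≡.≡-Reasoning
    inn out : ℕ
    inn = ∑ⁿ (allFin m) (λ i → ⟦ image? f i ⟧ 1)
    out = ∑ⁿ (allFin m) (λ i → ⟦ ¬? (image? f i) ⟧ 1)
    one : ∀ i → ⟦ image? f i ⟧ 1 ℕ.+ ⟦ ¬? (image? f i) ⟧ 1 ≡ 1
    one i with image? f i
    ... | yes _ = ≡.refl
    ... | no _  = ≡.refl
    total : inn ℕ.+ out ≡ m
    total = ≡.trans (≡.sym (ℕ∑.∑-∙ (allFin m) _ _)) (≡.trans (ℕ∑.∑-cong (allFin m) one) (≡.trans (∑ⁿ-1 (allFin m)) (List.length-tabulate id)))

injective⇒bijective : ∀ {N} (f : Fin N → Fin N) → Injective _≡_ _≡_ f → Bijective _≡_ _≡_ f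
injective⇒bijective {N} f inj = inj , λ y → let (x , fx≡y) = hit y in x , λ { ≡.refl → fx≡y }
  where
  all-hit : filter (image? f) (allFin N) ≡ allFin N
  all-hit = List.filter-complete (image? f) (≡.trans (image-size f inj) (≡.sym (List.length-tabulate id)))
  hit : ∀ y → Image f y
  hit y = proj₂ (List∈.∈-filter⁻ (image? f) {xs = allFin N} (subst (y ∈_) (≡.sym all-hit) (List∈.∈-allFin y)))

module _ where
  open FinFunSum ℕ.+-0-commutativeMonoid
  open import Algebra.Properties.CommutativeMonoid.Sum ℕ.+-0-commutativeMonoid using (sum; sum-cong-≋; ∑-comm)
  open import Algebra.Properties.Semiring.Sum ℕ.+-*-semiring using (*-distribʳ-sum)

  injections : ℕ → ℕ → ℕ
  injections m p = sum {m ℕ.^ p} λ k → ⟦ injective? {m} {p} (finToFun k) ⟧ 1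

  -- An injective map extends by exactly the m ∸ p values outside its image.
  injections-suc : ∀ m p → injections m (suc p) ≡ injections m p ℕ.* (m ∸ p)
  injections-suc m p = begin
    injections m (suc p)
      ≡⟨ sum-finToFun m p (λ f → ⟦ injective? f ⟧ 1) (λ {f} {g} eq → ℕ∑.[]-⇔ (injective? f) (injective? g)
           (λ inj p → inj (≡.trans (eq _) (≡.trans p (≡.sym (eq _))))) (λ inj p → inj (≡.trans (≡.sym (eq _)) (≡.trans p (eq _))))) ⟩
    sum {m} (λ i → sum {m ℕ.^ p} (λ k → ⟦ injective? (extend i (fun k)) ⟧ 1))
      ≡⟨ ∑-comm {m} {m ℕ.^ p} (λ i k → ⟦ injective? (extend i (fun k)) ⟧ 1) ⟩
    sum {m ℕ.^ p} (λ k → sum {m} (λ i → ⟦ injective? (extend i (fun k)) ⟧ 1))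
      ≡⟨ sum-cong-≋ {m ℕ.^ p} (λ k → count (fun k)) ⟩
    sum {m ℕ.^ p} (λ k → ⟦ injective? (fun k) ⟧ 1 ℕ.* (m ∸ p))
      ≡⟨ *-distribʳ-sum {m ℕ.^ p} (m ∸ p) (λ k → ⟦ injective? (fun k) ⟧ 1) ⟨
    injections m p ℕ.* (m ∸ p) ∎
    where
    open ≡.≡-Reasoning
    fun : Fin (m ℕ.^ p) → Fin p → Fin m
    fun = finToFun
    split : ∀ i (f : Fin p → Fin m) → ⟦ injective? (extend i f) ⟧ 1 ≡ ⟦ injective? f ⟧ ⟦ ¬? (image? f i) ⟧ 1
    split i f = ≡.trans (ℕ∑.[]-⇔ (injective? (extend i f)) (injective? f ×-dec ¬? (image? f i)) to from) (ℕ∑.[]-× (injective? f) (¬? (image? f i)))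
      where
      to : Inj (extend i f) → Inj f × ¬ Image f i
      to inj = (λ eq → Fin.suc-injective (inj eq)) , λ (j , fj≡i) → contradiction (inj {zero} {suc j} (≡.sym fj≡i)) λ ()
      from : Inj f × ¬ Image f i → Inj (extend i f)
      from (inj , ∉) {zero}  {zero}  eq = ≡.refl
      from (inj , ∉) {zero}  {suc y} eq = contradiction (y , ≡.sym eq) ∉
      from (inj , ∉) {suc x} {zero}  eq = contradiction (x , eq) ∉
      from (inj , ∉) {suc x} {suc y} eq = cong suc (inj eq)
    count : ∀ (f : Fin p → Fin m) → sum {m} (λ i → ⟦ injective? (extend i f) ⟧ 1) ≡ ⟦ injective? f ⟧ 1 ℕ.* (m ∸ p)
    count f = ≡.trans (sum-cong-≋ {m} λ i → split i f) (≡.trans (≡.sym (ℕ∑.∑-allFin {n = m} (λ i → ⟦ injective? f ⟧ ⟦ ¬? (image? f i) ⟧ 1)))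
      (≡.trans (≡.sym (ℕ∑.[]-∑ (injective? f) (allFin m) _)) (last (injective? f))))
      where
      last : (d : Dec (Inj f)) → ⟦ d ⟧ ∑ⁿ (allFin m) (λ i → ⟦ ¬? (image? f i) ⟧ 1) ≡ ⟦ d ⟧ 1 ℕ.* (m ∸ p)
      last (yes inj) = ≡.trans (complement-size f inj) (≡.sym (ℕ.*-identityˡ _))
      last (no _)    = ≡.refl

  -- `injections-suc` splits off the smallest factor of a falling factorial, whereas the factorial
  -- unfolds by its largest.
  injections-suc-suc : ∀ m p → injections (suc m) (suc p) ≡ suc m ℕ.* injections m p
  injections-suc-suc m zero    = ≡.trans (injections-suc (suc m) 0) (ℕ.*-comm 1 (suc m))
  injections-suc-suc m (suc p) = begin
    injections (suc m) (suc (suc p))               ≡⟨ injections-suc (suc m) (suc p) ⟩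
    injections (suc m) (suc p) ℕ.* (m ∸ p)         ≡⟨ cong (ℕ._* (m ∸ p)) (injections-suc-suc m p) ⟩
    suc m ℕ.* injections m p ℕ.* (m ∸ p)           ≡⟨ ℕ.*-assoc (suc m) (injections m p) (m ∸ p) ⟩
    suc m ℕ.* (injections m p ℕ.* (m ∸ p))         ≡⟨ cong (suc m ℕ.*_) (injections-suc m p) ⟨
    suc m ℕ.* injections m (suc p)                 ∎
    where open ≡.≡-Reasoning

  injections-! : ∀ m → injections m m ≡ m !
  injections-! zero    = ≡.refl
  injections-! (suc m) = ≡.trans (injections-suc-suc m m) (cong (suc m ℕ.*_) (injections-! m))

  bijections-! : ∀ N → length (filter (λ k → bijective? {N} {N} (finToFun k)) (allFin (N ℕ.^ N))) ≡ N !
  bijections-! N = begin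
    length (filter (λ k → bijective? {N} {N} (finToFun k)) (allFin (N ℕ.^ N)))
      ≡⟨ length-filter _ (allFin (N ℕ.^ N)) ⟩
    ∑ⁿ (allFin (N ℕ.^ N)) (λ k → ⟦ bijective? {N} {N} (finToFun k) ⟧ 1)
      ≡⟨ ℕ∑.∑-cong (allFin (N ℕ.^ N)) (λ k → ℕ∑.[]-⇔ (bijective? {N} {N} (finToFun k)) (injective? (finToFun k)) proj₁
          (injective⇒bijective (finToFun k))) ⟩
    ∑ⁿ (allFin (N ℕ.^ N)) (λ k → ⟦ injective? {N} {N} (finToFun k) ⟧ 1)
      ≡⟨ ℕ∑.∑-allFin {n = N ℕ.^ N} (λ k → ⟦ injective? {N} {N} (finToFun k) ⟧ 1) ⟩
    injections N N
      ≡⟨ injections-! N ⟩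
    N ! ∎
    where open ≡.≡-Reasoning

module 𝕋 = Setoid 𝕋

≗-iso : ∀ {S T f g} → f ≗ g → IsIsomorphism S T f → IsIsomorphism S T g
≗-iso {S} {T} {f} {g} eq iso = record
  { bijective = (λ p → inj (≡.trans (eq _) (≡.trans p (≡.sym (eq _)))))
              , (λ y → proj₁ (surj y) , λ { ≡.refl → ≡.trans (≡.sym (eq _)) (proj₂ (surj y) ≡.refl) })
  ; adj-resp = λ u v → ≡.trans (IsIsomorphism.adj-resp iso u v) (cong₂ (Tree.adj T) (eq u) (eq v)) }
  where
  inj = proj₁ (IsIsomorphism.bijective iso)
  surj = proj₂ (IsIsomorphism.bijective iso)

funToFin-cong : ∀ {m n} {f g : Fin m → Fin n} → f ≗ g → funToFin f ≡ funToFin g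
funToFin-cong {zero}  eq = ≡.refl
funToFin-cong {suc m} eq = cong₂ combine (eq zero) (funToFin-cong (eq ∘ suc))

-- For equal arguments this is definitionally `automorphisms`. Maps are counted through their codes,
-- for which propositional equality is decidable.
isoCodes : (S T : Tree) → List (Fin (Tree.order T ℕ.^ Tree.order S))
isoCodes S T = filter (λ k → isIsomorphism? S T (finToFun k)) (allFin _)

isoCodes! : ∀ S T → Unique (isoCodes S T)
isoCodes! S T = Unique.filter⁺ (λ k → isIsomorphism? S T (finToFun k)) (Unique.allFin⁺ _)

∈-isoCodes⁺ : ∀ S T {f} → IsIsomorphism S T f → funToFin f ∈ isoCodes S T
∈-isoCodes⁺ S T {f} iso = List∈.∈-filter⁺ (λ k → isIsomorphism? S T (finToFun k)) (List∈.∈-allFin _) (≗-iso (≡.sym ∘ Fin.finToFun-funToFin f) iso)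

∈-isoCodes⁻ : ∀ S T {k} → k ∈ isoCodes S T → IsIsomorphism S T (finToFun k)
∈-isoCodes⁻ S T k∈ = proj₂ (List∈.∈-filter⁻ (λ k → isIsomorphism? S T (finToFun k)) {xs = allFin _} k∈)

infix 4 _≅?_
_≅?_ : ∀ S T → Dec (S ≅ T)
S ≅? T = map′ (λ (k , iso) → finToFun k , iso) (λ (f , iso) → funToFin f , ≗-iso (≡.sym ∘ Fin.finToFun-funToFin f) iso)
  (any? λ k → isIsomorphism? S T (finToFun k))

≅-order : ∀ {S T} → S ≅ T → Tree.order S ≡ Tree.order T
≅-order {S} {T} S≅T = ℕ.≤-antisym (bound S≅T) (bound (𝕋.sym {S} {T} S≅T))
  where
  bound : ∀ {S T} → S ≅ T → Tree.order S ℕ.≤ Tree.order T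
  bound (f , iso) = Fin.injective⇒≤ (proj₁ (IsIsomorphism.bijective iso))

-- Composition with one fixed isomorphism identifies the isomorphisms from `S` to `T` with the
-- automorphisms of `T`.
count-≅ : ∀ {S T} → S ≅ T → length (isoCodes S T) ≡ ∣Aut T ∣
count-≅ {S} {T} S≅T@(φ , iso) = length-bijection F G (isoCodes! S T) (isoCodes! T T) to from
  where
  φ⁻¹ : Tree.Vertex T → Tree.Vertex S
  φ⁻¹ = proj₁ (𝕋.sym {S} {T} S≅T)
  φφ⁻¹ : ∀ y → φ (φ⁻¹ y) ≡ y
  φφ⁻¹ y = proj₂ (proj₂ (IsIsomorphism.bijective iso) y) ≡.refl
  φ⁻¹φ : ∀ x → φ⁻¹ (φ x) ≡ x
  φ⁻¹φ x = proj₁ (IsIsomorphism.bijective iso) (φφ⁻¹ (φ x))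
  F : Fin (Tree.order T ℕ.^ Tree.order S) → Fin (Tree.order T ℕ.^ Tree.order T)
  F k = funToFin (finToFun {Tree.order T} {Tree.order S} k ∘ φ⁻¹)
  G : Fin (Tree.order T ℕ.^ Tree.order T) → Fin (Tree.order T ℕ.^ Tree.order S)
  G k = funToFin (finToFun {Tree.order T} {Tree.order T} k ∘ φ)
  to : ∀ {k} → k ∈ isoCodes S T → F k ∈ isoCodes T T × G (F k) ≡ k
  to {k} k∈ = ∈-isoCodes⁺ T T (proj₂ (𝕋.trans {T} {S} {T} (𝕋.sym {S} {T} S≅T) (finToFun k , ∈-isoCodes⁻ S T k∈)))
            , ≡.trans (funToFin-cong (λ x → ≡.trans (Fin.finToFun-funToFin (finToFun k ∘ φ⁻¹) (φ x)) (cong (finToFun k) (φ⁻¹φ x))))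
                      (Fin.funToFin-finToFin {Tree.order S} {Tree.order T} k)
  from : ∀ {k} → k ∈ isoCodes T T → G k ∈ isoCodes S T × F (G k) ≡ k
  from {k} k∈ = ∈-isoCodes⁺ S T (proj₂ (𝕋.trans {S} {T} {T} S≅T (finToFun k , ∈-isoCodes⁻ T T k∈)))
              , ≡.trans (funToFin-cong (λ y → ≡.trans (Fin.finToFun-funToFin (finToFun k ∘ φ) (φ⁻¹ y)) (cong (finToFun k) (φφ⁻¹ y))))
                        (Fin.funToFin-finToFin {Tree.order T} {Tree.order T} k)

count-≇ : ∀ {S T} → ¬ S ≅ T → length (isoCodes S T) ≡ 0
count-≇ {S} {T} S≇T = cong length (List.filter-none (λ k → isIsomorphism? S T (finToFun k))
    {xs = allFin (Tree.order T ℕ.^ Tree.order S)} (All.tabulate λ {k} _ iso → S≇T (finToFun k , iso)))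

module _ {N : ℕ} where

  treesIn : List (Mat N) → List Tree
  treesIn []       = []
  treesIn (M ∷ Ms) with treeOn? ⊤ M
  ... | yes t = toTree M t ∷ treesIn Ms
  ... | no _  = treesIn Ms

  ∈-treesIn⁻ : ∀ Ms {T} → T ∈ treesIn Ms → ∃[ M ] ∃[ t ] T ≡ toTree {N} M t
  ∈-treesIn⁻ (M ∷ Ms) T∈ with treeOn? ⊤ M
  ... | no _  = ∈-treesIn⁻ Ms T∈
  ∈-treesIn⁻ (M ∷ Ms) (here eq)  | yes t = M , t , eq
  ∈-treesIn⁻ (M ∷ Ms) (there T∈) | yes t = ∈-treesIn⁻ Ms T∈

  -- The tree listed for `M` carries the proof produced by `treeOn?`, which need not be the given
  -- one.
  ∈-treesIn⁺ : ∀ {Ms M} → M ∈ Ms → TreeOn ⊤ M → ∃[ t ] toTree {N} M t ∈ treesIn Ms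
  ∈-treesIn⁺ {M ∷ Ms} (here ≡.refl) t with treeOn? (⊤ {N}) M
  ... | yes t′ = t′ , here ≡.refl
  ... | no ¬t  = contradiction t ¬t
  ∈-treesIn⁺ {M′ ∷ Ms} (there M∈) t with treeOn? ⊤ M′ | ∈-treesIn⁺ M∈ t
  ... | yes _ | t′ , T∈ = t′ , there T∈
  ... | no _  | t′ , T∈ = t′ , T∈

  module _ {c ℓ} (𝕄 : CommutativeMonoid c ℓ) where
    open CommutativeMonoid 𝕄
    open ListSum 𝕄

    ∑-treesIn : ∀ Ms {f : Tree → Carrier} {g : Mat N → Carrier} → (∀ M (t : TreeOn (⊤ {N}) M) → f (toTree {N} M t) ≈ g M) →
                ∑ (treesIn Ms) f ≈ ∑ Ms (λ M → [ treeOn? ⊤ M ] g M)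
    ∑-treesIn []       eq = refl
    ∑-treesIn (M ∷ Ms) eq with treeOn? ⊤ M
    ... | yes t = ∙-cong (eq M t) (∑-treesIn Ms eq)
    ... | no _  = trans (∑-treesIn Ms eq) (sym (identityˡ _))

trees : ℕ → List Tree
trees N = treesIn (matrices N)

toTree-≅ : (T : Tree) (t : TreeOn ⊤ (mat (Tree.adj T))) → T ≅ toTree (mat (Tree.adj T)) t
toTree-≅ T t = id , record { bijective = (λ p → p) , (λ y → y , id) ; adj-resp = λ u v → ≡.sym (entry-mat (Tree.adj T) u v) }

-- Orbit–stabilizer for the symmetric group acting on the trees with vertex set Fin N.
orbit-count : ∀ T → ∑ⁿ (trees (Tree.order T)) (λ S → length (isoCodes S T)) ≡ Tree.order T !
orbit-count T = begin
  ∑ⁿ (trees N) (λ S → length (isoCodes S T))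
    ≡⟨ ∑-treesIn ℕ.+-0-commutativeMonoid (matrices N) (λ M t → ≡.trans (length-filter _ (allFin (N ℕ.^ N)))
         (ℕ∑.∑-cong (allFin (N ℕ.^ N)) λ k → ℕ∑.[]-⇔ (isIsomorphism? (toTree M t) T (finToFun k)) (iso? M k)
           (λ i → IsIsomorphism.bijective i , IsIsomorphism.adj-resp i) (λ (b , r) → record { bijective = b ; adj-resp = r }))) ⟩
  ∑ⁿ (matrices N) (λ M → ⟦ treeOn? ⊤ M ⟧ ∑ⁿ (allFin (N ℕ.^ N)) λ k → ⟦ iso? M k ⟧ 1)
    ≡⟨ ℕ∑.∑-cong (matrices N) (λ M → ≡.trans (ℕ∑.[]-∑ (treeOn? ⊤ M) (allFin (N ℕ.^ N)) _)
         (ℕ∑.∑-cong (allFin (N ℕ.^ N)) λ k → ≡.sym (ℕ∑.[]-× (treeOn? ⊤ M) (iso? M k)))) ⟩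
  ∑ⁿ (matrices N) (λ M → ∑ⁿ (allFin (N ℕ.^ N)) λ k → ⟦ treeOn? ⊤ M ×-dec iso? M k ⟧ 1)
    ≡⟨ ℕ∑.∑-cartesianProduct (matrices N) (allFin (N ℕ.^ N)) _ ⟨
  ∑ⁿ (cartesianProduct (matrices N) (allFin (N ℕ.^ N))) (λ x → ⟦ pair? x ⟧ 1)
    ≡⟨ length-filter pair? (cartesianProduct (matrices N) (allFin (N ℕ.^ N))) ⟨
  length (filter pair? (cartesianProduct (matrices N) (allFin (N ℕ.^ N))))
    -- For each bijection there is exactly one tree on `Fin N` that it maps isomorphically onto `T`,
    -- namely the pullback of `T`.
    ≡⟨ length-bijection proj₂ (λ k → pulled k , k)
         (Unique.filter⁺ pair? (Unique.cartesianProduct⁺ (matrices! N) (Unique.allFin⁺ _))) (Unique.filter⁺ bij? (Unique.allFin⁺ _)) to from ⟩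
  length (filter bij? (allFin (N ℕ.^ N)))
    ≡⟨ bijections-! N ⟩
  N ! ∎
  where
  open ≡.≡-Reasoning
  N : ℕ
  N = Tree.order T
  M₀ : Mat N
  M₀ = mat (Tree.adj T)
  fun : Fin (N ℕ.^ N) → Fin N → Fin N
  fun = finToFun
  Iso : Mat N → Fin (N ℕ.^ N) → Set
  Iso M k = Bijective _≡_ _≡_ (fun k) × (∀ u v → entry M u v ≡ Tree.adj T (fun k u) (fun k v))
  iso? : ∀ M k → Dec (Iso M k)
  iso? M k = bijective? (fun k) ×-dec (all? λ u → all? λ v → entry M u v ≟ᵇ Tree.adj T (fun k u) (fun k v))
  pair? : ((M , k) : Mat N × Fin (N ℕ.^ N)) → Dec (TreeOn ⊤ M × Iso M k)
  pair? (M , k) = treeOn? ⊤ M ×-dec iso? M k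
  bij? : ∀ k → Dec (Bijective _≡_ _≡_ (fun k))
  bij? k = bijective? (fun k)
  pulled : Fin (N ℕ.^ N) → Mat N
  pulled k = mat λ u v → entry M₀ (fun k u) (fun k v)
  pulled-entry : ∀ k u v → entry (pulled k) u v ≡ Tree.adj T (fun k u) (fun k v)
  pulled-entry k u v = ≡.trans (entry-mat (λ u v → entry M₀ (fun k u) (fun k v)) u v) (entry-mat (Tree.adj T) (fun k u) (fun k v))
  to : ∀ {x} → x ∈ filter pair? (cartesianProduct (matrices N) (allFin (N ℕ.^ N))) → proj₂ x ∈ filter bij? (allFin _) ×
      (pulled (proj₂ x) , proj₂ x) ≡ x
  to {M , k} x∈ with _ , b , r ← proj₂ (List∈.∈-filter⁻ pair? {xs = cartesianProduct (matrices N) (allFin (N ℕ.^ N))} x∈) =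
    List∈.∈-filter⁺ bij? (List∈.∈-allFin k) b , cong (_, k) (Vec-ext λ u → Vec-ext λ v → ≡.trans (pulled-entry k u v) (≡.sym (r u v)))
  from : ∀ {k} → k ∈ filter bij? (allFin _) → (pulled k , k) ∈ filter pair? (cartesianProduct (matrices N) (allFin (N ℕ.^ N))) × k ≡ k
  from {k} k∈ with b ← proj₂ (List∈.∈-filter⁻ bij? {xs = allFin _} k∈) =
    List∈.∈-filter⁺ pair? (List∈.∈-cartesianProduct⁺ (∈-matrices (pulled k)) (List∈.∈-allFin k))
      (pullback (fun k) b (fromTree T) , b , pulled-entry k) , ≡.refl

-- Representatives of isomorphism classes and sums over orbits

𝕋-dec : DecSetoid 0ℓ 0ℓ
𝕋-dec = record { Carrier = Tree ; _≈_ = _≅_ ; isDecEquivalence = record { isEquivalence = 𝕋.isEquivalence ; _≟_ = _≅?_ } }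

representatives : ℕ → List Tree
representatives N = deduplicate _≅?_ (trees N)

open SetoidMembership 𝕋 using () renaming (_∈_ to _∈≅_)
open SetoidUnique 𝕋 using () renaming (Unique to Unique≅)

representatives! : ∀ N → Unique≅ (representatives N)
representatives! N = DecSetoidUnique.deduplicate-! 𝕋-dec (trees N)

∈-representatives⁻ : ∀ N {T} → T ∈ representatives N → Tree.order T ≡ N
∈-representatives⁻ N T∈ with ∈-treesIn⁻ (matrices N) (List∈.∈-deduplicate⁻ _≅?_ (trees N) T∈)
... | _ , _ , ≡.refl = ≡.refl

trees⊆representatives : ∀ N {T} → T ∈ trees N → T ∈≅ representatives N
trees⊆representatives N {T} T∈ = SetoidMembershipProperties.∈-deduplicate⁺ 𝕋 _≅?_
    (λ {x} {y} {z} z≅y x≅y → 𝕋.trans {x} {y} {z} x≅y (𝕋.sym {z} {y} z≅y)) (lift T∈)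
  where
  lift : ∀ {xs} → T ∈ xs → T ∈≅ xs
  lift (here ≡.refl) = here (𝕋.refl {T})
  lift (there T∈)    = there (lift T∈)

∈≅-representatives : ∀ T → T ∈≅ representatives (Tree.order T)
∈≅-representatives T with t , T∈ ← ∈-treesIn⁺ (∈-matrices (mat (Tree.adj T))) (fromTree T) =
  SetoidMembershipProperties.∈-resp-≈ 𝕋 (𝕋.sym {T} (toTree-≅ T t)) (trees⊆representatives (Tree.order T) T∈)

module _ {c ℓ} (𝕄 : CommutativeMonoid c ℓ) where
  open CommutativeMonoid 𝕄
  open ListSum 𝕄

  -- Among pairwise non-isomorphic trees at most one is isomorphic to `S`, and membership provides
  -- it.
  ∑-class : ∀ {Ts S} → Unique≅ Ts → S ∈≅ Ts → ∀ x → ∑ Ts (λ T → [ S ≅? T ] x) ≈ x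
  ∑-class {T ∷ Ts} {S} (T∉ ∷ Ts!) (here S≅T) x = trans
    (∙-cong ([]-yes (S ≅? T) S≅T) (∑-ε∈ Ts λ {U} U∈ → []-no (S ≅? U) λ S≅U → All.lookup T∉ U∈ (𝕋.trans {T} {S} {U} (𝕋.sym {S} {T} S≅T) S≅U)))
    (identityʳ x)
  ∑-class {T ∷ Ts} {S} (T∉ ∷ Ts!) (there S∈) x =
    trans (∙-cong ([]-no (S ≅? T) λ S≅T → not-in-Ts S≅T S∈ T∉) (∑-class Ts! S∈ x)) (identityˡ x)
    where
    not-in-Ts : S ≅ T → ∀ {Us} → S ∈≅ Us → ¬ All (λ U → ¬ T ≅ U) Us
    not-in-Ts S≅T {U ∷ _} (here S≅U)  (T≇U ∷ _) = T≇U (𝕋.trans {T} {S} {U} (𝕋.sym {S} {T} S≅T) S≅U)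
    not-in-Ts S≅T         (there S∈) (_ ∷ T≇)  = not-in-Ts S≅T S∈ T≇

module OrbitSum {c ℓ n} (𝔸 : DifferentialAlgebra c ℓ n) where
  open DifferentialAlgebraProperties 𝔸
  open ListSum +-commutativeMonoid
  open Weights 𝔸 using (additive-∑; ·-additive)
  open import Relation.Binary.Reasoning.Setoid setoid

  ∑ⁿ-· : ∀ {a} {A : Set a} (xs : List A) (k : A → ℕ) x → ∑ⁿ xs k · x ≈ ∑ xs (λ a → k a · x)
  ∑ⁿ-· []       k x = refl
  ∑ⁿ-· (a ∷ xs) k x = trans (×-homo-+ x (k a) (∑ⁿ xs k)) (+-congˡ (∑ⁿ-· xs k x))

  -- Double counting of isomorphisms S → T, with S a tree on `Fin N` and T a representative. A fixed
  -- T is the target of N! of them; a fixed S is the source of |Aut T| many, all into its own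
  -- representative T.
  orbit-sum : ∀ N (f g : Tree → Carrier) → (∀ {S T} → S ≅ T → f S ≈ f T) → (∀ T → ∣Aut T ∣ · g T ≈ f T) →
              (N !) · ∑ (representatives N) g ≈ ∑ (trees N) f
  orbit-sum N f g invariant weight = begin
    (N !) · ∑ (representatives N) g
      ≈⟨ additive-∑ (·-additive (N !)) (representatives N) g ⟩
    ∑ (representatives N) (λ T → (N !) · g T)
      ≈⟨ ∑-cong∈ (representatives N) (λ {T} T∈ → trans (reflexive (cong (_· g T) (count T∈))) (∑ⁿ-· (trees N) (λ S → length (isoCodes S T)) (g T))) ⟩
    ∑ (representatives N) (λ T → ∑ (trees N) λ S → length (isoCodes S T) · g T)
      ≈⟨ ∑-cong (representatives N) (λ T → ∑-cong (trees N) λ S → term S T) ⟩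
    ∑ (representatives N) (λ T → ∑ (trees N) λ S → [ S ≅? T ] f S)
      ≈⟨ ∑-swap (representatives N) (trees N) (λ T S → [ S ≅? T ] f S) ⟩
    ∑ (trees N) (λ S → ∑ (representatives N) λ T → [ S ≅? T ] f S)
      ≈⟨ ∑-cong∈ (trees N) (λ {S} S∈ → ∑-class +-commutativeMonoid (representatives! N) (trees⊆representatives N S∈) (f S)) ⟩
    ∑ (trees N) f ∎
    where
    count : ∀ {T} → T ∈ representatives N → N ! ≡ ∑ⁿ (trees N) (λ S → length (isoCodes S T))
    count {T} T∈ with ≡.refl ← ∈-representatives⁻ N T∈ = ≡.sym (orbit-count T)
    term : ∀ S T → length (isoCodes S T) · g T ≈ [ S ≅? T ] f S
    term S T = cases (S ≅? T)
      where
      cases : (d : Dec (S ≅ T)) → length (isoCodes S T) · g T ≈ [ d ] f S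
      cases (yes S≅T) = trans (reflexive (cong (_· g T) (count-≅ {S} {T} S≅T))) (trans (weight T) (sym (invariant {S} {T} S≅T)))
      cases (no S≇T)  = reflexive (cong (_· g T) (count-≇ {S} {T} S≇T))

-- The tree expansion of the inverse

edgesOf-cong : ∀ {N} {adj adj′ : Fin N → Fin N → Bool} → (∀ u v → adj u v ≡ adj′ u v) → EdgeList.edgesOf adj ≡ EdgeList.edgesOf adj′
edgesOf-cong {N} {adj} {adj′} eq = List.filter-≐ (EdgeList.edge? adj) (EdgeList.edge? adj′)
  ((λ {e} (lt , a) → lt , subst T (eq (proj₁ e) (proj₂ e)) a) , (λ {e} (lt , a) → lt , subst T (≡.sym (eq (proj₁ e) (proj₂ e))) a)) (pairs N)

size+1≡order : ∀ t → suc (Tree.size t) ≡ Tree.order t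
size+1≡order t = ≡.trans (cong (suc ∘ length) (edgesOf-cong (λ u v → ≡.sym (entry-mat (Tree.adj t) u v))))
    (length-edges (Tree.order t) (Subset.∣⊤∣≡n (Tree.order t)) (fromTree t))

Endpoint : ∀ {N} → Fin N → Fin N × Fin N → Set
Endpoint v e = v ≡ proj₁ e ⊎ v ≡ proj₂ e

-- The first step of a walk from `v` to some other vertex uses an edge at `v`.
endpoint : ∀ t → 2 ℕ.≤ Tree.order t → ∀ v → Any (Endpoint v) (Tree.edges t)
endpoint t 2≤N v = first (Tree.connected t v (proj₁ (other 2≤N v))) (proj₂ (other 2≤N v))
  where
  open Tree t using (adj; _~_; irreflexive)
  other : ∀ {N} → 2 ℕ.≤ N → (v : Fin N) → ∃[ w ] v ≢ w
  other (s≤s (s≤s _)) zero    = suc zero , λ ()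
  other (s≤s (s≤s _)) (suc v) = zero , λ ()
  first : ∀ {v w} → Star _~_ v w → v ≢ w → Any (Endpoint v) (Tree.edges t)
  first ε⋆ v≢v = contradiction ≡.refl v≢v
  first {v} (_◅_ {j = x} vx _) _ with Fin.<-cmp v x
  ... | tri< v<x _ _ = Any.map (λ { ≡.refl → inj₁ ≡.refl }) (EdgeList.∈-edgesOf⁺ adj v<x vx)
  ... | tri≈ _ v≡x _ = contradiction vx (irreflexive v≡x)
  ... | tri> _ _ x<v = Any.map (λ { ≡.refl → inj₂ ≡.refl }) (EdgeList.∈-edgesOf⁺ adj x<v (Tree.symmetric t vx))

module Replacement {c ℓ n} (𝔸 : DifferentialAlgebra c ℓ n) where
  open DifferentialAlgebraProperties 𝔸
  open Weights 𝔸
  open import Algebra.Properties.CommutativeMonoid.Sum *-commutativeMonoid using () renaming (sum-cong-≋ to Π-cong)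

  module _ {N : ℕ} where

    ∂-derivative : ∀ i (u : Fin N) s t v → (∀ j → D j (s v) ≈ D j (t v)) → ∀ j → D j (∂ i u s v) ≈ D j (∂ i u t v)
    ∂-derivative i u s t v eq j with v ≟ u
    ... | yes _ = D-cong j (eq i)
    ... | no _  = eq j

    ∂-agree : ∀ i (u : Fin N) s t → (∀ j → D j (s u) ≈ D j (t u)) → ∂ i u s u ≈ ∂ i u t u
    ∂-agree i u s t eq = trans (∂-at i u s) (trans (eq i) (sym (∂-at i u t)))

    ∂-keep : ∀ i (u : Fin N) s t v → s v ≈ t v → ∂ i u s v ≈ ∂ i u t v
    ∂-keep i u s t v eq with v ≟ u
    ... | yes _ = D-cong i eq
    ... | no _  = eq

    -- At an endpoint of an edge only derivatives of the state matter.
    L-replace : ∀ es {s t : State N} → (∀ v j → D j (s v) ≈ D j (t v)) → (∀ v → s v ≈ t v ⊎ Any (Endpoint v) es) → L es s ≈ L es t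
    L-replace [] {s} {t} same cover = Π-cong agree
      where
      agree : ∀ v → s v ≈ t v
      agree v with cover v
      ... | inj₁ eq = eq
      ... | inj₂ ()
    L-replace ((x , y) ∷ es) {s} {t} same cover = sum-cong-≋ λ i → L-replace es
      (λ v → ∂-derivative i x (∂ i y s) (∂ i y t) v (∂-derivative i y s t v (same v))) (cover′ i)
      where
      cover′ : ∀ i v → ∂ i x (∂ i y s) v ≈ ∂ i x (∂ i y t) v ⊎ Any (Endpoint v) es
      cover′ i v with cover v
      ... | inj₁ eq                     = inj₁ (∂-keep i x (∂ i y s) (∂ i y t) v (∂-keep i y s t v eq))
      ... | inj₂ (here (inj₁ ≡.refl))   = inj₁ (∂-agree i x (∂ i y s) (∂ i y t) (∂-derivative i y s t x (same x)))
      ... | inj₂ (here (inj₂ ≡.refl))   = inj₁ (∂-keep i x (∂ i y s) (∂ i y t) y (∂-agree i y s t (same y)))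
      ... | inj₂ (there v∈)             = inj₂ v∈

module Series {c ℓ} (K : Commutativeℚ-Algebra c ℓ) (n : ℕ) where
  private module K = Commutativeℚ-Algebra K
  open Orders K n
  open PowerSeries K n using (_•_; 𝒬; HasSum)
  open Weights differentialAlgebra
  open Labelings differentialAlgebra
  open Replacement differentialAlgebra
  open OrbitSum differentialAlgebra
  open import Algebra.Properties.CommutativeMonoid.Sum ℕ.+-0-commutativeMonoid using () renaming (sum to sumℕ)
  open import Algebra.Properties.CommutativeMonoid.Sum *-commutativeMonoid using () renaming (sum to Π)
  open import Algebra.Properties.Semiring.Mult K.semiring using () renaming (×-assoc-* to K·-assoc-*; _×_ to _K×_)
  open import Relation.Binary.Reasoning.Setoid K.setoid
  open ℚ-Scalars K

  lower : ∀ {N} → Fin N → (Fin N → ℕ) → Fin N → ℕ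
  lower u o v with v ≟ u
  ... | yes _ = ℕ.pred (o v)
  ... | no _  = o v

  sum-lower : ∀ {N} (u : Fin N) o → sumℕ o ℕ.≤ suc (sumℕ (lower u o))
  sum-lower {suc N} zero    o = ℕ.+-monoˡ-≤ (sumℕ (o ∘ suc)) (≤-suc-pred (o zero))
    where
    ≤-suc-pred : ∀ k → k ℕ.≤ suc (ℕ.pred k)
    ≤-suc-pred zero    = z≤n
    ≤-suc-pred (suc k) = ℕ.≤-refl
  sum-lower {suc N} (suc u) o = ℕ.≤-trans (ℕ.+-monoʳ-≤ (o zero) (sum-lower u (o ∘ suc)))
    (ℕ.≤-reflexive (≡.trans (ℕ.+-suc (o zero) _) (cong (λ k → suc (o zero ℕ.+ k)) (sumℕ-cong later))))
    where
    open import Algebra.Properties.CommutativeMonoid.Sum ℕ.+-0-commutativeMonoid using () renaming (sum-cong-≗ to sumℕ-cong)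
    later : ∀ v → lower u (o ∘ suc) v ≡ lower (suc u) o (suc v)
    later v with v ≟ u
    ... | yes _ = ≡.refl
    ... | no _  = ≡.refl

  order-Π : ∀ {N} (s : State N) o → (∀ v → OnlyDegrees≥ (o v) (s v)) → OnlyDegrees≥ (sumℕ o) (Π s)
  order-Π {zero}  s o os = order-any 1#
  order-Π {suc N} s o os = order-* (os zero) (order-Π (s ∘ suc) (o ∘ suc) (os ∘ suc))

  order-∂ : ∀ {N} i (u : Fin N) s o → (∀ v → OnlyDegrees≥ (o v) (s v)) → ∀ v → OnlyDegrees≥ (lower u o v) (∂ i u s v)
  order-∂ i u s o os v with v ≟ u
  ... | no _  = os v
  ... | yes _ = pred (o v) (os v)
    where
    pred : ∀ k → OnlyDegrees≥ k (s v) → OnlyDegrees≥ (ℕ.pred k) (D i (s v))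
    pred zero    _ = order-any (D i (s v))
    pred (suc k) p = order-D {f = s v} i p

  -- Every edge applies two derivatives, and each lowers the total order by at most one.
  order-L : ∀ {N} es (s : State N) o → (∀ v → OnlyDegrees≥ (o v) (s v)) → OnlyDegrees≥ (sumℕ o ∸ (length es ℕ.+ length es)) (L es s)
  order-L []             s o os = order-Π s o os
  order-L ((x , y) ∷ es) s o os = order-sum (λ i → L es (∂ i x (∂ i y s))) λ i →
    order-mono bound (order-L es (∂ i x (∂ i y s)) (lower x (lower y o)) (order-∂ i x (∂ i y s) (lower y o) (order-∂ i y s o os)))
    where
    l : ℕ
    l = length es
    bound : sumℕ o ∸ (suc l ℕ.+ suc l) ℕ.≤ sumℕ (lower x (lower y o)) ∸ (l ℕ.+ l)
    bound = ℕ.≤-trans (ℕ.∸-monoˡ-≤ (suc l ℕ.+ suc l) (ℕ.≤-trans (sum-lower y o) (s≤s (sum-lower x (lower y o)))))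
      (ℕ.≤-reflexive (cong (2 ℕ.+ sumℕ (lower x (lower y o)) ∸_) (cong suc (ℕ.+-suc l l))))

  module _ (P : K[[X]]) where

    𝒬≈L : ∀ t → 𝒬 t P ≈ L (Tree.edges t) (λ _ → P)
    𝒬≈L t = sum-labeled (Tree.edges t) (λ _ → P) (edgesOf-distinct (Tree.adj t))

    𝒬-invariant : ∀ {S t} → S ≅ t → 𝒬 S P ≈ 𝒬 t P
    𝒬-invariant {S} {t} (f , iso) α = begin
      𝒬 S P α                            ≈⟨ 𝒬≈L S α ⟩
      L (Tree.edges S) (λ _ → P) α       ≈⟨ L-isomorphic {adj = Tree.adj S} {Tree.adj t} (Tree.symmetric t) (Tree.symmetric S) f
          (IsIsomorphism.bijective iso) (IsIsomorphism.adj-resp iso) (λ _ → P) α ⟩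
      L (Tree.edges t) (λ _ → P) α       ≈⟨ 𝒬≈L t α ⟨
      𝒬 t P α                            ∎

    1/Aut•𝒬 : Tree → K[[X]]
    1/Aut•𝒬 t = 1/∣Aut t ∣ • 𝒬 t P

    Aut-weight : ∀ t → ∣Aut t ∣ · 1/Aut•𝒬 t ≈ 𝒬 t P
    Aut-weight t α = begin
      (∣Aut t ∣ · 1/Aut•𝒬 t) α                                 ≡⟨ PSA.·-coefficient ∣Aut t ∣ (1/Aut•𝒬 t) α ⟩
      ∣Aut t ∣ K× (K.fromℚ 1/∣Aut t ∣ K.* 𝒬 t P α)             ≈⟨ K·-assoc-* ∣Aut t ∣ _ _ ⟨
      (∣Aut t ∣ K× K.fromℚ 1/∣Aut t ∣) K.* 𝒬 t P α             ≈⟨ K.*-congʳ (inverse ∣Aut t ∣ {{∣Aut∣-nonZero t}}) ⟩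
      K.1# K.* 𝒬 t P α                                         ≈⟨ K.*-identityˡ _ ⟩
      𝒬 t P α                                                  ∎
      where
      inverse : ∀ k .{{nz : NonZero k}} → k K× K.fromℚ ((+ 1 ℚ./ k) {{nz}}) K.≈ K.1#
      inverse (suc k) = ·-fromℚ-1/ k

    open TreeSeries differentialAlgebra P
    open Potential P
    module A∑ = ListSum +-commutativeMonoid
    module K∑ = ListSum K.+-commutativeMonoid

    ∑-coefficient : ∀ {a} {A : Set a} (xs : List A) (f : A → K[[X]]) α → A∑.∑ xs f α ≡ K∑.∑ xs (λ x → f x α)
    ∑-coefficient []       f α = ≡.refl
    ∑-coefficient (x ∷ xs) f α = cong (f x α K.+_) (∑-coefficient xs f α)

    ∑-representatives : ∀ N → A∑.∑ (representatives N) 1/Aut•𝒬 ≈ q N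
    ∑-representatives N = !-cancel N {A∑.∑ (representatives N) 1/Aut•𝒬} {q N} λ α → begin
      ((N !) · A∑.∑ (representatives N) 1/Aut•𝒬) α
        ≈⟨ orbit-sum N (λ t → 𝒬 t P) 1/Aut•𝒬 (λ {S} {t} → 𝒬-invariant {S} {t}) Aut-weight α ⟩
      A∑.∑ (trees N) (λ t → 𝒬 t P) α
        ≈⟨ ∑-treesIn +-commutativeMonoid (matrices N) {λ t → 𝒬 t P} {weight ⊤} 𝒬≈weight α ⟩
      s N α
        ≈⟨ !·q N α ⟨
      ((N !) · q N) α ∎
      where
      𝒬≈weight : ∀ (M : Mat N) (t : TreeOn ⊤ M) → 𝒬 (toTree M t) P ≈ weight ⊤ M
      𝒬≈weight M t α = K.trans (𝒬≈L (toTree M t) α) (L-cong (edges M) {λ _ → P} {potential ⊤}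
          (λ v α → K.sym (potential-in {A = ⊤} {v} Subset.∈⊤ α)) α)

    module _ (P-order : ∀ i → OnlyDegrees≥ 2 (∇ P i)) where

      -- `P` without its constant term, which the bound on the gradient does not control. All
      -- derivatives are unchanged.
      reduced : K[[X]]
      reduced = P + - const (P 0ᵐ)

      D-reduced : ∀ i → D i P ≈ D i reduced
      D-reduced i α = K.sym (begin
        D i reduced α                                ≈⟨ D-+ i P (- const (P 0ᵐ)) α ⟩
        D i P α K.+ D i (- const (P 0ᵐ)) α           ≈⟨ K.+-congˡ
            (K.trans (Additive.Φ-neg (D-additive i) (const (P 0ᵐ)) α) (K.trans (K.-‿cong (D-const (P 0ᵐ) i α)) -0#≈0#)) ⟩
        D i P α K.+ K.0#                             ≈⟨ K.+-identityʳ _ ⟩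
        D i P α                                      ∎)
        where open import Algebra.Properties.Ring K.ring using (-0#≈0#)

      -- A coefficient of positive degree is recovered from a derivative of `P` by dividing by its
      -- exponent, so the bound 2 on the gradient becomes 3.
      order-reduced : OnlyDegrees≥ 3 reduced
      order-reduced α lt with 0-or-%= α
      ... | inj₁ ≡.refl = K.trans (K.+-congˡ (K.-‿cong (K.trans (K.*-congˡ (monomial-yes 0ᵐ)) (K.*-identityʳ _)))) (K.-‿inverseʳ _)
      ... | inj₂ (j , β , ≡.refl) = begin
        P (β [ j ]%= suc) K.+ K.- (P 0ᵐ K.* 1# (β [ j ]%= suc))
          ≈⟨ K.+-cong P≈0 (K.-‿cong (K.trans (K.*-congˡ (monomial-no (%=≢0 β j))) (K.zeroʳ _))) ⟩
        K.0# K.+ K.- K.0#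
          ≈⟨ K.-‿inverseʳ K.0# ⟩
        K.0# ∎
        where
        k : ℕ
        k = lookup β j
        P≈0 : P (β [ j ]%= suc) K.≈ K.0#
        P≈0 = begin
          P (β [ j ]%= suc)                                                         ≈⟨ K.*-identityˡ _ ⟨
          K.1# K.* P (β [ j ]%= suc)                                                ≈⟨ K.*-congʳ (·-fromℚ-1/ k) ⟨
          (suc k K× K.fromℚ (+ 1 ℚ./ suc k)) K.* P (β [ j ]%= suc)                  ≈⟨ K.trans (K·-assoc-* (suc k) _ _)
              (K.sym (K·-comm-* (suc k) _ _)) ⟩
          K.fromℚ (+ 1 ℚ./ suc k) K.* D j P β                                       ≈⟨ K.*-congˡ
              (P-order j β (ℕ.≤-pred (subst (ℕ._< 3) (deg-%= β j) lt))) ⟩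
          K.fromℚ (+ 1 ℚ./ suc k) K.* K.0#                                          ≈⟨ K.zeroʳ _ ⟩
          K.0#                                                                      ∎
          where open import Algebra.Properties.Semiring.Mult K.semiring using () renaming (×-comm-* to K·-comm-*)

      -- N factors of order 3 lose at most two degrees for each of the N - 1 edges, and 3 N - 2 (N -
      -- 1) exceeds N. From two vertices on, each vertex meets an edge, so `P` may be replaced by
      -- `reduced`.
      order-𝒬 : ∀ t → 2 ℕ.≤ Tree.order t → OnlyDegrees≥ (Tree.order t) (𝒬 t P)
      order-𝒬 t 2≤N = order-mono bound (order-cong {f = L (Tree.edges t) (λ _ → reduced)} (λ α → K.sym (K.trans (𝒬≈L t α) (replace α)))
        (order-L (Tree.edges t) (λ _ → reduced) (λ _ → 3) (λ _ → order-reduced)))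
        where
        N m : ℕ
        N = Tree.order t
        m = Tree.size t
        replace : L (Tree.edges t) (λ _ → P) ≈ L (Tree.edges t) (λ _ → reduced)
        replace = L-replace (Tree.edges t) (λ _ → D-reduced) (λ v → inj₂ (endpoint t 2≤N v))
        sum-3 : ∀ N → sumℕ {N} (λ _ → 3) ≡ N ℕ.+ (N ℕ.+ N)
        sum-3 zero    = ≡.refl
        sum-3 (suc N) = ≡.trans (cong (3 ℕ.+_) (sum-3 N)) (solve 1
            (λ N → con 3 :+ (N :+ (N :+ N)) := (con 1 :+ N) :+ ((con 1 :+ N) :+ (con 1 :+ N))) ≡.refl N)
          where
          open import Data.Nat.Solver
          open +-*-Solver
        m≤N : m ℕ.≤ N
        m≤N = subst (m ℕ.≤_) (size+1≡order t) (ℕ.n≤1+n m)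
        bound : N ℕ.≤ sumℕ {N} (λ _ → 3) ∸ (m ℕ.+ m)
        bound = ℕ.≤-trans (ℕ.≤-reflexive (≡.sym (ℕ.m+n∸n≡m N (N ℕ.+ N))))
          (ℕ.≤-trans (ℕ.∸-monoʳ-≤ (N ℕ.+ (N ℕ.+ N)) (ℕ.+-mono-≤ m≤N m≤N)) (ℕ.≤-reflexive (cong (_∸ (m ℕ.+ m)) (≡.sym (sum-3 N)))))

      -- The exponent of t is one less than the number of vertices.
      open Inverse P P-order (q ∘ suc) (λ j → D-cong j {q 1} {P} q-1) D-q-equation public

      -- One tree for each isomorphism class of order at most b + 1.
      upTo : ℕ → List Tree
      upTo zero    = representatives 1
      upTo (suc b) = upTo b ++ representatives (suc (suc b))

      order-representative : ∀ N {t} → t ∈≅ representatives N → Tree.order t ≡ N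
      order-representative N {t} t∈ with S , S∈ , t≅S ← find t∈ = ≡.trans (≅-order {t} {S} t≅S) (∈-representatives⁻ N S∈)

      order-upTo : ∀ b {t} → t ∈≅ upTo b → Tree.order t ℕ.≤ suc b
      order-upTo zero    {t} t∈ = ℕ.≤-reflexive (order-representative 1 {t} t∈)
      order-upTo (suc b) {t} t∈ with SetoidMembershipProperties.∈-++⁻ 𝕋 (upTo b) t∈
      ... | inj₁ t∈₁ = ℕ.m≤n⇒m≤1+n (order-upTo b {t} t∈₁)
      ... | inj₂ t∈₂ = ℕ.≤-reflexive (order-representative (suc (suc b)) {t} t∈₂)

      upTo! : ∀ b → Unique≅ (upTo b)
      upTo! zero    = representatives! 1
      upTo! (suc b) = SetoidUniqueProperties.++⁺ 𝕋 (upTo! b) (representatives! (suc (suc b))) λ {t} (t∈₁ , t∈₂) →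
        ℕ.<-irrefl (order-representative (suc (suc b)) {t} t∈₂) (s≤s (order-upTo b {t} t∈₁))

      ∈-upTo : ∀ b t → Tree.order t ℕ.≤ suc b → t ∈≅ upTo b
      ∈-upTo zero t ≤1 = subst (λ N → t ∈≅ representatives N) (ℕ.≤-antisym ≤1 (ℕ.n≢0⇒n>0 (ℕ.≢-nonZero⁻¹ _ {{Tree.nonEmpty t}})))
          (∈≅-representatives t)
      ∈-upTo (suc b) t ≤2+b with ℕ.m≤n⇒m<n∨m≡n ≤2+b
      ... | inj₁ (s≤s ≤1+b) = SetoidMembershipProperties.∈-++⁺ˡ 𝕋 (∈-upTo b t ≤1+b)
      ... | inj₂ eq         = SetoidMembershipProperties.∈-++⁺ʳ 𝕋 (upTo b) (subst (λ N → t ∈≅ representatives N) eq (∈≅-representatives t))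

      ∑-upTo : ∀ b α → K∑.∑ (upTo b) (λ t → 1/Aut•𝒬 t α) K.≈ KC.conv b (λ k _ → q (suc k) α)
      ∑-upTo zero    α = K.trans (K.reflexive (≡.sym (∑-coefficient (representatives 1) 1/Aut•𝒬 α))) (∑-representatives 1 α)
      ∑-upTo (suc b) α = begin
        K∑.∑ (upTo b ++ representatives (suc (suc b))) (λ t → 1/Aut•𝒬 t α)
          ≈⟨ K∑.∑-++ (upTo b) (representatives (suc (suc b))) _ ⟩
        K∑.∑ (upTo b) (λ t → 1/Aut•𝒬 t α) K.+ K∑.∑ (representatives (suc (suc b))) (λ t → 1/Aut•𝒬 t α)
          ≈⟨ K.+-cong (∑-upTo b α) (K.trans (K.reflexive (≡.sym (∑-coefficient (representatives (suc (suc b))) 1/Aut•𝒬 α)))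
              (∑-representatives (suc (suc b)) α)) ⟩
        KC.conv b (λ k _ → q (suc k) α) K.+ q (suc (suc b)) α
          ≈⟨ KC.conv-last b (λ k _ → q (suc k) α) ⟨
        KC.conv (suc b) (λ k _ → q (suc k) α) ∎

      order-1/Aut•𝒬 : ∀ t → 2 ℕ.≤ Tree.order t → OnlyDegrees≥ (Tree.order t) (1/Aut•𝒬 t)
      order-1/Aut•𝒬 t 2≤N α lt = K.trans (K.*-congˡ (order-𝒬 t 2≤N α lt)) (K.zeroʳ _)

      -- A class missing from the list has more than `deg α` + 1 vertices, in particular at least
      -- two, so `order-𝒬` applies. The one-vertex tree, which may contribute in degree 0, is always
      -- listed.
      vanish : ∀ α t → ¬ t ∈≅ upTo (deg α) → 1/Aut•𝒬 t α K.≈ K.0#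
      vanish α t t∉ = order-1/Aut•𝒬 t (ℕ.≤-trans (s≤s (s≤s z≤n)) large) α (ℕ.<-trans (ℕ.n<1+n (deg α)) large)
        where
        large : suc (deg α) ℕ.< Tree.order t
        large = ℕ.≰⇒> (λ small → t∉ (∈-upTo (deg α) t small))

      hasSum : HasSum 𝕋 1/Aut•𝒬 Q
      hasSum α = upTo (deg α) , upTo! (deg α) , vanish α , ∑-upTo (deg α) α

theorem2p3 : ∀ {c ℓ} (K : Commutativeℚ-Algebra c ℓ) (n : ℕ) .{{_ : NonZero n}} →
    let open PowerSeries K n in
    (P : K[[X]]) → (∀ i → OnlyDegrees≥ 2 (∇ P i)) →
    (G : FormalMap) → IsFormalInverse (X ⊖ ∇ P) G →
    ∃[ Q ] HasSum 𝕋 (λ T → 1/∣Aut T ∣ • 𝒬 T P) Q × G ≋ X ⊕ ∇ Q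
theorem2p3 K n P P-order G inverse = Q P P-order , hasSum P P-order , inverse-gradient P P-order G (PowerSeries.IsFormalInverse.inverseˡ inverse)
  where open Series K n
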